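{- Let $\ell>3$ be a prime, $a\in\mathbb{Z}_{\ge1}$, and $b\in\mathbb{Z}$. Suppose that $H(an+b)\equiv 0\pmod{\ell}$ for all integers $n$. Then $H(an+bu^2)\equiv 0\pmod{\ell}$ for all integers $u$ with $\gcd(u,a)=1$ and all integers $n$.
   Context: $H(D)$ denotes the Hurwitz class number: $H(0)=-1/12$; for $D>0$ with $-D\equiv 0,1\pmod 4$, $H(D)$ is the number of $\mathrm{SL}_2(\mathbb{Z})$-equivalence classes of positive definite integral binary quadratic forms of discriminant $-D$, where classes containing a multiple of $x^2+y^2$ are counted with weight $1/2$ and classes containing a multiple of $x^2+xy+y^2$ with weight $1/3$; and $H(D)=0$ for all other integers $D$ (in particular for $D<0$). Congruences modulo $\ell$ between these rational numbers (whose denominators are prime to $\ell$) are understood in $\mathbb{Z}_{(\ell)}$. -}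

module Defs where

open import Data.Nat as ℕ using (ℕ)
open import Data.Nat.Divisibility as ℕD using ()
open import Data.Integer as ℤ using (ℤ; +_; -[1+_]; _*_; _+_; _-_; _<_; 0ℤ; 1ℤ)
open import Data.Rational as ℚ using (ℚ; ↥_)
open import Data.Product using (Σ; ∃; _×_; _,_; proj₁; proj₂)
open import Data.Sum using (_⊎_)
open import Data.List using (List; foldr; map)
open import Data.List.Relation.Unary.All using (All)
open import Data.List.Relation.Unary.Any using (Any)
open import Data.List.Relation.Unary.AllPairs using (AllPairs)
open import Relation.Binary.PropositionalEquality using (_≡_; _≢_)
open import Relation.Nullary using (¬_)

record Form : Set where
  constructor form
  field
    A B C : ℤ
open Form public

value : Form → ℤ → ℤ → ℤ
value (form a b c) x y = a * x * x + b * x * y + c * y * y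

disc : Form → ℤ
disc (form a b c) = b * b - (+ 4) * a * c

PositiveDefinite : Form → Set
PositiveDefinite f = ∀ x y → ¬ (x ≡ 0ℤ × y ≡ 0ℤ) → 0ℤ < value f x y

-- f ∘ [[α, β],[γ, δ]] :  (x,y) ↦ f(α x + β y, γ x + δ y)
act : Form → ℤ → ℤ → ℤ → ℤ → Form
act f α β γ δ = form (value f α γ)
                     ((+ 2) * A f * α * β + B f * (α * δ + β * γ) + (+ 2) * C f * γ * δ)
                     (value f β δ)

_∼_ : Form → Form → Set
f ∼ g = Σ ℤ λ α → Σ ℤ λ β → Σ ℤ λ γ → Σ ℤ λ δ →
          (α * δ - β * γ ≡ 1ℤ) × (act f α β γ δ ≡ g)

ContainsMultSq : Form → Set
ContainsMultSq f = ∃ λ k → f ∼ form k 0ℤ k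

ContainsMultHex : Form → Set
ContainsMultHex f = ∃ λ k → f ∼ form k k k

data Weight (f : Form) : ℚ → Set where
  wSq    : ContainsMultSq f → Weight f ((+ 1) ℚ./ 2)
  wHex   : ContainsMultHex f → Weight f ((+ 1) ℚ./ 3)
  wOther : ¬ ContainsMultSq f → ¬ ContainsMultHex f → Weight f ℚ.1ℚ

DiscCong : ℤ → Set
DiscCong D = ∃ λ k → (ℤ.- D ≡ (+ 4) * k) ⊎ (ℤ.- D ≡ (+ 4) * k + 1ℤ)

sumℚ : List ℚ → ℚ
sumℚ = foldr ℚ._+_ ℚ.0ℚ

data IsHurwitz : ℤ → ℚ → Set where
  hZero  : IsHurwitz 0ℤ (-[1+ 0 ] ℚ./ 12)
  hPos   : ∀ {D} → 0ℤ < D → DiscCong D →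
           (reps : List (Form × ℚ)) →
           All (λ p → PositiveDefinite (proj₁ p) × (disc (proj₁ p) ≡ ℤ.- D)
                      × Weight (proj₁ p) (proj₂ p)) reps →
           AllPairs (λ p q → ¬ (proj₁ p ∼ proj₁ q)) reps →
           (∀ g → PositiveDefinite g → disc g ≡ ℤ.- D →
                  Any (λ p → g ∼ proj₁ p) reps) →
           IsHurwitz D (sumℚ (map proj₂ reps))
  hOther : ∀ {D} → D ≢ 0ℤ → ¬ (0ℤ < D × DiscCong D) → IsHurwitz D ℚ.0ℚ

-- q ≡ 0 (mod ℓ) in ℤ_(ℓ).  Since ℚ is stored in lowest terms, for q with
-- denominator prime to ℓ this is ℓ ∣ numerator q.
ZeroMod : ℕ → ℚ → Set
ZeroMod ℓ q = ℓ ℕD.∣ ℤ.∣ ↥ q ∣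

{-# OPTIONS --safe #-}

-- For odd primes p the Hurwitz numbers satisfy H(p²D) = (p + 1 - χ(p)) H(D) if p ∤ D, where χ(p) = ±1 according to
-- whether -D is a square modulo p, and H(p⁴D) + p H(D) = (p + 1) H(p²D). Both come from counting in two ways, weighted
-- by automorphisms, the matrices of determinant p that carry a form of discriminant -D to one of discriminant -p²D.
--
-- Let D ≡ b u² and w u ≡ 1 (mod a). Then x²D ≡ b (mod a), hence H(x²D) ≡ 0 (mod ℓ), for every x ≡ w (mod a), and a good
-- choice of x gives H(D) ≡ 0. If w is a square s² modulo a, take x = s² + Dy² with a suitable y divisible by a: all
-- primes dividing x are split, so H(x²D) = x H(D) with x prime to ℓ. In general w is a square times distinct primes p
-- not dividing D. Since p³ and p agree modulo squares, each such p can be removed by replacing D with p²D and with p⁶D,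
-- and H(p²D) ≡ H(p⁶D) ≡ 0 already forces H(D) ≡ 0. No primes in arithmetic progressions are needed.

module Submission where

open import Defs
open import Data.Bool using (if_then_else_)
open import Data.Fin as Fin using (Fin; zero; suc; toℕ; fromℕ<)
import Data.Fin.Properties as Fin
open import Data.Integer as ℤ hiding (_⊓_; _⊔_; suc; pred; NonZero; Positive; Negative; sign; ∣_∣)
import Data.Integer.Properties as ℤ
open import Data.Integer.DivMod using (_%ℕ_; _/ℕ_; n%ℕd<d; a≡a%ℕn+[a/ℕn]*n)
open import Data.Integer.Divisibility.Signed using (_∣_; divides; _∣?_; ∣⇒∣ᵤ; ∣ᵤ⇒∣; ∣m∣n⇒∣m+n; ∣n⇒∣m*n; ∣m⇒∣m*n; m∣∣m∣; ∣m∣∣m; ∣-trans; ∣-refl; *-cancelˡ-∣; *-monoʳ-∣)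
open import Data.Integer.GCD using (gcd)
open import Data.Integer.Solver using (module +-*-Solver)
open +-*-Solver using (Polynomial; solve; con; _:=_; _:+_; _:*_; _:-_; :-_)
open import Data.List as List using (List; []; _∷_; length; lookup; concat; tabulate; upTo; _++_; cartesianProduct; cartesianProductWith)
import Data.List.Properties as List
open import Data.List.Membership.Propositional using (_∈_)
open import Data.List.Membership.Propositional.Properties using (∈-map⁺; ∈-map⁻; ∈-concat⁺′; ∈-concat⁻′; ∈-tabulate⁺; ∈-tabulate⁻; ∈-lookup; ∈-++⁺ˡ; ∈-++⁺ʳ; ∈-upTo⁺; ∈-cartesianProduct⁺; ∈-cartesianProductWith⁺)
open import Data.List.Membership.Propositional.Properties.WithK using (unique∧set⇒bag)
open import Data.List.Relation.Binary.BagAndSetEquality using (∼bag⇒↭)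
open import Data.List.Relation.Binary.Permutation.Propositional.Properties using (↭-length)
open import Data.List.Relation.Unary.All as All using (All; []; _∷_)
import Data.List.Relation.Unary.All.Properties as All
open import Data.List.Relation.Unary.AllPairs as AllPairs using (AllPairs; []; _∷_)
import Data.List.Relation.Unary.AllPairs.Properties as AllPairs
open import Data.List.Relation.Unary.Any as Any using (Any; here; there)
import Data.List.Relation.Unary.Any.Properties as Any
open import Data.List.Relation.Unary.Unique.Propositional using (Unique)
import Data.List.Relation.Unary.Unique.Propositional.Properties as Unique
open import Data.Maybe using (Maybe; just; nothing)
open import Data.Maybe.Properties using (just-injective)
open import Data.Nat as ℕ using (ℕ; zero; suc)
import Data.Nat.Properties as ℕ
open import Data.Nat.Coprimality as Coprime using (Coprime)
import Data.Nat.Divisibility as ℕ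
open import Data.Nat.GCD using (module Bézout)
open import Data.Nat.Induction using (Acc; acc; <-wellFounded)
open import Data.Nat.ListAction using (product)
open import Data.Nat.Primality using (Prime; euclidsLemma; prime⇒nonZero; prime⇒nonTrivial; prime⇒irreducible; ¬prime[1]; prime[2])
open import Data.Nat.Primality.Factorisation using (factorise; module PrimeFactorisation; factorisationHasAllPrimeFactors)
open import Data.Nat.Tactic.RingSolver using () renaming (solve-∀ to ℕ-solve-∀)
open import Data.Product using (Σ; _×_; _,_; proj₁; proj₂)
open import Data.Rational as ℚ using (ℚ; mkℚ; toℚᵘ)
import Data.Rational.Properties as ℚ
open import Data.Rational.Unnormalised as ℚᵘ using (mkℚᵘ; *≡*)
import Data.Rational.Unnormalised.Properties as ℚᵘ
open import Data.Sum using (_⊎_; inj₁; inj₂; [_,_])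
open import Function using (_∘_; mk⇔)
open import Relation.Binary.Definitions using (tri<; tri≈; tri>)
open import Relation.Binary.PropositionalEquality hiding ([_])
open import Relation.Nullary using (¬_; Dec; yes; no; contradiction; does)
open import Relation.Nullary.Decidable using (dec-true; dec-false; ¬¬-excluded-middle; decidable-stable)
open import Algebra.Properties.Semiring.Sum ℕ.+-*-semiring using (sum-syntax; sum-cong-≗; ∑-comm; *-distribˡ-sum; *-distribʳ-sum; ∑-distrib-+)

-- Integral matrices acting on forms

-- All counts are of 6 H(D): the weights 1, 1/2, 1/3 become 6, 3, 2, and 6 is prime to ℓ. Weight
-- times number of automorphisms is then always 12, which lets a plain count of matrices produce
-- weighted class counts. The obstacle is an inert prime p, where H(p²D) = (p + 2) H(D) and p + 2
-- may vanish modulo ℓ, so that a single multiple of D may carry no information. The exponents 2 and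
-- 6 arise as follows. If H(x²D) ≡ 0 for all x ≡ c (mod a), then x = p^k y gives the same statement
-- for p^(2k) D and the residue c / p^k. For even k the square class of c is unchanged; k = 1 and k
-- = 3 are the first two odd exponents, and c / p and c / p³ differ by the square of a unit modulo
-- a. The value at p⁴D is not known to vanish, but the three-term relation ties it to its
-- neighbours.

record Mat : Set where
  constructor mat
  field
    m₁₁ m₁₂ m₂₁ m₂₂ : ℤ

open Mat public

scalar : ℤ → Mat
scalar s = mat s 0ℤ 0ℤ s

𝟙 : Mat
𝟙 = scalar 1ℤ

mat-≡ : ∀ {α β γ δ α′ β′ γ′ δ′} → α ≡ α′ → β ≡ β′ → γ ≡ γ′ → δ ≡ δ′ → mat α β γ δ ≡ mat α′ β′ γ′ δ′
mat-≡ refl refl refl refl = refl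

form-≡ : ∀ {a b c a′ b′ c′} → a ≡ a′ → b ≡ b′ → c ≡ c′ → form a b c ≡ form a′ b′ c′
form-≡ refl refl refl = refl

private
  valueP : ∀ {n} → (a b c x y : Polynomial n) → Polynomial n
  valueP a b c x y = a :* x :* x :+ b :* x :* y :+ c :* y :* y

  crossP : ∀ {n} → (a b c α β γ δ : Polynomial n) → Polynomial n
  crossP a b c α β γ δ = con (+ 2) :* a :* α :* β :+ b :* (α :* δ :+ β :* γ) :+ con (+ 2) :* c :* γ :* δ

  discP : ∀ {n} → (a b c : Polynomial n) → Polynomial n
  discP a b c = b :* b :- con (+ 4) :* a :* c

infixl 7 _⊗_
infixl 6 _⊙_
infixr 7 _•_

opaque
  det : Mat → ℤ
  det (mat α β γ δ) = α * δ - β * γ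

  _⊗_ : Mat → Mat → Mat
  mat α β γ δ ⊗ mat x y z w = mat (α * x + β * z) (α * y + β * w) (γ * x + δ * z) (γ * y + δ * w)

  adj : Mat → Mat
  adj (mat α β γ δ) = mat δ (- β) (- γ) α

  _⊙_ : Form → Mat → Form
  f ⊙ mat α β γ δ = act f α β γ δ

  _•_ : ℤ → Form → Form
  s • form a b c = form (s * a) (s * b) (s * c)

  ⊗-assoc : ∀ M N P → (M ⊗ N) ⊗ P ≡ M ⊗ (N ⊗ P)
  ⊗-assoc (mat a b c d) (mat x y z w) (mat p q r s) = mat-≡ (e a b p r) (e a b q s) (e c d p r) (e c d q s)
    where
    e : ∀ a b p r → (a * x + b * z) * p + (a * y + b * w) * r ≡ a * (x * p + y * r) + b * (z * p + w * r)
    e = solve 8 (λ x y z w a b p r → (a :* x :+ b :* z) :* p :+ (a :* y :+ b :* w) :* r := a :* (x :* p :+ y :* r) :+ b :* (z :* p :+ w :* r)) refl x y z w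

  scalar-⊗ : ∀ s M → scalar s ⊗ M ≡ M ⊗ scalar s
  scalar-⊗ s (mat a b c d) = mat-≡ (e₁ s a b c) (e₂ s b a d) (e₃ s c a d) (e₄ s d c b)
    where
    e₁ : ∀ s a b c → s * a + 0ℤ * c ≡ a * s + b * 0ℤ
    e₁ = solve 4 (λ s a b c → s :* a :+ con 0ℤ :* c := a :* s :+ b :* con 0ℤ) refl
    e₂ : ∀ s b a d → s * b + 0ℤ * d ≡ a * 0ℤ + b * s
    e₂ = solve 4 (λ s b a d → s :* b :+ con 0ℤ :* d := a :* con 0ℤ :+ b :* s) refl
    e₃ : ∀ s c a d → 0ℤ * a + s * c ≡ c * s + d * 0ℤ
    e₃ = solve 4 (λ s c a d → con 0ℤ :* a :+ s :* c := c :* s :+ d :* con 0ℤ) refl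
    e₄ : ∀ s d c b → 0ℤ * b + s * d ≡ c * 0ℤ + d * s
    e₄ = solve 4 (λ s d c b → con 0ℤ :* b :+ s :* d := c :* con 0ℤ :+ d :* s) refl

  ⊗-identityˡ : ∀ M → 𝟙 ⊗ M ≡ M
  ⊗-identityˡ (mat a b c d) = mat-≡ (e a c) (e b d) (e′ c a) (e′ d b)
    where
    e : ∀ a c → 1ℤ * a + 0ℤ * c ≡ a
    e = solve 2 (λ a c → con 1ℤ :* a :+ con 0ℤ :* c := a) refl
    e′ : ∀ c a → 0ℤ * a + 1ℤ * c ≡ c
    e′ = solve 2 (λ c a → con 0ℤ :* a :+ con 1ℤ :* c := c) refl

  ⊗-identityʳ : ∀ M → M ⊗ 𝟙 ≡ M
  ⊗-identityʳ M = trans (sym (scalar-⊗ 1ℤ M)) (⊗-identityˡ M)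

  ⊗-adjʳ : ∀ M → M ⊗ adj M ≡ scalar (det M)
  ⊗-adjʳ (mat a b c d) = mat-≡ (e₁ a b c d) (e₂ a b) (e₃ c d) (e₄ a b c d)
    where
    e₁ : ∀ a b c d → a * d + b * - c ≡ a * d - b * c
    e₁ = solve 4 (λ a b c d → a :* d :+ b :* :- c := a :* d :- b :* c) refl
    e₂ : ∀ a b → a * - b + b * a ≡ 0ℤ
    e₂ = solve 2 (λ a b → a :* :- b :+ b :* a := con 0ℤ) refl
    e₃ : ∀ c d → c * d + d * - c ≡ 0ℤ
    e₃ = solve 2 (λ c d → c :* d :+ d :* :- c := con 0ℤ) refl
    e₄ : ∀ a b c d → c * - b + d * a ≡ a * d - b * c
    e₄ = solve 4 (λ a b c d → c :* :- b :+ d :* a := a :* d :- b :* c) refl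

  adj-involutive : ∀ M → adj (adj M) ≡ M
  adj-involutive (mat a b c d) = mat-≡ refl (ℤ.neg-involutive b) (ℤ.neg-involutive c) refl

  adj-injective : ∀ {M N} → adj M ≡ adj N → M ≡ N
  adj-injective {M} {N} eq = trans (sym (adj-involutive M)) (trans (cong adj eq) (adj-involutive N))

  det-adj : ∀ M → det (adj M) ≡ det M
  det-adj (mat a b c d) = solve 4 (λ a b c d → d :* a :- (:- b) :* (:- c) := a :* d :- b :* c) refl a b c d

  ⊗-adjˡ : ∀ M → adj M ⊗ M ≡ scalar (det M)
  ⊗-adjˡ M = trans (cong (adj M ⊗_) (sym (adj-involutive M))) (trans (⊗-adjʳ (adj M)) (cong scalar (det-adj M)))

  det-⊗ : ∀ M N → det (M ⊗ N) ≡ det M * det N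
  det-⊗ (mat a b c d) (mat x y z w) = solve 8 (λ a b c d x y z w →
    (a :* x :+ b :* z) :* (c :* y :+ d :* w) :- (a :* y :+ b :* w) :* (c :* x :+ d :* z) := (a :* d :- b :* c) :* (x :* w :- y :* z)) refl a b c d x y z w

  det-scalar : ∀ s → det (scalar s) ≡ s * s
  det-scalar = solve 1 (λ s → s :* s :- con 0ℤ :* con 0ℤ := s :* s) refl

  scalar-injective : ∀ s {M N} → s ≢ 0ℤ → scalar s ⊗ M ≡ scalar s ⊗ N → M ≡ N
  scalar-injective s {mat a b c d} {mat a′ b′ c′ d′} s≢0 eq =
    mat-≡ (up a c a′ c′ (cong m₁₁ eq)) (up b d b′ d′ (cong m₁₂ eq)) (dn c a c′ a′ (cong m₂₁ eq)) (dn d b d′ b′ (cong m₂₂ eq))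
    where
    instance
      nz : ℤ.NonZero s
      nz = ℤ.≢-nonZero s≢0
    up : ∀ x y x′ y′ → s * x + 0ℤ * y ≡ s * x′ + 0ℤ * y′ → x ≡ x′
    up x y x′ y′ p = ℤ.*-cancelˡ-≡ s x x′ (trans (sym (ℤ.+-identityʳ (s * x))) (trans p (ℤ.+-identityʳ (s * x′))))
    dn : ∀ x y x′ y′ → 0ℤ * y + s * x ≡ 0ℤ * y′ + s * x′ → x ≡ x′
    dn x y x′ y′ p = ℤ.*-cancelˡ-≡ s x x′ (trans (sym (ℤ.+-identityˡ (s * x))) (trans p (ℤ.+-identityˡ (s * x′))))

  ⊗-cancelˡ : ∀ M {N P} → det M ≢ 0ℤ → M ⊗ N ≡ M ⊗ P → N ≡ P
  ⊗-cancelˡ M {N} {P} d≢0 eq = scalar-injective (det M) d≢0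
    (trans (e N) (trans (cong (adj M ⊗_) eq) (sym (e P))))
    where
    e : ∀ X → scalar (det M) ⊗ X ≡ adj M ⊗ (M ⊗ X)
    e X = trans (cong (_⊗ X) (sym (⊗-adjˡ M))) (⊗-assoc (adj M) M X)

  ⊙-⊗ : ∀ f M N → f ⊙ M ⊗ N ≡ (f ⊙ M) ⊙ N
  ⊙-⊗ (form a b c) (mat α β γ δ) (mat x y z w) = form-≡ (e x z) cr (e y w)
    where
    e : ∀ x z → value (form a b c) (α * x + β * z) (γ * x + δ * z) ≡ value (act (form a b c) α β γ δ) x z
    e = solve 9 (λ a b c α β γ δ x z → valueP a b c (α :* x :+ β :* z) (γ :* x :+ δ :* z)
          := valueP (valueP a b c α γ) (crossP a b c α β γ δ) (valueP a b c β δ) x z) refl a b c α β γ δ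
    cr : B (act (form a b c) (α * x + β * z) (α * y + β * w) (γ * x + δ * z) (γ * y + δ * w)) ≡ B (act (act (form a b c) α β γ δ) x y z w)
    cr = solve 11 (λ a b c α β γ δ x y z w → crossP a b c (α :* x :+ β :* z) (α :* y :+ β :* w) (γ :* x :+ δ :* z) (γ :* y :+ δ :* w)
           := crossP (valueP a b c α γ) (crossP a b c α β γ δ) (valueP a b c β δ) x y z w) refl a b c α β γ δ x y z w

  ⊙-scalar : ∀ f s → f ⊙ scalar s ≡ (s * s) • f
  ⊙-scalar (form a b c) s = form-≡
    (solve 4 (λ a b c s → valueP a b c s (con 0ℤ) := s :* s :* a) refl a b c s)
    (solve 4 (λ a b c s → crossP a b c s (con 0ℤ) (con 0ℤ) s := s :* s :* b) refl a b c s)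
    (solve 4 (λ a b c s → valueP a b c (con 0ℤ) s := s :* s :* c) refl a b c s)

  •-⊙ : ∀ s f M → s • f ⊙ M ≡ s • (f ⊙ M)
  •-⊙ s (form a b c) (mat α β γ δ) = form-≡ (e α γ)
    (solve 8 (λ s a b c α β γ δ → crossP (s :* a) (s :* b) (s :* c) α β γ δ := s :* crossP a b c α β γ δ) refl s a b c α β γ δ) (e β δ)
    where
    e : ∀ x y → value (s • form a b c) x y ≡ s * value (form a b c) x y
    e = solve 6 (λ s a b c x y → valueP (s :* a) (s :* b) (s :* c) x y := s :* valueP a b c x y) refl s a b c

  1• : ∀ f → 1ℤ • f ≡ f
  1• (form a b c) = form-≡ (ℤ.*-identityˡ a) (ℤ.*-identityˡ b) (ℤ.*-identityˡ c)

  •-assoc : ∀ s t f → s • t • f ≡ (s * t) • f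
  •-assoc s t (form a b c) = form-≡ (sym (ℤ.*-assoc s t a)) (sym (ℤ.*-assoc s t b)) (sym (ℤ.*-assoc s t c))

  •-injective : ∀ s {f g} → s ≢ 0ℤ → s • f ≡ s • g → f ≡ g
  •-injective s {form a b c} {form a′ b′ c′} s≢0 eq =
    form-≡ (ℤ.*-cancelˡ-≡ s a a′ (cong A eq)) (ℤ.*-cancelˡ-≡ s b b′ (cong B eq)) (ℤ.*-cancelˡ-≡ s c c′ (cong C eq))
    where
      instance
        nz : ℤ.NonZero s
        nz = ℤ.≢-nonZero s≢0

  ⊙-𝟙 : ∀ f → f ⊙ 𝟙 ≡ f
  ⊙-𝟙 f = trans (⊙-scalar f 1ℤ) (1• f)

  value-⊙ : ∀ f M x y → value (f ⊙ M) x y ≡ value f (m₁₁ M * x + m₁₂ M * y) (m₂₁ M * x + m₂₂ M * y)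
  value-⊙ (form a b c) (mat α β γ δ) x y = solve 9 (λ a b c α β γ δ x y → valueP (valueP a b c α γ) (crossP a b c α β γ δ) (valueP a b c β δ) x y
     := valueP a b c (α :* x :+ β :* y) (γ :* x :+ δ :* y)) refl a b c α β γ δ x y

  disc-⊙ : ∀ f M → disc (f ⊙ M) ≡ det M * det M * disc f
  disc-⊙ (form a b c) (mat α β γ δ) = solve 7 (λ a b c α β γ δ → discP (valueP a b c α γ) (crossP a b c α β γ δ) (valueP a b c β δ)
     := (α :* δ :- β :* γ) :* (α :* δ :- β :* γ) :* discP a b c) refl a b c α β γ δ

  value-• : ∀ s f x y → value (s • f) x y ≡ s * value f x y
  value-• s (form a b c) x y = solve 6 (λ s a b c x y → valueP (s :* a) (s :* b) (s :* c) x y := s :* valueP a b c x y) refl s a b c x y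

  disc-• : ∀ s f → disc (s • f) ≡ s * s * disc f
  disc-• s (form a b c) = solve 4 (λ s a b c → discP (s :* a) (s :* b) (s :* c) := s :* s :* discP a b c) refl s a b c

-- Since `M ⊗ adj M` is the scalar `det M`, the adjugate undoes the action of `M` up to a square
-- factor. It replaces the inverse, which is not integral in general.
⊙-adj : ∀ {f g} M → f ⊙ M ≡ g → g ⊙ adj M ≡ (det M * det M) • f
⊙-adj {f} M refl = trans (sym (⊙-⊗ f M (adj M))) (trans (cong (f ⊙_) (⊗-adjʳ M)) (⊙-scalar f (det M)))

-- Apply `⊙-adj` to `adj M` and cancel the factor. In `Correspondence` this lets a morphism be
-- recovered from its adjugate.
⊙-unadj : ∀ {f g} M → det M ≢ 0ℤ → g ⊙ adj M ≡ (det M * det M) • f → f ⊙ M ≡ g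
⊙-unadj {f} {g} M d≢0 eq = •-injective (det M * det M) dd≢0 (sym
   (trans (sym (cong (λ d → (d * d) • g) (det-adj M))) (trans (sym (⊙-adj (adj M) eq)) (trans (cong ((det M * det M) • f ⊙_) (adj-involutive M)) (•-⊙ _ f M)))))
  where
  dd≢0 : det M * det M ≢ 0ℤ
  dd≢0 z with ℤ.i*j≡0⇒i≡0∨j≡0 (det M) z
  ... | inj₁ e = d≢0 e
  ... | inj₂ e = d≢0 e

⊙-unimodular-inverse : ∀ {f g} M → det M ≡ 1ℤ → f ⊙ M ≡ g → g ⊙ adj M ≡ f
⊙-unimodular-inverse {f} M d eq = trans (⊙-adj M eq) (trans (cong (λ t → (t * t) • f) d) (1• f))

infix 4 _≅_
record _≅_ (f g : Form) : Set where
  constructor iso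
  field
    M : Mat
    det≡1 : det M ≡ 1ℤ
    transports : f ⊙ M ≡ g

opaque
  unfolding det _⊙_

  ∼⇒≅ : ∀ {f g} → f ∼ g → f ≅ g
  ∼⇒≅ (α , β , γ , δ , d , eq) = iso (mat α β γ δ) d eq

  ≅⇒∼ : ∀ {f g} → f ≅ g → f ∼ g
  ≅⇒∼ (iso (mat α β γ δ) d eq) = α , β , γ , δ , d , eq

det-𝟙 : det 𝟙 ≡ 1ℤ
det-𝟙 = det-scalar 1ℤ

≅-refl : ∀ {f} → f ≅ f
≅-refl {f} = iso 𝟙 det-𝟙 (⊙-𝟙 f)

≅-sym : ∀ {f g} → f ≅ g → g ≅ f
≅-sym (iso M d eq) = iso (adj M) (trans (det-adj M) d) (⊙-unimodular-inverse M d eq)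

det-⊗-unimodular : ∀ M N → det M ≡ 1ℤ → det N ≡ 1ℤ → det (M ⊗ N) ≡ 1ℤ
det-⊗-unimodular M N d d′ = trans (det-⊗ M N) (cong₂ _*_ d d′)

⊙-compose : ∀ {f g h} M N → f ⊙ M ≡ g → g ⊙ N ≡ h → f ⊙ M ⊗ N ≡ h
⊙-compose {f} M N refl eq = trans (⊙-⊗ f M N) eq

≅-trans : ∀ {f g h} → f ≅ g → g ≅ h → f ≅ h
≅-trans (iso M d eq) (iso N d′ eq′) = iso (M ⊗ N) (det-⊗-unimodular M N d d′) (⊙-compose M N eq eq′)

disc-≅ : ∀ {f g} → f ≅ g → disc f ≡ disc g
disc-≅ {f} (iso M d refl) = sym (trans (disc-⊙ f M) (trans (cong (λ t → t * t * disc f) d) (ℤ.*-identityˡ (disc f))))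

opaque
  unfolding det

  -- A matrix of nonzero determinant kills no nonzero vector, by Cramer's rule (`zx` and `zy`), so
  -- the values of `f ⊙ M` off the origin are values of `f` off the origin.
  posDef-⊙ : ∀ {f} M → det M ≢ 0ℤ → PositiveDefinite f → PositiveDefinite (f ⊙ M)
  posDef-⊙ {f} M@(mat α β γ δ) d≢0 pd x y xy≢0 = subst (0ℤ <_) (sym (value-⊙ f M x y)) (pd _ _ λ (p , q) → xy≢0 (zx p q , zy p q))
    where
    kill : ∀ z → det M * z ≡ 0ℤ → z ≡ 0ℤ
    kill z eq with ℤ.i*j≡0⇒i≡0∨j≡0 (det M) eq
    ... | inj₁ e = contradiction e d≢0
    ... | inj₂ e = e
    zx : α * x + β * y ≡ 0ℤ → γ * x + δ * y ≡ 0ℤ → x ≡ 0ℤ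
    zx p q = kill x (trans (solve 6 (λ α β γ δ x y → (α :* δ :- β :* γ) :* x := δ :* (α :* x :+ β :* y) :- β :* (γ :* x :+ δ :* y)) refl α β γ δ x y)
       (trans (cong₂ (λ u v → δ * u - β * v) p q) (solve 2 (λ β δ → δ :* con 0ℤ :- β :* con 0ℤ := con 0ℤ) refl β δ)))
    zy : α * x + β * y ≡ 0ℤ → γ * x + δ * y ≡ 0ℤ → y ≡ 0ℤ
    zy p q = kill y (trans (solve 6 (λ α β γ δ x y → (α :* δ :- β :* γ) :* y := α :* (γ :* x :+ δ :* y) :- γ :* (α :* x :+ β :* y)) refl α β γ δ x y)
       (trans (cong₂ (λ u v → α * u - γ * v) q p) (solve 2 (λ β δ → δ :* con 0ℤ :- β :* con 0ℤ := con 0ℤ) refl γ α)))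

posDef-≅ : ∀ {f g} → f ≅ g → PositiveDefinite f → PositiveDefinite g
posDef-≅ {f} (iso M d refl) pd = posDef-⊙ {f} M (λ e → contradiction (trans (sym d) e) λ ()) pd

posDef-• : ∀ {f} s → 0ℤ < s → PositiveDefinite f → PositiveDefinite (s • f)
posDef-• {f} s s>0 pd x y nz = subst (0ℤ <_) (sym (value-• s f x y)) (subst (_< s * value f x y) (ℤ.*-zeroʳ s) (ℤ.*-monoˡ-<-pos s (pd x y nz)))
  where
    instance
      s⁺ : ℤ.Positive s
      s⁺ = ℤ.positive s>0

posDef-•⁻¹ : ∀ {f} s → 0ℤ < s → PositiveDefinite (s • f) → PositiveDefinite f
posDef-•⁻¹ {f} s s>0 pd x y nz = ℤ.*-cancelˡ-<-nonNeg s (subst₂ _<_ (sym (ℤ.*-zeroʳ s)) (value-• s f x y) (pd x y nz))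
  where
    instance
      nn : ℤ.NonNegative s
      nn = ℤ.nonNegative (ℤ.<⇒≤ s>0)

-- Double counting with weights

indicator : ∀ {p} {P : Set p} → Dec P → ℕ
indicator P? = if does P? then 1 else 0

indicator-true : ∀ {p} {P : Set p} (P? : Dec P) → P → indicator P? ≡ 1
indicator-true P? p rewrite dec-true P? p = refl

indicator-false : ∀ {p} {P : Set p} (P? : Dec P) → ¬ P → indicator P? ≡ 0
indicator-false P? ¬p rewrite dec-false P? ¬p = refl

∑-zero : ∀ n → ∑[ i < n ] 0 ≡ 0
∑-zero zero = refl
∑-zero (suc n) = ∑-zero n

∑-const : ∀ n c → ∑[ i < n ] c ≡ n ℕ.* c
∑-const zero c = refl
∑-const (suc n) c = cong (c ℕ.+_) (∑-const n c)

∑-single : ∀ {n} (f : Fin n → ℕ) j → (∀ i → i ≢ j → f i ≡ 0) → ∑[ i < n ] f i ≡ f j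
∑-single {suc n} f zero z = trans (cong (f zero ℕ.+_) (trans (sum-cong-≗ (λ i → z (suc i) λ ())) (∑-zero n))) (ℕ.+-identityʳ (f zero))
∑-single {suc n} f (suc j) z = cong₂ ℕ._+_ (z zero λ ()) (∑-single (f ∘ suc) j λ i i≢j → z (suc i) (i≢j ∘ Fin.suc-injective))

unique-length : ∀ {A : Set} {xs ys : List A} → Unique xs → Unique ys → (∀ {x} → x ∈ xs → x ∈ ys) → (∀ {x} → x ∈ ys → x ∈ xs) → length xs ≡ length ys
unique-length u v f g = ↭-length (∼bag⇒↭ (unique∧set⇒bag u v (mk⇔ f g)))

length-concat-tabulate : ∀ {A : Set} {n} (f : Fin n → List A) → length (concat (tabulate f)) ≡ ∑[ i < n ] length (f i)
length-concat-tabulate {n = zero} f = refl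
length-concat-tabulate {n = suc n} f = trans (List.length-++ (f zero)) (cong (length (f zero) ℕ.+_) (length-concat-tabulate (f ∘ suc)))

unique-map : ∀ {A B : Set} (f : A → B) {xs} → (∀ {x y} → x ∈ xs → y ∈ xs → f x ≡ f y → x ≡ y) → Unique xs → Unique (List.map f xs)
unique-map f inj AllPairs.[] = AllPairs.[]
unique-map f {x ∷ xs} inj (x∉ AllPairs.∷ u) =
  All.map⁺ (lookup′ x∉ λ y∈ x≢y eq → x≢y (inj (here refl) (there y∈) eq)) AllPairs.∷ unique-map f (λ p q → inj (there p) (there q)) u
  where
  lookup′ : ∀ {ys} → All (x ≢_) ys → (∀ {y} → y ∈ ys → x ≢ y → f x ≢ f y) → All (λ y → f x ≢ f y) ys
  lookup′ [] k = []
  lookup′ (p ∷ ps) k = k (here refl) p ∷ lookup′ ps (k ∘ there)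

module _ {n : ℕ} where
  hit : Fin n → Maybe (Fin n) → ℕ
  hit j nothing = 0
  hit j (just j′) = indicator (j′ Fin.≟ j)

  defined : Maybe (Fin n) → ℕ
  defined nothing = 0
  defined (just _) = 1

  ∑-hit : ∀ t → ∑[ j < n ] hit j t ≡ defined t
  ∑-hit nothing = ∑-zero n
  ∑-hit (just j) = trans (∑-single _ j λ i i≢j → indicator-false (j Fin.≟ i) (i≢j ∘ sym)) (indicator-true (j Fin.≟ j) refl)

-- Hom i j, the set of morphisms from the i-th to the j-th object, is split into fibres over Fin k: the fibre over L is
-- empty for all j except possibly one, for which it is a torsor under the automorphisms of j.
record Fibration {m n : ℕ} (auts : Fin n → List Mat) (Hom : Fin m → Fin n → Mat → Set) (k : ℕ) : Set where
  field
    target    : Fin m → Fin k → Maybe (Fin n)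
    param     : Fin m → Fin k → Mat → Mat
    sound     : ∀ {i j L a} → target i L ≡ just j → a ∈ auts j → Hom i j (param i L a)
    injective : ∀ {i j L L′ a a′} → target i L ≡ just j → target i L′ ≡ just j → a ∈ auts j → a′ ∈ auts j →
                param i L a ≡ param i L′ a′ → L ≡ L′ × a ≡ a′
    complete  : ∀ {i j M} → Hom i j M → Σ (Fin k) λ L → Σ Mat λ a → target i L ≡ just j × a ∈ auts j × M ≡ param i L a

  degree : Fin m → ℕ
  degree i = ∑[ L < k ] defined (target i L)

  hits : Fin m → Fin n → ℕ
  hits i j = ∑[ L < k ] hit j (target i L)

  ∑-hits : ∀ i → ∑[ j < n ] hits i j ≡ degree i
  ∑-hits i = trans (∑-comm (λ j L → hit j (target i L))) (sum-cong-≗ λ L → ∑-hit (target i L))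

  block : Fin m → Fin n → Fin k → Maybe (Fin n) → List Mat
  block i j L nothing = []
  block i j L (just j′) = if does (j′ Fin.≟ j) then List.map (param i L) (auts j) else []

  homs : Fin m → Fin n → List Mat
  homs i j = concat (tabulate λ L → block i j L (target i L))

  ∈-block⁻ : ∀ {i j L M} t → M ∈ block i j L t → t ≡ just j × Σ Mat λ a → a ∈ auts j × M ≡ param i L a
  ∈-block⁻ {j = j} (just j′) M∈ with j′ Fin.≟ j
  ... | yes refl = refl , ∈-map⁻ _ M∈

  ∈-block⁺ : ∀ {i j L a} t → t ≡ just j → a ∈ auts j → param i L a ∈ block i j L t
  ∈-block⁺ {j = j} _ refl a∈ rewrite dec-true (j Fin.≟ j) refl = ∈-map⁺ _ a∈

  ∈-homs⁻ : ∀ {i j M} → M ∈ homs i j → Hom i j M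
  ∈-homs⁻ {i} {j} M∈ with ∈-concat⁻′ (tabulate λ L → block i j L (target i L)) M∈
  ... | _ , M∈b , b∈ with ∈-tabulate⁻ b∈
  ... | L , refl with ∈-block⁻ (target i L) M∈b
  ... | t≡ , a , a∈ , refl = sound t≡ a∈

  ∈-homs⁺ : ∀ {i j M} → Hom i j M → M ∈ homs i j
  ∈-homs⁺ {i} h with complete h
  ... | L , a , t≡ , a∈ , refl = ∈-concat⁺′ (∈-block⁺ (target i L) t≡ a∈) (∈-tabulate⁺ L)

  unique-block : (∀ j → Unique (auts j)) → ∀ i j L → Unique (block i j L (target i L))
  unique-block u i j L with target i L in t≡
  ... | nothing = AllPairs.[]
  ... | just j′ with j′ Fin.≟ j
  ... | no _ = AllPairs.[]
  ... | yes refl = unique-map (param i L) (λ p q eq → proj₂ (injective t≡ t≡ p q eq)) (u j)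

  unique-homs : (∀ j → Unique (auts j)) → ∀ i j → Unique (homs i j)
  unique-homs u i j = Unique.concat⁺ (All.tabulate⁺ (unique-block u i j)) (AllPairs.tabulate⁺ disjoint)
    where
    disjoint : ∀ {L L′} → L ≢ L′ → ∀ {M} → ¬ (M ∈ block i j L (target i L) × M ∈ block i j L′ (target i L′))
    disjoint {L} {L′} L≢L′ (p , q) with ∈-block⁻ (target i L) p | ∈-block⁻ (target i L′) q
    ... | t≡ , a , a∈ , refl | t≡′ , a′ , a∈′ , eq = L≢L′ (proj₁ (injective t≡ t≡′ a∈ a∈′ eq))

  length-block : ∀ i j L t → length (block i j L t) ≡ length (auts j) ℕ.* hit j t
  length-block i j L nothing = sym (ℕ.*-zeroʳ (length (auts j)))
  length-block i j L (just j′) with j′ Fin.≟ j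
  ... | yes refl = trans (List.length-map (param i L) (auts j)) (sym (ℕ.*-identityʳ _))
  ... | no _ = sym (ℕ.*-zeroʳ (length (auts j)))

  length-homs : ∀ i j → length (homs i j) ≡ length (auts j) ℕ.* hits i j
  length-homs i j = trans (length-concat-tabulate λ L → block i j L (target i L))
    (trans (sum-cong-≗ λ L → length-block i j L (target i L)) (sym (*-distribˡ-sum (length (auts j)) λ L → hit j (target i L))))

-- Both fibrations list the same sets `Hom i j`, so `length (auts′ j)` times the number of fibres
-- over `j` equals `length (auts i)` times the number of fibres over `i`. With the weights this
-- becomes `local`, and summation over all pairs turns fibre counts into degrees.
double-counting : ∀ {m n k l} {auts : Fin m → List Mat} {auts′ : Fin n → List Mat} {Hom : Fin m → Fin n → Mat → Set}
  (e : Fin m → ℕ) (e′ : Fin n → ℕ) →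
  (∀ i → Unique (auts i)) → (∀ j → Unique (auts′ j)) →
  (∀ i → e i ℕ.* length (auts i) ≡ 12) → (∀ j → e′ j ℕ.* length (auts′ j) ≡ 12) →
  (F : Fibration auts′ Hom k) (F′ : Fibration auts (λ j i → Hom i j) l) →
  ∑[ i < m ] (e i ℕ.* Fibration.degree F i) ≡ ∑[ j < n ] (e′ j ℕ.* Fibration.degree F′ j)
double-counting {m} {n} {auts = auts} {auts′} e e′ u u′ mass mass′ F F′ = begin
  ∑[ i < m ] (e i ℕ.* F.degree i)                    ≡⟨ sum-cong-≗ (λ i → trans (cong (e i ℕ.*_) (sym (F.∑-hits i))) (*-distribˡ-sum (e i) (F.hits i))) ⟩
  ∑[ i < m ] ∑[ j < n ] (e i ℕ.* F.hits i j)         ≡⟨ sum-cong-≗ (λ i → sum-cong-≗ (local i)) ⟩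
  ∑[ i < m ] ∑[ j < n ] (e′ j ℕ.* F′.hits j i)       ≡⟨ ∑-comm (λ i j → e′ j ℕ.* F′.hits j i) ⟩
  ∑[ j < n ] ∑[ i < m ] (e′ j ℕ.* F′.hits j i)       ≡⟨ sum-cong-≗ (λ j → trans (sym (*-distribˡ-sum (e′ j) (F′.hits j))) (cong (e′ j ℕ.*_) (F′.∑-hits j))) ⟩
  ∑[ j < n ] (e′ j ℕ.* F′.degree j)                  ∎
  where
  open ≡-Reasoning
  module F = Fibration F
  module F′ = Fibration F′
  local : ∀ i j → e i ℕ.* F.hits i j ≡ e′ j ℕ.* F′.hits j i
  -- The factor 12 is written as `e′ j ℕ.* α′` at the start and recovered as `e i ℕ.* α` at the end,
  -- which trades automorphism counts for weights.
  local i j = ℕ.*-cancelˡ-≡ _ _ 12 (begin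
    12 ℕ.* (e i ℕ.* h)                    ≡⟨ cong (ℕ._* (e i ℕ.* h)) (sym (mass′ j)) ⟩
    e′ j ℕ.* α′ ℕ.* (e i ℕ.* h)           ≡⟨ swap₁ (e′ j) α′ (e i) h ⟩
    e′ j ℕ.* e i ℕ.* (α′ ℕ.* h)           ≡⟨ cong (e′ j ℕ.* e i ℕ.*_) (trans (sym (F.length-homs i j)) (trans
         (unique-length (F.unique-homs u′ i j) (F′.unique-homs u j i) (λ p → F′.∈-homs⁺ (F.∈-homs⁻ p)) (λ p → F.∈-homs⁺ (F′.∈-homs⁻ p)))
         (F′.length-homs j i))) ⟩
    e′ j ℕ.* e i ℕ.* (α ℕ.* h′)           ≡⟨ swap₂ (e′ j) (e i) α h′ ⟩
    e i ℕ.* α ℕ.* (e′ j ℕ.* h′)           ≡⟨ cong (ℕ._* (e′ j ℕ.* h′)) (mass i) ⟩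
    12 ℕ.* (e′ j ℕ.* h′)                  ∎)
    where
    α = length (auts i)
    α′ = length (auts′ j)
    h = F.hits i j
    h′ = F′.hits j i
    swap₁ : ∀ x y z w → x ℕ.* y ℕ.* (z ℕ.* w) ≡ x ℕ.* z ℕ.* (y ℕ.* w)
    swap₁ = ℕ-solve-∀
    swap₂ : ∀ x y z w → x ℕ.* y ℕ.* (z ℕ.* w) ≡ y ℕ.* z ℕ.* (x ℕ.* w)
    swap₂ = ℕ-solve-∀

-- Correspondences between classes of forms

IsAutomorphism : Form → Mat → Set
IsAutomorphism f M = det M ≡ 1ℤ × f ⊙ M ≡ f

record Automorphisms (f : Form) : Set where
  field
    elements : List Mat
    unique   : Unique elements
    sound    : ∀ {M} → M ∈ elements → IsAutomorphism f M
    complete : ∀ {M} → IsAutomorphism f M → M ∈ elements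

-- For D > 0 the automorphism groups have order 2, 4 or 6, so `mass` forces the weights 6, 3, 2 and
-- `total` is 6 H(D).
record Classes (D : ℤ) : Set where
  field
    size     : ℕ
    rep      : Fin size → Form
    posDef   : ∀ i → PositiveDefinite (rep i)
    disc≡    : ∀ i → disc (rep i) ≡ - D
    class    : ∀ f → PositiveDefinite f → disc f ≡ - D → Σ (Fin size) λ i → f ≅ rep i
    distinct : ∀ {i j} → rep i ≅ rep j → i ≡ j
    weight   : Fin size → ℕ
    auts     : ∀ i → Automorphisms (rep i)
    mass     : ∀ i → weight i ℕ.* length (Automorphisms.elements (auts i)) ≡ 12

  total : ℕ
  total = ∑[ i < size ] weight i

open Classes public
open Automorphisms public

-- Representatives of the orbits of SL₂(ℤ) acting from the right on the matrices of determinant d.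
record Lines (d : ℤ) (k : ℕ) : Set where
  field
    line       : Fin k → Mat
    det-line   : ∀ L → det (line L) ≡ d
    decompose  : ∀ M → det M ≡ d → Σ (Fin k) λ L → Σ Mat λ N → det N ≡ 1ℤ × M ≡ line L ⊗ N
    separate   : ∀ {L L′} N N′ → det N ≡ 1ℤ → det N′ ≡ 1ℤ → line L ⊗ N ≡ line L′ ⊗ N′ → L ≡ L′

open Lines public

Divides : ℤ → Form → Set
Divides s g = Σ Form λ f → s • f ≡ g

opaque
  unfolding _•_

  Divides-intro : ∀ {s g} → s ∣ A g → s ∣ B g → s ∣ C g → Divides s g
  Divides-intro {s} {form a b c} (divides x refl) (divides y refl) (divides z refl) = form x y z , form-≡ (ℤ.*-comm s x) (ℤ.*-comm s y) (ℤ.*-comm s z)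

  Divides-elim : ∀ {s g} → Divides s g → s ∣ A g × s ∣ B g × s ∣ C g
  Divides-elim {s} (form x y z , refl) = divides x (ℤ.*-comm s x) , divides y (ℤ.*-comm s y) , divides z (ℤ.*-comm s z)

divides? : ∀ s g → Dec (Divides s g)
divides? s g with s ∣? A g | s ∣? B g | s ∣? C g
... | yes a | yes b | yes c = yes (Divides-intro a b c)
... | no ¬a | _ | _ = no (¬a ∘ proj₁ ∘ Divides-elim)
... | yes _ | no ¬b | _ = no (¬b ∘ proj₁ ∘ proj₂ ∘ Divides-elim)
... | yes _ | yes _ | no ¬c = no (¬c ∘ proj₂ ∘ proj₂ ∘ Divides-elim)

-- The adjugate of a unimodular matrix is its inverse, so two isomorphisms with the same source and
-- target differ by an automorphism of the target.
torsor : ∀ {f g} (φ : f ≅ g) N → det N ≡ 1ℤ → f ⊙ N ≡ g → Σ Mat λ a → IsAutomorphism g a × N ≡ _≅_.M φ ⊗ a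
torsor {f} {g} (iso M d eq) N d′ eq′ = adj M ⊗ N ,
  (det-⊗-unimodular (adj M) N (trans (det-adj M) d) d′ , ⊙-compose (adj M) N (⊙-unimodular-inverse M d eq) eq′) ,
  sym (trans (sym (⊗-assoc M (adj M) N)) (trans (cong (_⊗ N) (trans (⊗-adjʳ M) (cong scalar d))) (⊗-identityˡ N)))

positive⇒≢0 : ∀ {x} → 0ℤ < x → x ≢ 0ℤ
positive⇒≢0 lt refl = ℤ.<-irrefl refl lt

*-positive : ∀ {x y} → 0ℤ < x → 0ℤ < y → 0ℤ < x * y
*-positive {x} {y} px py = subst (_< x * y) (ℤ.*-zeroʳ x) (ℤ.*-monoˡ-<-pos x {{ℤ.positive px}} py)

cancel-unimodular : ∀ M {N P} → det M ≡ 1ℤ → M ⊗ N ≡ M ⊗ P → N ≡ P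
cancel-unimodular M d = ⊗-cancelˡ M (λ z → contradiction (trans (sym d) z) λ ())

-- Two cases are used: `d` prime with `s = 1` gives the Hecke relations, and `d = 1` counts the
-- forms divisible by `s`.
module Correspondence {D D′ d s : ℤ} {k : ℕ} (X : Classes D) (Y : Classes D′) (ℒ : Lines d k)
  (d>0 : 0ℤ < d) (s>0 : 0ℤ < s) (D′≡ : D′ ≡ s * s * (d * d) * D) where

  Hom : Fin (size X) → Fin (size Y) → Mat → Set
  Hom i j M = det M ≡ d × s • rep X i ⊙ M ≡ rep Y j

  private
    d≢0 : d ≢ 0ℤ
    d≢0 = positive⇒≢0 d>0

    -- If `M` carries `s • f` to `g`, then `adj M` carries `g` to `q • f`: the adjugate contributes
    -- d² and the source form brings `s`.
    q : ℤ
    q = d * d * s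

    q>0 : 0ℤ < q
    q>0 = *-positive (*-positive d>0 d>0) s>0

    opaque
      disc-image : ∀ {f} M → det M ≡ d → disc f ≡ - D → disc (s • f ⊙ M) ≡ - D′
      disc-image {f} M dM df = trans (disc-⊙ (s • f) M) (trans (cong₂ (λ u v → u * u * v) dM (trans (disc-• s f) (cong (s * s *_) df)))
        (trans (solve 3 (λ s d D → d :* d :* (s :* s :* :- D) := :- (s :* s :* (d :* d) :* D)) refl s d D) (cong -_ (sym D′≡))))

      down : ∀ i L → Σ (Fin (size Y)) λ j → s • rep X i ⊙ line ℒ L ≅ rep Y j
      down i L = class Y _ (posDef-⊙ (line ℒ L) (λ z → d≢0 (trans (sym (det-line ℒ L)) z)) (posDef-• s s>0 (posDef X i)))
                           (disc-image (line ℒ L) (det-line ℒ L) (disc≡ X i))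

    ∈auts : ∀ {D} (Z : Classes D) i {M} → M ∈ elements (auts Z i) → IsAutomorphism (rep Z i) M
    ∈auts Z i = sound (auts Z i)

    -- The premise `L ≡ L′ → γ ≡ γ′` expresses that the transporting matrix is a function of the
    -- line. Once `separate` has identified the lines, the rest is cancellation of matrices of
    -- nonzero determinant.
    fibre-injective : ∀ {L L′ γ γ′ a a′} → det γ ≡ 1ℤ → (L ≡ L′ → γ ≡ γ′) → det γ′ ≡ 1ℤ → det a ≡ 1ℤ → det a′ ≡ 1ℤ →
      line ℒ L ⊗ (γ ⊗ a) ≡ line ℒ L′ ⊗ (γ′ ⊗ a′) → L ≡ L′ × a ≡ a′
    fibre-injective {L} {L′} {γ} {γ′} {a} {a′} dγ γ≡ dγ′ da da′ eq
      with separate ℒ (γ ⊗ a) (γ′ ⊗ a′) (det-⊗-unimodular γ a dγ da) (det-⊗-unimodular γ′ a′ dγ′ da′) eq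
    ... | refl with γ≡ refl
    ... | refl = refl , cancel-unimodular γ dγ (⊗-cancelˡ (line ℒ L) (λ z → d≢0 (trans (sym (det-line ℒ L)) z)) eq)

    -- `s • rep X i ⊙ line ℒ L` always has discriminant -D′, so every line has a target and all
    -- degrees equal `k`.
    down-fibration : Fibration (λ j → elements (auts Y j)) Hom k
    down-fibration = record
      { target = λ i L → just (proj₁ (down i L))
      ; param = λ i L a → line ℒ L ⊗ (_≅_.M (proj₂ (down i L)) ⊗ a)
      ; sound = λ {i} {j} {L} {a} → snd i j L a
      ; injective = λ {i} {j} {L} {L′} {a} {a′} → inj i j L L′ a a′
      ; complete = λ {i} {j} {M} → cpl i j M
      }
      where
      snd : ∀ i j L a → just (proj₁ (down i L)) ≡ just j → a ∈ elements (auts Y j) → Hom i j (line ℒ L ⊗ (_≅_.M (proj₂ (down i L)) ⊗ a))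
      snd i j L a t≡ a∈ with down i L | just-injective t≡
      ... | j , iso γ dγ eγ | refl with ∈auts Y j a∈
      ... | da , ea = trans (det-⊗ (line ℒ L) (γ ⊗ a)) (trans (cong₂ _*_ (det-line ℒ L) (det-⊗-unimodular γ a dγ da)) (ℤ.*-identityʳ d)) ,
                      ⊙-compose (line ℒ L) (γ ⊗ a) refl (⊙-compose γ a eγ ea)
      inj : ∀ i j L L′ a a′ → just (proj₁ (down i L)) ≡ just j → just (proj₁ (down i L′)) ≡ just j → a ∈ elements (auts Y j) → a′ ∈ elements (auts Y j) →
            line ℒ L ⊗ (_≅_.M (proj₂ (down i L)) ⊗ a) ≡ line ℒ L′ ⊗ (_≅_.M (proj₂ (down i L′)) ⊗ a′) → L ≡ L′ × a ≡ a′
      inj i j L L′ a a′ _ _ a∈ a∈′ = fibre-injective (_≅_.det≡1 (proj₂ (down i L))) (λ { refl → refl }) (_≅_.det≡1 (proj₂ (down i L′)))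
                                       (proj₁ (∈auts Y j a∈)) (proj₁ (∈auts Y j a∈′))
      cpl : ∀ i j M → Hom i j M → Σ (Fin k) λ L → Σ Mat λ a → just (proj₁ (down i L)) ≡ just j × a ∈ elements (auts Y j) × M ≡ line ℒ L ⊗ (_≅_.M (proj₂ (down i L)) ⊗ a)
      cpl i j M (dM , eM) with decompose ℒ M dM
      ... | L , N , dN , refl with down i L in eq | trans (sym (⊙-⊗ (s • rep X i) (line ℒ L) N)) eM
      ... | j′ , φ | eN with distinct Y (≅-trans (≅-sym φ) (iso N dN eN))
      ... | refl with torsor φ N dN eN
      ... | a , aut , refl = L , a , cong just (cong proj₁ eq) , complete (auts Y j) aut , cong (λ z → line ℒ L ⊗ (_≅_.M (proj₂ z) ⊗ a)) (sym eq)

    opaque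
      up : ∀ j K → Divides q (rep Y j ⊙ line ℒ K) → Σ (Fin (size X)) λ i → Σ Mat λ γ → det γ ≡ 1ℤ × rep Y j ⊙ line ℒ K ⊗ γ ≡ q • rep X i
      up j K (f , eq) with class X f (posDef-•⁻¹ q q>0 (subst PositiveDefinite (sym eq) (posDef-⊙ (line ℒ K) (λ z → d≢0 (trans (sym (det-line ℒ K)) z)) (posDef Y j)))) disc-f
        where
        instance
          q²≢0 : ℤ.NonZero (q * q)
          q²≢0 = ℤ.≢-nonZero (positive⇒≢0 (*-positive q>0 q>0))
        disc-f : disc f ≡ - D
        disc-f = ℤ.*-cancelˡ-≡ (q * q) _ _ (begin
          q * q * disc f                        ≡⟨ sym (disc-• q f) ⟩
          disc (q • f)                          ≡⟨ cong disc eq ⟩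
          disc (rep Y j ⊙ line ℒ K)             ≡⟨ disc-⊙ (rep Y j) (line ℒ K) ⟩
          det (line ℒ K) * det (line ℒ K) * disc (rep Y j) ≡⟨ cong₂ (λ u v → u * u * v) (det-line ℒ K) (trans (disc≡ Y j) (cong -_ D′≡)) ⟩
          d * d * - (s * s * (d * d) * D)       ≡⟨ solve 3 (λ d s D → d :* d :* :- (s :* s :* (d :* d) :* D) := d :* d :* s :* (d :* d :* s) :* :- D) refl d s D ⟩
          q * q * - D                           ∎)
          where open ≡-Reasoning
      ... | i , iso γ dγ eγ = i , γ , dγ , ⊙-compose (line ℒ K) γ (sym eq) (trans (•-⊙ q f γ) (cong (q •_) eγ))

    target-up : ∀ j K → Dec (Divides q (rep Y j ⊙ line ℒ K)) → Maybe (Fin (size X))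
    target-up j K (yes δ) = just (proj₁ (up j K δ))
    target-up j K (no _) = nothing

    param-up : ∀ j K → Dec (Divides q (rep Y j ⊙ line ℒ K)) → Mat
    param-up j K (yes δ) = proj₁ (proj₂ (up j K δ))
    param-up j K (no _) = 𝟙

    s•-unadj : ∀ {f g} M → det M ≡ d → g ⊙ M ≡ q • f → s • f ⊙ adj M ≡ g
    s•-unadj {f} {g} M dM eq = ⊙-unadj (adj M) (λ z → d≢0 (trans (sym dM) (trans (sym (det-adj M)) z)))
      (trans (cong (g ⊙_) (adj-involutive M)) (trans eq (trans (sym (•-assoc (d * d) s f)) (cong (λ t → (t * t) • s • f) (sym (trans (det-adj M) dM))))))

    s•-adj : ∀ {f g} M → det M ≡ d → s • f ⊙ M ≡ g → g ⊙ adj M ≡ q • f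
    s•-adj {f} M dM eq = trans (⊙-adj M eq) (trans (cong (λ t → (t * t) • s • f) dM) (•-assoc (d * d) s f))

    -- The same morphisms, decomposed through their adjugates. A line now has a target only if the
    -- form restricted to it is divisible by `q`, so the degree is a genuine count.
    up-fibration : Fibration (λ i → elements (auts X i)) (λ j i → Hom i j) k
    up-fibration = record
      { target = λ j K → target-up j K (δ? j K)
      ; param = λ j K a → adj (line ℒ K ⊗ (param-up j K (δ? j K) ⊗ a))
      ; sound = λ {j} {i} {K} {a} → snd j i K a (δ? j K)
      ; injective = λ {j} {i} {K} {K′} {a} {a′} → inj j i K K′ a a′
      ; complete = λ {j} {i} {M} → cpl j i M
      }
      where
      δ? : ∀ j K → Dec (Divides q (rep Y j ⊙ line ℒ K))
      δ? j K = divides? q (rep Y j ⊙ line ℒ K)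
      det-param : ∀ j K δ → det (param-up j K δ) ≡ 1ℤ
      det-param j K (yes δ) = proj₁ (proj₂ (proj₂ (up j K δ)))
      det-param j K (no _) = det-𝟙
      snd : ∀ j i K a δ → target-up j K δ ≡ just i → a ∈ elements (auts X i) → Hom i j (adj (line ℒ K ⊗ (param-up j K δ ⊗ a)))
      snd j i K a (yes δ) t≡ a∈ with up j K δ | just-injective t≡
      ... | i , γ , dγ , eγ | refl with ∈auts X i a∈
      ... | da , ea = trans (det-adj _) dM , s•-unadj (line ℒ K ⊗ (γ ⊗ a)) dM
                        (trans (cong (rep Y j ⊙_) (sym (⊗-assoc (line ℒ K) γ a))) (⊙-compose (line ℒ K ⊗ γ) a eγ (trans (•-⊙ q (rep X i) a) (cong (q •_) ea))))
        where
        dM : det (line ℒ K ⊗ (γ ⊗ a)) ≡ d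
        dM = trans (det-⊗ (line ℒ K) (γ ⊗ a)) (trans (cong₂ _*_ (det-line ℒ K) (det-⊗-unimodular γ a dγ da)) (ℤ.*-identityʳ d))
      inj : ∀ j i K K′ a a′ → target-up j K (δ? j K) ≡ just i → target-up j K′ (δ? j K′) ≡ just i → a ∈ elements (auts X i) → a′ ∈ elements (auts X i) →
            adj (line ℒ K ⊗ (param-up j K (δ? j K) ⊗ a)) ≡ adj (line ℒ K′ ⊗ (param-up j K′ (δ? j K′) ⊗ a′)) → K ≡ K′ × a ≡ a′
      inj j i K K′ a a′ _ _ a∈ a∈′ eq = fibre-injective (det-param j K (δ? j K)) (λ { refl → refl }) (det-param j K′ (δ? j K′))
                                       (proj₁ (∈auts X i a∈)) (proj₁ (∈auts X i a∈′)) (adj-injective eq)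
      cpl : ∀ j i M → Hom i j M → Σ (Fin k) λ K → Σ Mat λ a → target-up j K (δ? j K) ≡ just i × a ∈ elements (auts X i) × M ≡ adj (line ℒ K ⊗ (param-up j K (δ? j K) ⊗ a))
      cpl j i M (dM , eM) with decompose ℒ (adj M) (trans (det-adj M) dM)
      ... | K , N , dN , eq = finish (δ? j K)
        where
        g⊙ : (rep Y j ⊙ line ℒ K) ⊙ N ≡ q • rep X i
        g⊙ = trans (sym (⊙-⊗ (rep Y j) (line ℒ K) N)) (trans (cong (rep Y j ⊙_) (sym eq)) (s•-adj M dM eM))
        f₀ = rep X i ⊙ adj N
        q•f₀ : q • f₀ ≡ rep Y j ⊙ line ℒ K
        q•f₀ = trans (sym (•-⊙ q (rep X i) (adj N))) (⊙-unimodular-inverse N dN g⊙)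
        f₀⊙N : f₀ ⊙ N ≡ rep X i
        f₀⊙N = trans (cong (f₀ ⊙_) (sym (adj-involutive N))) (⊙-unimodular-inverse (adj N) (trans (det-adj N) dN) refl)
        finish : (δ : Dec (Divides q (rep Y j ⊙ line ℒ K))) → Σ (Fin k) λ K → Σ Mat λ a → target-up j K (δ? j K) ≡ just i × a ∈ elements (auts X i) × M ≡ adj (line ℒ K ⊗ (param-up j K (δ? j K) ⊗ a))
        finish (no ¬δ) = contradiction (f₀ , q•f₀) ¬δ
        finish (yes _) with δ? j K in eqδ
        ... | no ¬δ = contradiction (f₀ , q•f₀) ¬δ
        ... | yes δ with up j K δ in equ
        ... | i′ , γ , dγ , eγ with distinct X (≅-trans (≅-sym φ) (iso N dN f₀⊙N))
          where
          φ : f₀ ≅ rep X i′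
          φ = iso γ dγ (•-injective q (positive⇒≢0 q>0) (trans (sym (•-⊙ q f₀ γ)) (trans (cong (_⊙ γ) q•f₀) (trans (sym (⊙-⊗ (rep Y j) (line ℒ K) γ)) eγ))))
        ... | refl with torsor {f₀} (iso γ dγ (•-injective q (positive⇒≢0 q>0) (trans (sym (•-⊙ q f₀ γ)) (trans (cong (_⊙ γ) q•f₀) (trans (sym (⊙-⊗ (rep Y j) (line ℒ K) γ)) eγ))))) N dN f₀⊙N
        ... | a , aut , refl = K , a , trans (cong (target-up j K) eqδ) (cong (just ∘ proj₁) equ) , complete (auts X i) aut ,
               trans (sym (adj-involutive M)) (cong adj (trans eq (cong (λ t → line ℒ K ⊗ (t ⊗ a)) (sym (trans (cong (param-up j K) eqδ) (cong (proj₁ ∘ proj₂) equ))))))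

    defined-target-up : ∀ j K δ → defined (target-up j K δ) ≡ indicator δ
    defined-target-up j K (yes _) = refl
    defined-target-up j K (no _) = refl

  -- The columns of `line ℒ K`, divided by `d`, span a lattice containing ℤ² with index `d`, and on
  -- it the form g / s becomes (g ⊙ line) / q. Hence this counts the overlattices of index `d` on
  -- which g / s stays integral.
  overlattices : Form → ℕ
  overlattices g = ∑[ K < k ] indicator (divides? q (g ⊙ line ℒ K))

  correspondence : k ℕ.* total X ≡ ∑[ j < size Y ] (weight Y j ℕ.* overlattices (rep Y j))
  correspondence = begin
    k ℕ.* total X                                ≡⟨ ℕ.*-comm k (total X) ⟩
    total X ℕ.* k                                ≡⟨ *-distribʳ-sum k (weight X) ⟩
    ∑[ i < size X ] (weight X i ℕ.* k)           ≡⟨ sum-cong-≗ (λ i → cong (weight X i ℕ.*_) (sym (trans (∑-const k 1) (ℕ.*-identityʳ k)))) ⟩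
    ∑[ i < size X ] (weight X i ℕ.* Fibration.degree down-fibration i)
      ≡⟨ double-counting (weight X) (weight Y) (λ i → unique (auts X i)) (λ j → unique (auts Y j)) (mass X) (mass Y) down-fibration up-fibration ⟩
    ∑[ j < size Y ] (weight Y j ℕ.* Fibration.degree up-fibration j)
      ≡⟨ sum-cong-≗ (λ j → cong (weight Y j ℕ.*_) (sum-cong-≗ λ K → defined-target-up j K _)) ⟩
    ∑[ j < size Y ] (weight Y j ℕ.* overlattices (rep Y j)) ∎
    where open ≡-Reasoning

-- Divisibility, Bézout and congruences modulo a prime.

∣-comb : ∀ {d x y z} u v → d ∣ x → d ∣ y → z ≡ u * x + v * y → d ∣ z
∣-comb u v dx dy refl = ∣m∣n⇒∣m+n (∣n⇒∣m*n u dx) (∣n⇒∣m*n v dy)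

∣-mult : ∀ {d x z} u → d ∣ x → z ≡ u * x → d ∣ z
∣-mult u dx refl = ∣n⇒∣m*n u dx

bezout : ∀ x y → Coprime ℤ.∣ x ∣ ℤ.∣ y ∣ → Σ ℤ λ s → Σ ℤ λ t → s * x + t * y ≡ 1ℤ
bezout x y c with m∣∣m∣ {x} | m∣∣m∣ {y} | Coprime.coprime-Bézout c
... | divides u eu | divides v ev | Bézout.+- s t eq = + s * u , - (+ t) * v , (begin
  + s * u * x + - (+ t) * v * y             ≡⟨ solve 6 (λ s t u v x y → s :* u :* x :+ (:- t) :* v :* y := s :* (u :* x) :- t :* (v :* y)) refl (+ s) (+ t) u v x y ⟩
  + s * (u * x) - + t * (v * y)             ≡⟨ cong₂ (λ a b → + s * a - + t * b) (sym eu) (sym ev) ⟩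
  + s * + ℤ.∣ x ∣ - + t * + ℤ.∣ y ∣          ≡⟨ cong₂ (λ a b → a - b) (trans (sym (ℤ.pos-* s ℤ.∣ x ∣)) (trans (cong +_ (sym eq)) (cong (λ e → 1ℤ + e) (ℤ.pos-* t ℤ.∣ y ∣)))) refl ⟩
  1ℤ + + t * + ℤ.∣ y ∣ - + t * + ℤ.∣ y ∣     ≡⟨ solve 1 (λ a → con 1ℤ :+ a :- a := con 1ℤ) refl (+ t * + ℤ.∣ y ∣) ⟩
  1ℤ ∎)
  where open ≡-Reasoning
... | divides u eu | divides v ev | Bézout.-+ s t eq = - (+ s) * u , + t * v , (begin
  - (+ s) * u * x + + t * v * y             ≡⟨ solve 6 (λ s t u v x y → (:- s) :* u :* x :+ t :* v :* y := t :* (v :* y) :- s :* (u :* x)) refl (+ s) (+ t) u v x y ⟩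
  + t * (v * y) - + s * (u * x)             ≡⟨ cong₂ (λ a b → + t * b - + s * a) (sym eu) (sym ev) ⟩
  + t * + ℤ.∣ y ∣ - + s * + ℤ.∣ x ∣          ≡⟨ cong₂ (λ a b → a - b) (trans (sym (ℤ.pos-* t ℤ.∣ y ∣)) (trans (cong +_ (sym eq)) (cong (λ e → 1ℤ + e) (ℤ.pos-* s ℤ.∣ x ∣)))) refl ⟩
  1ℤ + + s * + ℤ.∣ x ∣ - + s * + ℤ.∣ x ∣     ≡⟨ solve 1 (λ a → con 1ℤ :+ a :- a := con 1ℤ) refl (+ s * + ℤ.∣ x ∣) ⟩
  1ℤ ∎)
  where open ≡-Reasoning

module ModPrime (p : ℕ) (pp : Prime p) where
  P : ℤ
  P = + p

  instance
    p≢0 : ℕ.NonZero p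
    p≢0 = prime⇒nonZero pp

  P>0 : 0ℤ < P
  P>0 = +<+ (ℕ.>-nonZero⁻¹ p)

  euclid : ∀ x y → P ∣ x * y → P ∣ x ⊎ P ∣ y
  euclid x y d with euclidsLemma ℤ.∣ x ∣ ℤ.∣ y ∣ pp (subst (p ℕ.∣_) (ℤ.abs-* x y) (∣⇒∣ᵤ d))
  ... | inj₁ e = inj₁ (∣ᵤ⇒∣ e)
  ... | inj₂ e = inj₂ (∣ᵤ⇒∣ e)

  euclidʳ : ∀ x y → ¬ P ∣ x → P ∣ x * y → P ∣ y
  euclidʳ x y ¬d d with euclid x y d
  ... | inj₁ e = contradiction e ¬d
  ... | inj₂ e = e

  square⇒∣ : ∀ x → P ∣ x * x → P ∣ x
  square⇒∣ x d with euclid x x d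
  ... | inj₁ e = e
  ... | inj₂ e = e

  ∤1 : ¬ P ∣ 1ℤ
  ∤1 d with ℕ.∣1⇒≡1 (∣⇒∣ᵤ d)
  ... | refl = ¬prime[1] pp

  ∤⇒coprime : ∀ x → ¬ P ∣ x → Coprime ℤ.∣ x ∣ p
  ∤⇒coprime x ¬d {d} (d∣x , d∣p) with prime⇒irreducible pp d∣p
  ... | inj₁ e = e
  ... | inj₂ refl = contradiction (∣ᵤ⇒∣ d∣x) ¬d

  opaque
    inverse : ∀ x → ¬ P ∣ x → Σ ℤ λ z → P ∣ z * x - 1ℤ
    inverse x ¬d with bezout x P (∤⇒coprime x ¬d)
    ... | s , t , eq = s , divides (- t) (trans (cong (λ e → s * x - e) (sym eq)) (solve 4 (λ s x t P → s :* x :- (s :* x :+ t :* P) := (:- t) :* P) refl s x t P))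

    residue : ∀ y → Σ (Fin p) λ j → P ∣ + toℕ j - y
    residue y = fromℕ< (n%ℕd<d y p) , divides (- (y /ℕ p))
      (trans (cong₂ (λ a b → + a - b) (Fin.toℕ-fromℕ< (n%ℕd<d y p)) (a≡a%ℕn+[a/ℕn]*n y p))
             (solve 3 (λ r q P → r :- (r :+ q :* P) := (:- q) :* P) refl (+ (y %ℕ p)) (y /ℕ p) P))

  private
    multiple<p : ∀ k → k ℕ.< p → P ∣ + k → k ≡ 0
    multiple<p zero _ _ = refl
    multiple<p (suc k) k<p d = contradiction (ℕ.∣⇒≤ (∣⇒∣ᵤ d)) (ℕ.<⇒≱ k<p)

    residue-≤ : ∀ {i j : Fin p} → toℕ j ℕ.≤ toℕ i → P ∣ + toℕ i - + toℕ j → i ≡ j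
    residue-≤ {i} {j} j≤i d with ℕ.m≤n⇒∃[o]m+o≡n j≤i
    ... | k , eq = Fin.toℕ-injective (trans (sym eq) (trans (cong (toℕ j ℕ.+_)
        (multiple<p k (ℕ.≤-<-trans (subst (k ℕ.≤_) eq (ℕ.m≤n+m k (toℕ j))) (Fin.toℕ<n i))
          (subst (P ∣_) (trans (cong (λ t → + t - + toℕ j) (sym eq)) (solve 2 (λ j k → j :+ k :- j := k) refl (+ toℕ j) (+ k))) d)))
      (ℕ.+-identityʳ (toℕ j))))

  residue-unique : ∀ {i j : Fin p} → P ∣ + toℕ i - + toℕ j → i ≡ j
  residue-unique {i} {j} d with ℕ.≤-total (toℕ j) (toℕ i)
  ... | inj₁ j≤i = residue-≤ j≤i d
  ... | inj₂ i≤j = sym (residue-≤ i≤j (∣-mult -1ℤ d (solve 2 (λ i j → j :- i := con -1ℤ :* (i :- j)) refl (+ toℕ i) (+ toℕ j))))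

  opaque
    linear : ∀ x y → ¬ P ∣ x → Σ (Fin p) λ j → P ∣ + toℕ j * x - y
    linear x y ¬d = proj₁ r , ∣-comb x y (proj₂ r) (proj₂ v) (ring (+ toℕ (proj₁ r)) x y (proj₁ v))
      where
      v : Σ ℤ λ z → P ∣ z * x - 1ℤ
      v = inverse x ¬d
      r : Σ (Fin p) λ j → P ∣ + toℕ j - proj₁ v * y
      r = residue (proj₁ v * y)
      ring : ∀ j x y z → j * x - y ≡ x * (j - z * y) + y * (z * x - 1ℤ)
      ring = solve 4 (λ j x y z → j :* x :- y := x :* (j :- z :* y) :+ y :* (z :* x :- con 1ℤ)) refl

  linear-unique : ∀ x y → ¬ P ∣ x → ∀ {i j : Fin p} → P ∣ + toℕ i * x - y → P ∣ + toℕ j * x - y → i ≡ j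
  linear-unique x y ¬d {i} {j} di dj = residue-unique (euclidʳ x (+ toℕ i - + toℕ j) ¬d
    (∣-comb 1ℤ -1ℤ di dj (solve 4 (λ i j x y → x :* (i :- j) := con 1ℤ :* (i :* x :- y) :+ con -1ℤ :* (j :* x :- y)) refl (+ toℕ i) (+ toℕ j) x y)))

-- Orbit representatives of determinant 1 and p.

unit-line : Lines 1ℤ 1
unit-line = record
  { line = λ _ → 𝟙
  ; det-line = λ _ → det-𝟙
  ; decompose = λ M d → zero , M , d , sym (⊗-identityˡ M)
  ; separate = λ { {zero} {zero} _ _ _ _ _ → refl }
  }

module PrimeLines (p : ℕ) (pp : Prime p) where
  open ModPrime p pp

  -- Right multiplication by SL₂(ℤ) preserves the column lattice, and the lattices of index p are
  -- the p + 1 points of the projective line modulo p. `zero` is the lattice y ≡ 0, `suc j` the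
  -- lattice x ≡ j y; the sign in `- P` makes the determinant positive.
  lineMat : Fin (suc p) → Mat
  lineMat zero = mat 1ℤ 0ℤ 0ℤ P
  lineMat (suc j) = mat (+ toℕ j) (- P) 1ℤ 0ℤ

  opaque
    unfolding det _⊗_

    det-lineMat : ∀ L → det (lineMat L) ≡ P
    det-lineMat zero = solve 1 (λ P → con 1ℤ :* P :- con 0ℤ :* con 0ℤ := P) refl P
    det-lineMat (suc j) = solve 2 (λ j P → j :* con 0ℤ :- (:- P) :* con 1ℤ := P) refl (+ toℕ j) P

    in-∞ : ∀ {α β γ δ} → P ∣ γ → P ∣ δ → Σ Mat λ N → mat α β γ δ ≡ lineMat zero ⊗ N
    in-∞ {α} {β} (divides x refl) (divides y refl) = mat α β x y , mat-≡
      (solve 2 (λ α x → α := con 1ℤ :* α :+ con 0ℤ :* x) refl α x) (solve 2 (λ α x → α := con 1ℤ :* α :+ con 0ℤ :* x) refl β y)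
      (solve 3 (λ α x P → x :* P := con 0ℤ :* α :+ P :* x) refl α x P) (solve 3 (λ α x P → x :* P := con 0ℤ :* α :+ P :* x) refl β y P)

    in-finite : ∀ {α β γ δ} j → P ∣ + toℕ j * γ - α → P ∣ + toℕ j * δ - β → Σ Mat λ N → mat α β γ δ ≡ lineMat (suc j) ⊗ N
    in-finite {α} {β} {γ} {δ} j (divides x ex) (divides y ey) = mat γ δ x y , mat-≡ (e α γ x ex) (e β δ y ey)
      (solve 2 (λ γ x → γ := con 1ℤ :* γ :+ con 0ℤ :* x) refl γ x) (solve 2 (λ γ x → γ := con 1ℤ :* γ :+ con 0ℤ :* x) refl δ y)
      where
      e : ∀ α γ x → + toℕ j * γ - α ≡ x * P → α ≡ + toℕ j * γ + - P * x
      e α γ x ex = trans (solve 3 (λ α j γ → α := j :* γ :- (j :* γ :- α)) refl α (+ toℕ j) γ)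
        (trans (cong (λ t → + toℕ j * γ - t) ex) (solve 4 (λ j γ x P → j :* γ :- x :* P := j :* γ :+ (:- P) :* x) refl (+ toℕ j) γ x P))

    -- The columns are proportional modulo p because p divides the determinant. An invertible entry
    -- of the second row determines `j` from its own column, and the determinant gives the
    -- congruence for the other one.
    in-some-line : ∀ M → det M ≡ P → Σ (Fin (suc p)) λ L → Σ Mat λ N → M ≡ lineMat L ⊗ N
    in-some-line (mat α β γ δ) dM = cases (P ∣? γ) (P ∣? δ)
      where
      P∣det : P ∣ α * δ - β * γ
      P∣det = divides 1ℤ (trans dM (sym (ℤ.*-identityˡ P)))
      ringγ : ∀ j α β γ δ → γ * (j * δ - β) ≡ δ * (j * γ - α) + 1ℤ * (α * δ - β * γ)
      ringγ = solve 5 (λ j α β γ δ → γ :* (j :* δ :- β) := δ :* (j :* γ :- α) :+ con 1ℤ :* (α :* δ :- β :* γ)) refl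
      ringδ : ∀ j α β γ δ → δ * (j * γ - α) ≡ γ * (j * δ - β) + -1ℤ * (α * δ - β * γ)
      ringδ = solve 5 (λ j α β γ δ → δ :* (j :* γ :- α) := γ :* (j :* δ :- β) :+ con -1ℤ :* (α :* δ :- β :* γ)) refl
      via-γ : ¬ P ∣ γ → (Σ (Fin p) λ j → P ∣ + toℕ j * γ - α) → Σ (Fin (suc p)) λ L → Σ Mat λ N → mat α β γ δ ≡ lineMat L ⊗ N
      via-γ ¬dγ (j , dj) = suc j , in-finite j dj (euclidʳ γ (+ toℕ j * δ - β) ¬dγ (∣-comb δ 1ℤ dj P∣det (ringγ (+ toℕ j) α β γ δ)))
      via-δ : ¬ P ∣ δ → (Σ (Fin p) λ j → P ∣ + toℕ j * δ - β) → Σ (Fin (suc p)) λ L → Σ Mat λ N → mat α β γ δ ≡ lineMat L ⊗ N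
      via-δ ¬dδ (j , dj) = suc j , in-finite j (euclidʳ δ (+ toℕ j * γ - α) ¬dδ (∣-comb γ -1ℤ dj P∣det (ringδ (+ toℕ j) α β γ δ))) dj
      cases : Dec (P ∣ γ) → Dec (P ∣ δ) → Σ (Fin (suc p)) λ L → Σ Mat λ N → mat α β γ δ ≡ lineMat L ⊗ N
      cases (yes dγ) (yes dδ) = zero , in-∞ dγ dδ
      cases (no ¬dγ) _ = via-γ ¬dγ (linear γ α ¬dγ)
      cases (yes _) (no ¬dδ) = via-δ ¬dδ (linear δ β ¬dδ)

    row-not-divisible : ∀ {x y z w} → det (mat x y z w) ≡ 1ℤ → P ∣ x → P ∣ y → ∀ {A : Set} → A
    row-not-divisible {x} {y} {z} {w} d dx dy = contradiction
      (subst (P ∣_) d (∣-comb w (- z) dx dy (solve 4 (λ x y z w → x :* w :- y :* z := w :* x :+ (:- z) :* y) refl x y z w))) ∤1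

    -- Were the lines different, comparing entries would make the first row of `N` or `N′` divisible
    -- by p, which determinant 1 forbids.
    separate-lines : ∀ {L L′} N N′ → det N ≡ 1ℤ → det N′ ≡ 1ℤ → lineMat L ⊗ N ≡ lineMat L′ ⊗ N′ → L ≡ L′
    separate-lines {zero} {zero} _ _ _ _ _ = refl
    separate-lines {zero} {suc j} (mat x y z w) (mat x′ y′ z′ w′) _ d′ eq =
      row-not-divisible d′ (low x z x′ z′ (cong m₂₁ eq)) (low y w y′ w′ (cong m₂₂ eq))
      where
      low : ∀ x z x′ z′ → 0ℤ * x + P * z ≡ 1ℤ * x′ + 0ℤ * z′ → P ∣ x′
      low x z x′ z′ e = divides z (trans (solve 2 (λ x z → x := con 1ℤ :* x :+ con 0ℤ :* z) refl x′ z′)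
        (trans (sym e) (solve 3 (λ x z P → con 0ℤ :* x :+ P :* z := z :* P) refl x z P)))
    separate-lines {suc j} {zero} N N′ d d′ eq = sym (separate-lines N′ N d′ d (sym eq))
    separate-lines {suc i} {suc j} (mat x y z w) (mat x′ y′ z′ w′) d _ eq with P ∣? (+ toℕ i - + toℕ j)
    ... | yes e = cong suc (residue-unique e)
    ... | no ¬e = row-not-divisible d (col x z x′ z′ (cong m₁₁ eq) (cong m₂₁ eq)) (col y w y′ w′ (cong m₁₂ eq) (cong m₂₂ eq))
      where
      col : ∀ x z x′ z′ → + toℕ i * x + - P * z ≡ + toℕ j * x′ + - P * z′ → 1ℤ * x + 0ℤ * z ≡ 1ℤ * x′ + 0ℤ * z′ → P ∣ x
      col x z x′ z′ e₁ e₂ with trans (solve 2 (λ x z → x := con 1ℤ :* x :+ con 0ℤ :* z) refl x z) (trans e₂ (solve 2 (λ x z → con 1ℤ :* x :+ con 0ℤ :* z := x) refl x′ z′))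
      ... | refl = euclidʳ (+ toℕ i - + toℕ j) x ¬e (divides (z - z′)
        (trans (solve 5 (λ i j x P z → (i :- j) :* x := i :* x :+ (:- P) :* z :+ P :* z :- j :* x) refl (+ toℕ i) (+ toℕ j) x P z)
        (trans (cong (λ t → t + P * z - + toℕ j * x) e₁)
          (solve 5 (λ j x P z z′ → j :* x :+ (:- P) :* z′ :+ P :* z :- j :* x := (z :- z′) :* P) refl (+ toℕ j) x P z z′))))

  P≢0 : P ≢ 0ℤ
  P≢0 = positive⇒≢0 P>0

  prime-lines : Lines P (suc p)
  prime-lines = record
    { line = lineMat
    ; det-line = det-lineMat
    ; decompose = dec
    ; separate = separate-lines
    }
    where
    dec : ∀ M → det M ≡ P → Σ (Fin (suc p)) λ L → Σ Mat λ N → det N ≡ 1ℤ × M ≡ lineMat L ⊗ N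
    dec M dM with in-some-line M dM
    ... | L , N , refl = L , N , ℤ.*-cancelˡ-≡ P (det N) 1ℤ {{ℤ.≢-nonZero P≢0}}
       (trans (cong (_* det N) (sym (det-lineMat L))) (trans (sym (det-⊗ (lineMat L) N)) (trans dM (sym (ℤ.*-identityʳ P))))) , refl

*⊙𝟙 : ∀ {s} g → Divides (1ℤ * 1ℤ * s) (g ⊙ 𝟙) → Divides s g
*⊙𝟙 {s} g (f , eq) = f , trans (cong (_• f) (sym (ℤ.*-identityˡ s))) (trans eq (⊙-𝟙 g))

*⊙𝟙⁻¹ : ∀ {s} g → Divides s g → Divides (1ℤ * 1ℤ * s) (g ⊙ 𝟙)
*⊙𝟙⁻¹ {s} g (f , eq) = f , trans (cong (_• f) (ℤ.*-identityˡ s)) (trans eq (sym (⊙-𝟙 g)))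

indicator-cong : ∀ {P Q : Set} (P? : Dec P) (Q? : Dec Q) → (P → Q) → (Q → P) → indicator P? ≡ indicator Q?
indicator-cong (yes p) Q? f g = sym (indicator-true Q? (f p))
indicator-cong (no ¬p) Q? f g = sym (indicator-false Q? (¬p ∘ g))

-- The correspondence for `d = 1`: dividing by `s` matches the forms of discriminant -D′ that are
-- divisible by `s` with the forms of discriminant -D, automorphisms included.
scaling : ∀ {D D′} s → 0ℤ < s → D′ ≡ s * s * D → (X : Classes D) (Y : Classes D′) →
  total X ≡ ∑[ j < size Y ] (weight Y j ℕ.* indicator (divides? s (rep Y j)))
scaling {D} {D′} s s>0 eq X Y = trans (sym (ℕ.*-identityˡ (total X))) (trans correspondence (sum-cong-≗ λ j → cong (weight Y j ℕ.*_)
    (trans (ℕ.+-identityʳ _) (indicator-cong (divides? (1ℤ * 1ℤ * s) (rep Y j ⊙ 𝟙)) (divides? s (rep Y j)) (*⊙𝟙 _) (*⊙𝟙⁻¹ _)))))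
  where
  open Correspondence X Y unit-line (+<+ ℕ.z<s) s>0 (trans eq (solve 2 (λ s D → s :* s :* D := s :* s :* (con 1ℤ :* con 1ℤ) :* D) refl s D))

-- `scaling` with `s = 1`, where every form is divisible by `s`. This frees `total` from the choice
-- of representatives.
total-unique : ∀ {D} (X Y : Classes D) → total X ≡ total Y
total-unique {D} X Y = trans (scaling 1ℤ (+<+ ℕ.z<s) (solve 1 (λ D → D := con 1ℤ :* con 1ℤ :* D) refl D) X Y)
  (sum-cong-≗ λ j → trans (cong (weight Y j ℕ.*_) (indicator-true (divides? 1ℤ (rep Y j)) (rep Y j , 1• (rep Y j)))) (ℕ.*-identityʳ (weight Y j)))

-- Hecke relations at odd primes

module _ {n : ℕ} {Q : Fin n → Set} (Q? : ∀ i → Dec (Q i)) where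
  count-all : (∀ i → Q i) → ∑[ i < n ] indicator (Q? i) ≡ n
  count-all q = trans (sum-cong-≗ λ i → indicator-true (Q? i) (q i)) (trans (∑-const n 1) (ℕ.*-identityʳ n))

  count-none : (∀ i → ¬ Q i) → ∑[ i < n ] indicator (Q? i) ≡ 0
  count-none ¬q = trans (sum-cong-≗ λ i → indicator-false (Q? i) (¬q i)) (∑-zero n)

  count-one : ∀ i → Q i → (∀ {j} → Q j → j ≡ i) → ∑[ i < n ] indicator (Q? i) ≡ 1
  count-one i q only = trans (∑-single _ i λ j j≢i → indicator-false (Q? j) (j≢i ∘ only)) (indicator-true (Q? i) q)

  count-two : ∀ i j → i ≢ j → Q i → Q j → (∀ {k} → Q k → k ≡ i ⊎ k ≡ j) → ∑[ i < n ] indicator (Q? i) ≡ 2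
  count-two i j i≢j qi qj only = trans (sum-cong-≗ split) (trans (∑-distrib-+ (λ k → indicator (k Fin.≟ i)) (λ k → indicator (k Fin.≟ j)))
      (cong₂ ℕ._+_ (one i) (one j)))
    where
    one : ∀ i → ∑[ k < n ] indicator (k Fin.≟ i) ≡ 1
    one i = trans (∑-single _ i λ k k≢i → indicator-false (k Fin.≟ i) k≢i) (indicator-true (i Fin.≟ i) refl)
    split : ∀ k → indicator (Q? k) ≡ indicator (k Fin.≟ i) ℕ.+ indicator (k Fin.≟ j)
    split k with k Fin.≟ i | k Fin.≟ j
    ... | yes refl | yes refl = contradiction refl i≢j
    ... | yes refl | no _ = indicator-true (Q? k) qi
    ... | no _ | yes refl = indicator-true (Q? k) qj
    ... | no k≢i | no k≢j = indicator-false (Q? k) λ q → [ k≢i , k≢j ] (only q)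

private
  ring₁ : ∀ x q P → x * (q * P) ≡ P * (x * q)
  ring₁ = solve 3 (λ x q P → x :* (q :* P) := P :* (x :* q)) refl

  ring₂ : ∀ a b c → a * 1ℤ * 1ℤ + b * 1ℤ * 0ℤ + c * 0ℤ * 0ℤ ≡ a
  ring₂ = solve 3 (λ a b c → a :* con 1ℤ :* con 1ℤ :+ b :* con 1ℤ :* con 0ℤ :+ c :* con 0ℤ :* con 0ℤ := a) refl

  ring₃ : ∀ a b c P → (+ 2) * a * 1ℤ * 0ℤ + b * (1ℤ * P + 0ℤ * 0ℤ) + (+ 2) * c * 0ℤ * P ≡ P * b
  ring₃ = solve 4 (λ a b c P → con (+ 2) :* a :* con 1ℤ :* con 0ℤ :+ b :* (con 1ℤ :* P :+ con 0ℤ :* con 0ℤ) :+ con (+ 2) :* c :* con 0ℤ :* P := P :* b) refl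

  ring₄ : ∀ a b c → a ≡ a * 1ℤ * 1ℤ + b * 1ℤ * 0ℤ + c * 0ℤ * 0ℤ
  ring₄ = solve 3 (λ a b c → a := a :* con 1ℤ :* con 1ℤ :+ b :* con 1ℤ :* con 0ℤ :+ c :* con 0ℤ :* con 0ℤ) refl

  ring₅ : ∀ a b c P → a * 0ℤ * 0ℤ + b * 0ℤ * P + c * P * P ≡ c * (P * P)
  ring₅ = solve 4 (λ a b c P → a :* con 0ℤ :* con 0ℤ :+ b :* con 0ℤ :* P :+ c :* P :* P := c :* (P :* P)) refl

  ring₆ : ∀ a b c P → a * (- P) * (- P) + b * (- P) * 0ℤ + c * 0ℤ * 0ℤ ≡ a * (P * P)
  ring₆ = solve 4 (λ a b c P → a :* (:- P) :* (:- P) :+ b :* (:- P) :* con 0ℤ :+ c :* con 0ℤ :* con 0ℤ := a :* (P :* P)) refl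

  ring₇ : ∀ a b c j P → P * a * j * j + P * b * j * 1ℤ + P * c * 1ℤ * 1ℤ ≡ P * (a * j * j + b * j * 1ℤ + c * 1ℤ * 1ℤ)
  ring₇ = solve 5 (λ a b c j P → P :* a :* j :* j :+ P :* b :* j :* con 1ℤ :+ P :* c :* con 1ℤ :* con 1ℤ := P :* (a :* j :* j :+ b :* j :* con 1ℤ :+ c :* con 1ℤ :* con 1ℤ)) refl

  ring₈ : ∀ a b j P → j * ((+ 2) * (P * a)) - - (P * b) ≡ (j * ((+ 2) * a) - - b) * P
  ring₈ = solve 4 (λ a b j P → j :* (con (+ 2) :* (P :* a)) :- :- (P :* b) := (j :* (con (+ 2) :* a) :- :- b) :* P) refl

  ring₉ : ∀ a b c → b * b ≡ 1ℤ * (b * b - (+ 4) * a * c) + (+ 4) * c * a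
  ring₉ = solve 3 (λ a b c → b :* b := con 1ℤ :* (b :* b :- con (+ 4) :* a :* c) :+ con (+ 4) :* c :* a) refl

  ring₁₀ : ∀ a b c j → c ≡ 1ℤ * (a * j * j + b * j * 1ℤ + c * 1ℤ * 1ℤ) + -1ℤ * (j * j * a + j * b)
  ring₁₀ = solve 4 (λ a b c j → c := con 1ℤ :* (a :* j :* j :+ b :* j :* con 1ℤ :+ c :* con 1ℤ :* con 1ℤ) :+ con -1ℤ :* (j :* j :* a :+ j :* b)) refl

  ring₁₁ : ∀ x y → x - y ≡ 1ℤ * x + -1ℤ * y
  ring₁₁ = solve 2 (λ x y → x :- y := con 1ℤ :* x :+ con -1ℤ :* y) refl

  ring₁₂ : ∀ q P → q * P * (q * P) ≡ q * q * (P * P)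
  ring₁₂ = solve 2 (λ q P → q :* P :* (q :* P) := q :* q :* (P :* P)) refl

  ring₁₃ : ∀ a b c → (+ 4) * c * a ≡ b * b - (b * b - (+ 4) * a * c)
  ring₁₃ = solve 3 (λ a b c → con (+ 4) :* c :* a := b :* b :- (b :* b :- con (+ 4) :* a :* c)) refl

  ring₁₄ : ∀ a b c j → a * j * j + b * j * 1ℤ + c * 1ℤ * 1ℤ ≡ j * (j * a + 1ℤ * b) + 1ℤ * c
  ring₁₄ = solve 4 (λ a b c j → a :* j :* j :+ b :* j :* con 1ℤ :+ c :* con 1ℤ :* con 1ℤ := j :* (j :* a :+ con 1ℤ :* b) :+ con 1ℤ :* c) refl

  ring₁₅ : ∀ w d → w * w - d ≡ w * w + -1ℤ * d
  ring₁₅ = solve 2 (λ w d → w :* w :- d := w :* w :+ con -1ℤ :* d) refl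

  ring₁₆ : ∀ w d → w * w ≡ w * w - d + 1ℤ * d
  ring₁₆ = solve 2 (λ w d → w :* w := w :* w :- d :+ con 1ℤ :* d) refl

  ring₁₇ : ∀ a b c → b * b - (b * b - (+ 4) * a * c) ≡ (+ 4) * c * a
  ring₁₇ = solve 3 (λ a b c → b :* b :- (b :* b :- con (+ 4) :* a :* c) := con (+ 4) :* c :* a) refl

  ring₁₈ : ∀ r d → d ≡ r * r + -1ℤ * (r * r - d)
  ring₁₈ = solve 2 (λ r d → d := r :* r :+ con -1ℤ :* (r :* r :- d)) refl

  ring₁₉ : ∀ w r d → w * w - d ≡ 1ℤ * (w * w - r * r) + 1ℤ * (r * r - d)
  ring₁₉ = solve 3 (λ w r d → w :* w :- d := con 1ℤ :* (w :* w :- r :* r) :+ con 1ℤ :* (r :* r :- d)) refl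

  ring₂₀ : ∀ j a b r → (j * ((+ 2) * a) - - b) * (j * ((+ 2) * a) - - b) - r * r ≡ (j * ((+ 2) * a) - - b + r) * (j * ((+ 2) * a) - (r - b))
  ring₂₀ = solve 4 (λ j a b r → (j :* (con (+ 2) :* a) :- :- b) :* (j :* (con (+ 2) :* a) :- :- b) :- r :* r := (j :* (con (+ 2) :* a) :- :- b :+ r) :* (j :* (con (+ 2) :* a) :- (r :- b))) refl

  ring₂₁ : ∀ j a b r → (j * ((+ 2) * a) - - b) * (j * ((+ 2) * a) - - b) - r * r ≡ (j * ((+ 2) * a) - - b - r) * (j * ((+ 2) * a) - (- r - b))
  ring₂₁ = solve 4 (λ j a b r → (j :* (con (+ 2) :* a) :- :- b) :* (j :* (con (+ 2) :* a) :- :- b) :- r :* r := (j :* (con (+ 2) :* a) :- :- b :- r) :* (j :* (con (+ 2) :* a) :- (:- r :- b))) refl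

  ring₂₂ : ∀ j a b r → (+ 2) * r ≡ 1ℤ * (j * ((+ 2) * a) - (- r - b)) + -1ℤ * (j * ((+ 2) * a) - (r - b))
  ring₂₂ = solve 4 (λ j a b r → con (+ 2) :* r := con 1ℤ :* (j :* (con (+ 2) :* a) :- (:- r :- b)) :+ con -1ℤ :* (j :* (con (+ 2) :* a) :- (r :- b))) refl

  ring₂₃ : ∀ j a b r d → (j * ((+ 2) * a) - (r - b)) * (j * ((+ 2) * a) - (- r - b)) ≡ (j * ((+ 2) * a) - - b) * (j * ((+ 2) * a) - - b) - d + -1ℤ * (r * r - d)
  ring₂₃ = solve 5 (λ j a b r d → (j :* (con (+ 2) :* a) :- (r :- b)) :* (j :* (con (+ 2) :* a) :- (:- r :- b)) := (j :* (con (+ 2) :* a) :- :- b) :* (j :* (con (+ 2) :* a) :- :- b) :- d :+ con -1ℤ :* (r :* r :- d)) refl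

  ring₂₄ : ∀ a b c → b * b - (+ 4) * a * c ≡ b * b + (- ((+ 4) * c)) * a
  ring₂₄ = solve 3 (λ a b c → b :* b :- con (+ 4) :* a :* c := b :* b :+ (:- (con (+ 4) :* c)) :* a) refl

  ring₂₅ : ∀ a b c j → a * j * j + b * j * 1ℤ + c * 1ℤ * 1ℤ ≡ j * j * a + 1ℤ * (j * b - - c)
  ring₂₅ = solve 4 (λ a b c j → a :* j :* j :+ b :* j :* con 1ℤ :+ c :* con 1ℤ :* con 1ℤ := j :* j :* a :+ con 1ℤ :* (j :* b :- :- c)) refl

  ring₂₆ : ∀ a b c j → j * b - - c ≡ 1ℤ * (a * j * j + b * j * 1ℤ + c * 1ℤ * 1ℤ) + (- (j * j)) * a
  ring₂₆ = solve 4 (λ a b c j → j :* b :- :- c := con 1ℤ :* (a :* j :* j :+ b :* j :* con 1ℤ :+ c :* con 1ℤ :* con 1ℤ) :+ (:- (j :* j)) :* a) refl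

module Overlattices (p : ℕ) (pp : Prime p) (odd : ¬ + p ∣ + 2) where
  open ModPrime p pp
  open PrimeLines p pp

  -- `P * P * 1ℤ` is the `q` of `Correspondence` at `s = 1`, kept unsimplified so that the two
  -- counts coincide.
  overlattices : Form → ℕ
  overlattices g = ∑[ K < suc p ] indicator (divides? (P * P * 1ℤ) (g ⊙ lineMat K))

  -- The last coefficient of `g ⊙ lineMat K` is a multiple of P² and the middle one of P, so these
  -- conditions are what remains of divisibility by P². The double minus is the shape in which
  -- `linear` solves 2 A j ≡ - B.
  Integral : Form → Fin (suc p) → Set
  Integral g zero = P * P ∣ A g × P ∣ B g
  Integral g (suc j) = P * P ∣ value g (+ toℕ j) 1ℤ × P ∣ + toℕ j * (+ 2 * A g) - - B g

  -- For `g = P • f` the conditions reduce to a zero of `f` modulo p at a point of the projective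
  -- line, `zero` being the point (1 : 0).
  Root : Form → Fin (suc p) → Set
  Root f zero = P ∣ A f
  Root f (suc j) = P ∣ value f (+ toℕ j) 1ℤ

  private
    instance
      P-nonZero : ℤ.NonZero P
      P-nonZero = ℤ.≢-nonZero P≢0

    PP1 : P * P * 1ℤ ≡ P * P
    PP1 = ℤ.*-identityʳ (P * P)

    from-PP1 : ∀ {z} → P * P * 1ℤ ∣ z → P * P ∣ z
    from-PP1 {z} = subst (_∣ z) PP1

    to-PP1 : ∀ {z} → P * P ∣ z → P * P * 1ℤ ∣ z
    to-PP1 {z} = subst (_∣ z) (sym PP1)

    cancel-P : ∀ {x y} → P * P ∣ y → y ≡ P * x → P ∣ x
    cancel-P {x} d refl = *-cancelˡ-∣ P d

    times-P : ∀ {x y} → P ∣ x → y ≡ P * x → P * P ∣ y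
    times-P {x} d refl = *-monoʳ-∣ P d

    PP∣⇒P∣ : ∀ {x} → P * P ∣ x → P ∣ x
    PP∣⇒P∣ = ∣-trans (∣-mult P ∣-refl refl)

    cancel-unit : ∀ x y → ¬ P ∣ x → P * P ∣ x * y → P * P ∣ y
    cancel-unit x y ¬d d = go (euclidʳ x y ¬d (PP∣⇒P∣ d)) d
      where
      go : ∀ {y} → P ∣ y → P * P ∣ x * y → P * P ∣ y
      go (divides q refl) d = times-P (euclidʳ x q ¬d (cancel-P d (ring₁ x q P))) (ℤ.*-comm q P)

  opaque
    unfolding _⊙_

    integral⁺ : ∀ g K → Divides (P * P * 1ℤ) (g ⊙ lineMat K) → Integral g K
    integral⁺ g@(form a b c) zero δ =
      subst₂ _∣_ PP1 (ring₂ a b c) (proj₁ (Divides-elim δ)) ,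
      cancel-P (from-PP1 (proj₁ (proj₂ (Divides-elim δ))))
        (ring₃ a b c P)
    integral⁺ g@(form a b c) (suc j) δ =
      from-PP1 (proj₁ (Divides-elim δ)) ,
      ∣-mult -1ℤ (cancel-P { - (+ toℕ j * (+ 2 * a) - - b)} (from-PP1 (proj₁ (proj₂ (Divides-elim δ)))) (ring (+ toℕ j) a b c P)) (ring′ (+ toℕ j * (+ 2 * a) - - b))
      where
      ring : ∀ j a b c P → + 2 * a * j * - P + b * (j * 0ℤ + - P * 1ℤ) + + 2 * c * 1ℤ * 0ℤ ≡ P * - (j * (+ 2 * a) - - b)
      ring = solve 5 (λ j a b c P → con (+ 2) :* a :* j :* :- P :+ b :* (j :* con 0ℤ :+ :- P :* con 1ℤ) :+ con (+ 2) :* c :* con 1ℤ :* con 0ℤ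
                 := P :* :- (j :* (con (+ 2) :* a) :- :- b)) refl
      ring′ : ∀ x → x ≡ -1ℤ * - x
      ring′ = solve 1 (λ x → x := con -1ℤ :* :- x) refl

    integral⁻ : ∀ g K → Integral g K → Divides (P * P * 1ℤ) (g ⊙ lineMat K)
    integral⁻ g@(form a b c) zero (dA , dB) = Divides-intro
      (subst₂ _∣_ (sym PP1) (ring₄ a b c) dA)
      (to-PP1 (times-P dB
        (ring₃ a b c P)))
      (to-PP1 (divides c (ring₅ a b c P)))
    integral⁻ g@(form a b c) (suc j) (dv , dB) = Divides-intro
      (to-PP1 dv)
      (to-PP1 (times-P (∣-mult -1ℤ dB refl) (ring (+ toℕ j) a b c P)))
      (to-PP1 (divides a (ring₆ a b c P)))
      where
      ring : ∀ j a b c P → + 2 * a * j * - P + b * (j * 0ℤ + - P * 1ℤ) + + 2 * c * 1ℤ * 0ℤ ≡ P * (-1ℤ * (j * (+ 2 * a) - - b))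
      ring = solve 5 (λ j a b c P → con (+ 2) :* a :* j :* :- P :+ b :* (j :* con 0ℤ :+ :- P :* con 1ℤ) :+ con (+ 2) :* c :* con 1ℤ :* con 0ℤ
                 := P :* (con -1ℤ :* (j :* (con (+ 2) :* a) :- :- b))) refl

  opaque
    unfolding _•_

    root⁺ : ∀ f K → Integral (P • f) K → Root f K
    root⁺ f zero (d , _) = cancel-P d refl
    root⁺ f@(form a b c) (suc j) (d , _) = cancel-P d
      (ring₇ a b c (+ toℕ j) P)

    root⁻ : ∀ f K → Root f K → Integral (P • f) K
    root⁻ f@(form a b c) zero d = times-P d refl , ∣-mult b ∣-refl (ℤ.*-comm P b)
    root⁻ f@(form a b c) (suc j) d = times-P d
      (ring₇ a b c (+ toℕ j) P) ,
      divides (+ toℕ j * (+ 2 * a) - - b) (ring₈ a b (+ toℕ j) P)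

  overlattices-• : ∀ f K → Divides (P * P * 1ℤ) (P • f ⊙ lineMat K) → Root f K
  overlattices-• f K δ = root⁺ f K (integral⁺ (P • f) K δ)

  overlattices-•⁻ : ∀ f K → Root f K → Divides (P * P * 1ℤ) (P • f ⊙ lineMat K)
  overlattices-•⁻ f K r = integral⁻ (P • f) K (root⁻ f K r)

  private
    ∤4* : ∀ {x} → ¬ P ∣ x → ¬ P ∣ + 4 * x
    ∤4* {x} ¬d d with euclid (+ 4) x d
    ... | inj₂ e = ¬d e
    ... | inj₁ e with euclid (+ 2) (+ 2) e
    ... | inj₁ e′ = odd e′
    ... | inj₂ e′ = odd e′

    ∤2* : ∀ {x} → ¬ P ∣ x → ¬ P ∣ + 2 * x
    ∤2* {x} ¬d d with euclid (+ 2) x d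
    ... | inj₁ e = odd e
    ... | inj₂ e = ¬d e

    complete-square : ∀ f j → + 4 * A f * value f j 1ℤ ≡ (j * (+ 2 * A f) - - B f) * (j * (+ 2 * A f) - - B f) - disc f
    complete-square (form a b c) j = solve 4 (λ a b c j → con (+ 4) :* a :* (a :* j :* j :+ b :* j :* con 1ℤ :+ c :* con 1ℤ :* con 1ℤ)
       := (j :* (con (+ 2) :* a) :- :- b) :* (j :* (con (+ 2) :* a) :- :- b) :- (b :* b :- con (+ 4) :* a :* c)) refl a b c j

    P∣B : ∀ f → P ∣ disc f → P ∣ A f → P ∣ B f
    P∣B (form a b c) dd da = square⇒∣ b (∣-comb 1ℤ (+ 4 * c) dd da
      (ring₉ a b c))

    P∣C : ∀ f j → P ∣ A f → P ∣ B f → P ∣ value f j 1ℤ → P ∣ C f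
    P∣C (form a b c) j da db dv = ∣-comb 1ℤ -1ℤ dv (∣-comb (j * j) j da db refl)
      (ring₁₀ a b c j)

    PP∣-diff : ∀ {x y z} → P * P ∣ x → P * P ∣ y → z ≡ x - y → P * P ∣ z
    PP∣-diff {x} {y} dx dy e = ∣-comb 1ℤ -1ℤ dx dy (trans e (ring₁₁ x y))

    square-PP : ∀ x → P ∣ x → P * P ∣ x * x
    square-PP _ (divides q refl) = divides (q * q) (ring₁₂ q P)

  -- Modulo p the form has one double root. If P ∤ A it solves 2 A j + B ≡ 0, and completing the
  -- square lifts the vanishing to P². If P ∣ A, then P ∣ B and P ∤ C, and 4 A C = B² - disc gives
  -- P² ∣ A: the root is the point at infinity.
  overlattices-primitive : ∀ g → P * P ∣ disc g → ¬ Divides P g → overlattices g ≡ 1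
  overlattices-primitive g dd prim = cases (P ∣? A g)
    where
    cases : Dec (P ∣ A g) → overlattices g ≡ 1
    cases (no ¬dA) = count-one (λ K → divides? _ (g ⊙ lineMat K)) (suc j₀) (integral⁻ g (suc j₀) (dv , d₀)) (λ {K} δ → only K (integral⁺ g K δ))
      where
      sol = linear (+ 2 * A g) (- B g) (∤2* ¬dA)
      j₀ = proj₁ sol
      d₀ : P ∣ + toℕ j₀ * (+ 2 * A g) - - B g
      d₀ = proj₂ sol
      dv : P * P ∣ value g (+ toℕ j₀) 1ℤ
      dv = cancel-unit (+ 4 * A g) _ (∤4* ¬dA) (PP∣-diff (square-PP _ d₀) dd (complete-square g (+ toℕ j₀)))
      only : ∀ K → Integral g K → K ≡ suc j₀
      only zero (dA , _) = contradiction (PP∣⇒P∣ dA) ¬dA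
      only (suc j) (_ , d) = cong suc (linear-unique (+ 2 * A g) (- B g) (∤2* ¬dA) d d₀)
    cases (yes dA) = count-one (λ K → divides? _ (g ⊙ lineMat K)) zero (integral⁻ g zero (ddA , dB)) (λ {K} δ → only K (integral⁺ g K δ))
      where
      dB = P∣B g (PP∣⇒P∣ dd) dA
      ¬dC : ¬ P ∣ C g
      ¬dC dC = prim (Divides-intro dA dB dC)
      ddA : P * P ∣ A g
      ddA = cancel-unit (+ 4 * C g) (A g) (∤4* ¬dC) (PP∣-diff (square-PP (B g) dB) dd
        (ring₁₃ (A g) (B g) (C g)))
      only : ∀ K → Integral g K → K ≡ zero
      only zero _ = refl
      only (suc j) (dv , _) = contradiction (P∣C g (+ toℕ j) dA dB (PP∣⇒P∣ dv)) ¬dC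

  overlattices-divisible : ∀ f → Divides P f → overlattices (P • f) ≡ suc p
  overlattices-divisible f δ = count-all (λ K → divides? _ (P • f ⊙ lineMat K)) λ K → overlattices-•⁻ f K (root K)
    where
    root : ∀ K → Root f K
    root zero = proj₁ (Divides-elim δ)
    root (suc j) = ∣-comb (+ toℕ j) 1ℤ (∣-comb (+ toℕ j) 1ℤ (proj₁ (Divides-elim δ)) (proj₁ (proj₂ (Divides-elim δ))) refl) (proj₂ (proj₂ (Divides-elim δ)))
      (ring₁₄ (A f) (B f) (C f) (+ toℕ j))

  -- Modulo p such a form is a nonzero constant times the square of a linear form, so it has a
  -- single projective root.
  overlattices-ramified : ∀ f → P ∣ disc f → ¬ Divides P f → overlattices (P • f) ≡ 1
  overlattices-ramified f dd prim = cases (P ∣? A f)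
    where
    cases : Dec (P ∣ A f) → overlattices (P • f) ≡ 1
    cases (no ¬dA) = count-one (λ K → divides? _ (P • f ⊙ lineMat K)) (suc j₀) (overlattices-•⁻ f (suc j₀) dv) (λ {K} δ → only K (overlattices-• f K δ))
      where
      sol = linear (+ 2 * A f) (- B f) (∤2* ¬dA)
      j₀ = proj₁ sol
      d₀ : P ∣ + toℕ j₀ * (+ 2 * A f) - - B f
      d₀ = proj₂ sol
      w : ℤ → ℤ
      w j = j * (+ 2 * A f) - - B f
      dv : P ∣ value f (+ toℕ j₀) 1ℤ
      dv = euclidʳ (+ 4 * A f) _ (∤4* ¬dA) (∣-comb (w (+ toℕ j₀)) -1ℤ d₀ dd
        (trans (complete-square f (+ toℕ j₀)) (ring₁₅ (w (+ toℕ j₀)) (disc f))))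
      only : ∀ K → Root f K → K ≡ suc j₀
      only zero dA = contradiction dA ¬dA
      only (suc j) d = cong suc (linear-unique (+ 2 * A f) (- B f) (∤2* ¬dA)
        (square⇒∣ (w (+ toℕ j)) (∣-comb (+ 4 * A f) 1ℤ d dd (trans (ring₁₆ (w (+ toℕ j)) (disc f))
           (cong (_+ 1ℤ * disc f) (sym (complete-square f (+ toℕ j))))))) d₀)
    cases (yes dA) = count-one (λ K → divides? _ (P • f ⊙ lineMat K)) zero (overlattices-•⁻ f zero dA) (λ {K} δ → only K (overlattices-• f K δ))
      where
      dB = P∣B f dd dA
      only : ∀ K → Root f K → K ≡ zero
      only zero _ = refl
      only (suc j) dv = contradiction (Divides-intro dA dB (P∣C f (+ toℕ j) dA dB dv)) prim

  -- A root would exhibit the discriminant as a square modulo p: of B at infinity, of 2 A j + B at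
  -- `j`.
  overlattices-inert : ∀ f → (∀ r → ¬ P ∣ r * r - disc f) → overlattices (P • f) ≡ 0
  overlattices-inert f nonsquare = count-none (λ K → divides? _ (P • f ⊙ lineMat K)) λ K δ → no-root K (overlattices-• f K δ)
    where
    no-root : ∀ K → ¬ Root f K
    no-root zero dA = nonsquare (B f) (∣-mult (+ 4 * C f) dA
      (ring₁₇ (A f) (B f) (C f)))
    no-root (suc j) dv = nonsquare (+ toℕ j * (+ 2 * A f) - - B f) (∣-mult (+ 4 * A f) dv (sym (complete-square f (+ toℕ j))))

  -- The roots solve 2 A j + B ≡ ± r and differ because 2 r is a unit. If P ∣ A, one root is at
  -- infinity and the other solves B j + C ≡ 0.
  overlattices-split : ∀ f r → ¬ P ∣ disc f → P ∣ r * r - disc f → overlattices (P • f) ≡ 2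
  overlattices-split f r ¬dd dr = cases (P ∣? A f)
    where
    ¬r : ¬ P ∣ r
    ¬r d = ¬dd (∣-comb r -1ℤ d dr (ring₁₈ r (disc f)))
    cases : Dec (P ∣ A f) → overlattices (P • f) ≡ 2
    cases (no ¬dA) = count-two (λ K → divides? _ (P • f ⊙ lineMat K)) (suc j₁) (suc j₂) j₁≢j₂
        (overlattices-•⁻ f (suc j₁) (root₁ (proj₁ s₁) (proj₂ s₁))) (overlattices-•⁻ f (suc j₂) (root₂ (proj₁ s₂) (proj₂ s₂))) (λ {K} δ → only K (overlattices-• f K δ))
      where
      s₁ = linear (+ 2 * A f) (r - B f) (∤2* ¬dA)
      s₂ = linear (+ 2 * A f) (- r - B f) (∤2* ¬dA)
      j₁ = proj₁ s₁
      j₂ = proj₁ s₂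
      w : ℤ → ℤ
      w j = j * (+ 2 * A f) - - B f
      value-root : ∀ j → P ∣ w j * w j - r * r → P ∣ value f j 1ℤ
      value-root j d = euclidʳ (+ 4 * A f) _ (∤4* ¬dA) (∣-comb 1ℤ 1ℤ d dr
        (trans (complete-square f j) (ring₁₉ (w j) r (disc f))))
      root₁ : ∀ (j : Fin p) → P ∣ + toℕ j * (+ 2 * A f) - (r - B f) → P ∣ value f (+ toℕ j) 1ℤ
      root₁ j d = value-root (+ toℕ j) (∣-mult (w (+ toℕ j) + r) d
        (ring₂₀ (+ toℕ j) (A f) (B f) r))
      root₂ : ∀ (j : Fin p) → P ∣ + toℕ j * (+ 2 * A f) - (- r - B f) → P ∣ value f (+ toℕ j) 1ℤ
      root₂ j d = value-root (+ toℕ j) (∣-mult (w (+ toℕ j) - r) d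
        (ring₂₁ (+ toℕ j) (A f) (B f) r))
      j₁≢j₂ : _≢_ {A = Fin (suc p)} (suc j₁) (suc j₂)
      j₁≢j₂ e = ∤2* ¬r (∣-comb 1ℤ -1ℤ (subst (λ j → P ∣ + toℕ j * (+ 2 * A f) - (- r - B f)) (sym (Fin.suc-injective e)) (proj₂ s₂)) (proj₂ s₁)
        (ring₂₂ (+ toℕ j₁) (A f) (B f) r))
      only : ∀ K → Root f K → K ≡ suc j₁ ⊎ K ≡ suc j₂
      only zero dA = contradiction dA ¬dA
      only (suc j) d = choose (euclid (+ toℕ j * (+ 2 * A f) - (r - B f)) (+ toℕ j * (+ 2 * A f) - (- r - B f)) (∣-comb (+ 4 * A f) -1ℤ d dr factored))
        where
        factored : (+ toℕ j * (+ 2 * A f) - (r - B f)) * (+ toℕ j * (+ 2 * A f) - (- r - B f)) ≡ + 4 * A f * value f (+ toℕ j) 1ℤ + -1ℤ * (r * r - disc f)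
        factored = trans (ring₂₃ (+ toℕ j) (A f) (B f) r (disc f)) (cong (_+ -1ℤ * (r * r - disc f)) (sym (complete-square f (+ toℕ j))))
        choose : P ∣ + toℕ j * (+ 2 * A f) - (r - B f) ⊎ P ∣ + toℕ j * (+ 2 * A f) - (- r - B f) → _≡_ {A = Fin (suc p)} (suc j) (suc j₁) ⊎ _≡_ {A = Fin (suc p)} (suc j) (suc j₂)
        choose (inj₁ e) = inj₁ (cong suc (linear-unique (+ 2 * A f) (r - B f) (∤2* ¬dA) e (proj₂ s₁)))
        choose (inj₂ e) = inj₂ (cong suc (linear-unique (+ 2 * A f) (- r - B f) (∤2* ¬dA) e (proj₂ s₂)))
    cases (yes dA) = count-two (λ K → divides? _ (P • f ⊙ lineMat K)) zero (suc j₁) (λ ())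
        (overlattices-•⁻ f zero dA) (overlattices-•⁻ f (suc j₁) dv) (λ {K} δ → only K (overlattices-• f K δ))
      where
      ¬dB : ¬ P ∣ B f
      ¬dB d = ¬dd (∣-comb (B f) (- (+ 4 * C f)) d dA (ring₂₄ (A f) (B f) (C f)))
      s₁ = linear (B f) (- C f) ¬dB
      j₁ = proj₁ s₁
      dv : P ∣ value f (+ toℕ j₁) 1ℤ
      dv = ∣-comb (+ toℕ j₁ * + toℕ j₁) 1ℤ dA (proj₂ s₁)
        (ring₂₅ (A f) (B f) (C f) (+ toℕ j₁))
      only : ∀ K → Root f K → K ≡ zero ⊎ K ≡ suc j₁
      only zero _ = inj₁ refl
      only (suc j) d = inj₂ (cong suc (linear-unique (B f) (- C f) ¬dB (∣-comb 1ℤ (- (+ toℕ j * + toℕ j)) d dA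
        (ring₂₆ (A f) (B f) (C f) (+ toℕ j))) (proj₂ s₁)))

module Hecke (p : ℕ) (pp : Prime p) (odd : ¬ + p ∣ + 2) where
  open ModPrime p pp
  open PrimeLines p pp
  open Overlattices p pp odd

  private
    instance
      PP-nonZero : ℤ.NonZero (P * P)
      PP-nonZero = ℤ.≢-nonZero (positive⇒≢0 (*-positive P>0 P>0))

    disc-quotient : ∀ {D} f → disc (P • f) ≡ - (P * P * D) → disc f ≡ - D
    disc-quotient {D} f e = ℤ.*-cancelˡ-≡ (P * P) (disc f) (- D) (trans (sym (disc-• P f)) (trans e (ℤ.neg-distribʳ-* (P * P) D)))

    PP∣disc : ∀ {D} g → disc g ≡ - (P * P * D) → P * P ∣ disc g
    PP∣disc {D} g e = divides (- D) (trans e (solve 2 (λ P D → :- (P :* P :* D) := (:- D) :* (P :* P)) refl P D))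

    ∣-neg : ∀ {x} → P ∣ - x → P ∣ x
    ∣-neg {x} d = ∣-mult -1ℤ d (solve 1 (λ x → x := con -1ℤ :* :- x) refl x)

    nonzero-disc : ∀ {D} f → ¬ P ∣ D → disc f ≡ - D → ¬ P ∣ disc f
    nonzero-disc f ¬d e d = ¬d (∣-neg (subst (P ∣_) e d))

    Σoverlattices : ∀ {D D′} → D′ ≡ P * P * D → (X : Classes D) (Y : Classes D′) → suc p ℕ.* total X ≡ ∑[ j < size Y ] (weight Y j ℕ.* overlattices (rep Y j))
    Σoverlattices {D} eq X Y = Correspondence.correspondence X Y prime-lines P>0 (+<+ ℕ.z<s)
      (trans eq (solve 2 (λ P D → P :* P :* D := con 1ℤ :* con 1ℤ :* (P :* P) :* D) refl P D))

    ∑-split : ∀ {n} (w f g h : Fin n → ℕ) → (∀ i → f i ℕ.+ g i ≡ h i) → ∑[ i < n ] (w i ℕ.* f i) ℕ.+ ∑[ i < n ] (w i ℕ.* g i) ≡ ∑[ i < n ] (w i ℕ.* h i)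
    ∑-split w f g h e = trans (sym (∑-distrib-+ (λ i → w i ℕ.* f i) (λ i → w i ℕ.* g i))) (sum-cong-≗ λ i → trans (sym (ℕ.*-distribˡ-+ (w i) (f i) (g i))) (cong (w i ℕ.*_) (e i)))

    ∑-one : ∀ {n} (w : Fin n → ℕ) → ∑[ i < n ] (w i ℕ.* 1) ≡ ∑[ i < n ] w i
    ∑-one w = sum-cong-≗ λ i → ℕ.*-identityʳ (w i)

  -- A form of discriminant -p²D has one overlattice, and one more if it is divisible by p. Since
  -- `scaling` sums the divisible ones to `total X`, the correspondence reads (p + 1) X = X + Y.
  hecke-split : ∀ {D D′} r → ¬ P ∣ D → P ∣ r * r + D → D′ ≡ P * P * D → (X : Classes D) (Y : Classes D′) → total Y ≡ p ℕ.* total X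
  hecke-split {D} r ¬d dr refl X Y = ℕ.+-cancelˡ-≡ (total X) _ _ (begin
    total X ℕ.+ total Y                          ≡⟨ cong₂ ℕ._+_ (scaling P P>0 refl X Y) (sym (∑-one (weight Y))) ⟩
    ∑[ j < size Y ] (weight Y j ℕ.* indicator (divides? P (rep Y j))) ℕ.+ ∑[ j < size Y ] (weight Y j ℕ.* 1)
                                                 ≡⟨ ∑-split (weight Y) _ _ _ (λ j → sym (count (rep Y j) (disc≡ Y j) (divides? P (rep Y j)))) ⟩
    ∑[ j < size Y ] (weight Y j ℕ.* overlattices (rep Y j)) ≡⟨ sym (Σoverlattices refl X Y) ⟩
    suc p ℕ.* total X                            ∎)
    where
    open ≡-Reasoning
    count : ∀ g → disc g ≡ - (P * P * D) → (δ : Dec (Divides P g)) → overlattices g ≡ indicator δ ℕ.+ 1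
    count g e (no ¬δ) = overlattices-primitive g (PP∣disc g e) ¬δ
    count g e (yes (f , refl)) = overlattices-split f r (nonzero-disc f ¬d (disc-quotient f e))
      (subst (λ t → P ∣ r * r - t) (sym (disc-quotient f e)) (subst (P ∣_) (cong (λ t → r * r + t) (sym (ℤ.neg-involutive D))) dr))

  -- Here a form divisible by p has no overlattice and every other one has one, so adding the
  -- divisible forms to both sides yields X + (p + 1) X = Y.
  hecke-inert : ∀ {D D′} → ¬ P ∣ D → (∀ r → ¬ P ∣ r * r + D) → D′ ≡ P * P * D → (X : Classes D) (Y : Classes D′) → total Y ≡ suc (suc p) ℕ.* total X
  hecke-inert {D} ¬d nonsquare refl X Y = begin
    total Y                                      ≡⟨ sym (∑-one (weight Y)) ⟩
    ∑[ j < size Y ] (weight Y j ℕ.* 1)           ≡⟨ sym (∑-split (weight Y) _ _ _ (λ j → count (rep Y j) (disc≡ Y j) (divides? P (rep Y j)))) ⟩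
    ∑[ j < size Y ] (weight Y j ℕ.* indicator (divides? P (rep Y j))) ℕ.+ ∑[ j < size Y ] (weight Y j ℕ.* overlattices (rep Y j))
                                                 ≡⟨ cong₂ ℕ._+_ (sym (scaling P P>0 refl X Y)) (sym (Σoverlattices refl X Y)) ⟩
    total X ℕ.+ suc p ℕ.* total X                ∎
    where
    open ≡-Reasoning
    count : ∀ g → disc g ≡ - (P * P * D) → (δ : Dec (Divides P g)) → indicator δ ℕ.+ overlattices g ≡ 1
    count g e (no ¬δ) = overlattices-primitive g (PP∣disc g e) ¬δ
    count g e (yes (f , refl)) = cong suc (overlattices-inert f
      λ r d → nonsquare r (subst (P ∣_) (trans (cong (λ t → r * r - t) (disc-quotient f e)) (cong (λ t → r * r + t) (ℤ.neg-involutive D))) d))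

  -- Every form has one overlattice, except that those divisible by p² have all p + 1. The excess p
  -- is summed by `scaling` with `s = P * P`, which leads back to discriminant -D₀.
  hecke-ramified : ∀ {D₀ D D′} → D ≡ P * P * D₀ → D′ ≡ P * P * D → (Z : Classes D₀) (X : Classes D) (Y : Classes D′) →
    suc p ℕ.* total X ≡ p ℕ.* total Z ℕ.+ total Y
  hecke-ramified {D₀} {D} refl refl Z X Y = begin
    suc p ℕ.* total X                            ≡⟨ Σoverlattices refl X Y ⟩
    ∑[ j < size Y ] (weight Y j ℕ.* overlattices (rep Y j))
                                                 ≡⟨ sym (∑-split (weight Y) _ _ _ (λ j → sym (count (rep Y j) (disc≡ Y j) (divides? (P * P) (rep Y j))))) ⟩
    ∑[ j < size Y ] (weight Y j ℕ.* (p ℕ.* indicator (divides? (P * P) (rep Y j)))) ℕ.+ ∑[ j < size Y ] (weight Y j ℕ.* 1)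
                                                 ≡⟨ cong₂ ℕ._+_ (trans (sum-cong-≗ λ j → swap₂ (weight Y j) p (indicator (divides? (P * P) (rep Y j))))
                                                      (sym (*-distribˡ-sum p λ j → weight Y j ℕ.* indicator (divides? (P * P) (rep Y j))))) (∑-one (weight Y)) ⟩
    p ℕ.* (∑[ j < size Y ] (weight Y j ℕ.* indicator (divides? (P * P) (rep Y j)))) ℕ.+ total Y
                                                 ≡⟨ cong (λ t → p ℕ.* t ℕ.+ total Y) (sym (scaling (P * P) (*-positive P>0 P>0)
                                                      (solve 2 (λ P D → P :* P :* (P :* P :* D) := P :* P :* (P :* P) :* D) refl P D₀) Z Y)) ⟩
    p ℕ.* total Z ℕ.+ total Y                    ∎
    where
    open ≡-Reasoning
    swap₂ : ∀ x y z → x ℕ.* (y ℕ.* z) ≡ y ℕ.* (x ℕ.* z)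
    swap₂ = ℕ-solve-∀
    count : ∀ g → disc g ≡ - (P * P * D) → (δ : Dec (Divides (P * P) g)) → overlattices g ≡ p ℕ.* indicator δ ℕ.+ 1
    count g e (yes (f , refl)) = trans (cong overlattices (sym (•-assoc P P f)))
      (trans (overlattices-divisible (P • f) (f , refl)) (sym (trans (cong (ℕ._+ 1) (ℕ.*-identityʳ p)) (ℕ.+-comm p 1))))
    count g e (no ¬δ) = trans (one (divides? P g)) (cong (ℕ._+ 1) (sym (ℕ.*-zeroʳ p)))
      where
      one : Dec (Divides P g) → overlattices g ≡ 1
      one (no ¬δ′) = overlattices-primitive g (PP∣disc g e) ¬δ′
      one (yes (f , refl)) = overlattices-ramified f (subst (P ∣_) (sym (disc-quotient f e))
          (divides (- (P * D₀)) (solve 2 (λ P D → :- (P :* P :* D) := (:- (P :* D)) :* P) refl P D₀)))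
        λ (h , eq) → ¬δ (h , trans (sym (•-assoc P P h)) (cong (P •_) eq))

-- Reduction and automorphisms

record Reduced (f : Form) : Set where
  constructor reduced
  field
    -A≤B : - A f ≤ B f
    B≤A  : B f ≤ A f
    A≤C  : A f ≤ C f

posDef⇒A>0 : ∀ f → PositiveDefinite f → 0ℤ < A f
posDef⇒A>0 (form a b c) pd = subst (0ℤ <_) (solve 3 (λ a b c → a :* con 1ℤ :* con 1ℤ :+ b :* con 1ℤ :* con 0ℤ :+ c :* con 0ℤ :* con 0ℤ := a) refl a b c) (pd 1ℤ 0ℤ λ { (() , _) })

opaque
  unfolding det _⊙_

  shift : ∀ f t → f ≅ form (A f) (B f + + 2 * A f * t) (A f * t * t + B f * t + C f)
  shift (form a b c) t = iso (mat 1ℤ t 0ℤ 1ℤ) (solve 1 (λ t → con 1ℤ :* con 1ℤ :- t :* con 0ℤ := con 1ℤ) refl t) (form-≡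
    (solve 3 (λ a b c → a :* con 1ℤ :* con 1ℤ :+ b :* con 1ℤ :* con 0ℤ :+ c :* con 0ℤ :* con 0ℤ := a) refl a b c)
    (solve 4 (λ a b c t → con (+ 2) :* a :* con 1ℤ :* t :+ b :* (con 1ℤ :* con 1ℤ :+ t :* con 0ℤ) :+ con (+ 2) :* c :* con 0ℤ :* con 1ℤ := b :+ con (+ 2) :* a :* t) refl a b c t)
    (solve 4 (λ a b c t → a :* t :* t :+ b :* t :* con 1ℤ :+ c :* con 1ℤ :* con 1ℤ := a :* t :* t :+ b :* t :+ c) refl a b c t))

  flip-form : ∀ f → f ≅ form (C f) (- B f) (A f)
  flip-form (form a b c) = iso (mat 0ℤ -1ℤ 1ℤ 0ℤ) refl (form-≡
    (solve 3 (λ a b c → a :* con 0ℤ :* con 0ℤ :+ b :* con 0ℤ :* con 1ℤ :+ c :* con 1ℤ :* con 1ℤ := c) refl a b c)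
    (solve 3 (λ a b c → con (+ 2) :* a :* con 0ℤ :* con -1ℤ :+ b :* (con 0ℤ :* con 0ℤ :+ con -1ℤ :* con 1ℤ) :+ con (+ 2) :* c :* con 1ℤ :* con 0ℤ := :- b) refl a b c)
    (solve 3 (λ a b c → a :* con -1ℤ :* con -1ℤ :+ b :* con -1ℤ :* con 0ℤ :+ c :* con 0ℤ :* con 0ℤ := a) refl a b c))

-- Division of b + a by 2 a leaves a remainder r between 0 and 2 a, and b - 2 a q = r - a. This is
-- why `center` divides the shifted coefficient and translates by the negated quotient.
center-remainder : ∀ a b q r m → m ≡ a + a → b + a ≡ r + q * m → 0ℤ ≤ r → r ≤ m → - a ≤ b + + 2 * a * - q × b + + 2 * a * - q ≤ a
center-remainder a b q r _ refl e 0≤r r≤m =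
  subst (- a ≤_) (sym eq) (subst (_≤ r - a) (ℤ.+-identityˡ (- a)) (ℤ.+-monoˡ-≤ (- a) 0≤r)) ,
  subst (_≤ a) (sym eq) (subst (r - a ≤_) (solve 1 (λ a → a :+ a :- a := a) refl a) (ℤ.+-monoˡ-≤ (- a) r≤m))
  where
  eq : b + + 2 * a * - q ≡ r - a
  eq = trans (solve 3 (λ a b q → b :+ con (+ 2) :* a :* :- q := b :+ a :- q :* (a :+ a) :- a) refl a b q)
     (trans (cong (λ t → t - q * (a + a) - a) e) (solve 3 (λ r q a → r :+ q :* (a :+ a) :- q :* (a :+ a) :- a := r :- a) refl r q a))

center : ∀ a b → 0ℤ < a → Σ ℤ λ t → - a ≤ b + + 2 * a * t × b + + 2 * a * t ≤ a
center (+ 0) b (+<+ ())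
center a@(+ suc n) b _ = - ((b + a) /ℕ m) , center-remainder a b ((b + a) /ℕ m) (+ ((b + a) %ℕ m)) (+ m) refl
    (a≡a%ℕn+[a/ℕn]*n (b + a) m) (+≤+ ℕ.z≤n) (ℤ.<⇒≤ (+<+ (n%ℕd<d (b + a) m)))
  where
  m = suc n ℕ.+ suc n

Reduction : Form → Set
Reduction f = Σ Form λ g → f ≅ g × Reduced g

≅-reduction : ∀ {f g} → f ≅ g → Reduction g → Reduction f
≅-reduction φ (h , ψ , red) = h , ≅-trans φ ψ , red

reduce-step : ∀ {n f} → (∀ h → A h ≤ + n → PositiveDefinite h → Reduction h) → ∀ a b c → f ≅ form a b c →
  - a ≤ b → b ≤ a → a ≤ + suc n → PositiveDefinite f → Reduction f
reduce-step rec a b c φ lo hi a≤n pd with a ℤ.≤? c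
... | yes a≤c = form a b c , φ , reduced lo hi a≤c
... | no a≰c = ≅-reduction (≅-trans φ (flip-form (form a b c)))
   (rec (form c (- b) a) (ℤ.i<j⇒i≤pred[j] (ℤ.<-≤-trans (ℤ.≰⇒> a≰c) a≤n)) (posDef-≅ (≅-trans φ (flip-form (form a b c))) pd))

-- Gauss reduction, by induction on a bound for the leading coefficient: after centring B, either A
-- ≤ C or `flip-form` puts the smaller C in front.
reduce-bounded : ∀ n f → A f ≤ + n → PositiveDefinite f → Reduction f
reduce-bounded zero f A≤0 pd = contradiction (posDef⇒A>0 f pd) (ℤ.≤⇒≯ A≤0)
reduce-bounded (suc n) f A≤n pd = translate (center (A f) (B f) (posDef⇒A>0 f pd))
  where
  translate : (Σ ℤ λ t → - A f ≤ B f + + 2 * A f * t × B f + + 2 * A f * t ≤ A f) → Reduction f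
  translate (t , lo , hi) = reduce-step (reduce-bounded n) (A f) (B f + + 2 * A f * t) (A f * t * t + B f * t + C f) (shift f t) lo hi A≤n pd

reduce-form : ∀ f → PositiveDefinite f → Reduction f
reduce-form f pd = reduce-bounded ℤ.∣ A f ∣ f (ℤ.≤-reflexive (sym (ℤ.0≤i⇒+∣i∣≡i (ℤ.<⇒≤ (posDef⇒A>0 f pd))))) pd

module _ {f : Form} {M : Mat} (aut : IsAutomorphism f M) where
  private
    a = A f
    b = B f
    c = C f
    α = m₁₁ M
    β = m₁₂ M
    γ = m₂₁ M
    δ = m₂₂ M

  opaque
    unfolding det _⊙_

    aut-value : a * α * α + b * α * γ + c * γ * γ ≡ a
    aut-value = cong A (proj₂ aut)

    -- With Q the Gram matrix, invariance and determinant 1 give Q M = (M⁻¹)ᵀ Q, which is linear in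
    -- the entries. This relation and `aut-β` are its first row, up to the factor 2 cancelled here;
    -- they determine the second column of `M` from the first.
    aut-δ : a * δ ≡ a * α + b * γ
    aut-δ = ℤ.*-cancelˡ-≡ (+ 2) (a * δ) (a * α + b * γ) (begin
      + 2 * (a * δ)                                           ≡⟨ solve 4 (λ a b γ δ → con (+ 2) :* (a :* δ) := con (+ 2) :* δ :* a :- γ :* b :+ γ :* b) refl a b γ δ ⟩
      + 2 * δ * a - γ * b + γ * b                             ≡⟨ cong₂ (λ u v → + 2 * δ * u - γ * v + γ * b) (sym (cong A (proj₂ aut))) (sym (cong B (proj₂ aut))) ⟩
      + 2 * δ * (a * α * α + b * α * γ + c * γ * γ) - γ * (+ 2 * a * α * β + b * (α * δ + β * γ) + + 2 * c * γ * δ) + γ * b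
        ≡⟨ solve 7 (λ a b c α β γ δ → con (+ 2) :* δ :* (a :* α :* α :+ b :* α :* γ :+ c :* γ :* γ) :- γ :* (con (+ 2) :* a :* α :* β :+ b :* (α :* δ :+ β :* γ) :+ con (+ 2) :* c :* γ :* δ) :+ γ :* b
             := (con (+ 2) :* a :* α :+ b :* γ) :* (α :* δ :- β :* γ) :+ γ :* b) refl a b c α β γ δ ⟩
      (+ 2 * a * α + b * γ) * (α * δ - β * γ) + γ * b         ≡⟨ cong (λ t → (+ 2 * a * α + b * γ) * t + γ * b) (proj₁ aut) ⟩
      (+ 2 * a * α + b * γ) * 1ℤ + γ * b                      ≡⟨ solve 4 (λ a b α γ → (con (+ 2) :* a :* α :+ b :* γ) :* con 1ℤ :+ γ :* b := con (+ 2) :* (a :* α :+ b :* γ)) refl a b α γ ⟩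
      + 2 * (a * α + b * γ)                                   ∎)
      where open ≡-Reasoning

    aut-β : a * β ≡ - (c * γ)
    aut-β = ℤ.*-cancelˡ-≡ (+ 2) (a * β) (- (c * γ)) (begin
      + 2 * (a * β)                                           ≡⟨ solve 4 (λ a b α β → con (+ 2) :* (a :* β) := con (+ 2) :* β :* a :- α :* b :+ α :* b) refl a b α β ⟩
      + 2 * β * a - α * b + α * b                             ≡⟨ cong₂ (λ u v → + 2 * β * u - α * v + α * b) (sym (cong A (proj₂ aut))) (sym (cong B (proj₂ aut))) ⟩
      + 2 * β * (a * α * α + b * α * γ + c * γ * γ) - α * (+ 2 * a * α * β + b * (α * δ + β * γ) + + 2 * c * γ * δ) + α * b
        ≡⟨ solve 7 (λ a b c α β γ δ → con (+ 2) :* β :* (a :* α :* α :+ b :* α :* γ :+ c :* γ :* γ) :- α :* (con (+ 2) :* a :* α :* β :+ b :* (α :* δ :+ β :* γ) :+ con (+ 2) :* c :* γ :* δ) :+ α :* b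
             := :- ((b :* α :+ con (+ 2) :* c :* γ) :* (α :* δ :- β :* γ)) :+ α :* b) refl a b c α β γ δ ⟩
      - ((b * α + + 2 * c * γ) * (α * δ - β * γ)) + α * b     ≡⟨ cong (λ t → - ((b * α + + 2 * c * γ) * t) + α * b) (proj₁ aut) ⟩
      - ((b * α + + 2 * c * γ) * 1ℤ) + α * b                  ≡⟨ solve 4 (λ b c α γ → :- ((b :* α :+ con (+ 2) :* c :* γ) :* con 1ℤ) :+ α :* b := con (+ 2) :* :- (c :* γ)) refl b c α γ ⟩
      + 2 * - (c * γ)                                         ∎)
      where open ≡-Reasoning

private
  -- If m ≥ 2, the left side already reaches m n + 2: compare n² with m n when m ≤ n, and m² with m
  -- (n + 1) when n < m.
  bound₁ : ∀ m n → m ℕ.* m ℕ.+ n ℕ.* n ℕ.≤ 1 ℕ.+ m ℕ.* n → m ℕ.≤ 1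
  bound₁ m n le with m ℕ.≤? 1 | ℕ.≤-total m n
  ... | yes m≤1 | _ = m≤1
  ... | no m≰1 | inj₁ m≤n = contradiction (ℕ.≤-trans (ℕ.+-mono-≤ (ℕ.≤-trans (ℕ.≰⇒> m≰1) (ℕ.m≤m*n m m {{ℕ.>-nonZero (ℕ.<-trans ℕ.z<s (ℕ.≰⇒> m≰1))}})) (ℕ.*-monoˡ-≤ n m≤n)) le) (ℕ.<⇒≱ (ℕ.n<1+n _))
  ... | no m≰1 | inj₂ n≤m with ℕ.m≤n⇒m<n∨m≡n n≤m
  ... | inj₂ refl = contradiction (ℕ.≤-trans (ℕ.+-monoˡ-≤ (n ℕ.* n) (ℕ.≤-trans (ℕ.≰⇒> m≰1) (ℕ.m≤m*n m m {{ℕ.>-nonZero (ℕ.<-trans ℕ.z<s (ℕ.≰⇒> m≰1))}}))) le) (ℕ.<⇒≱ (ℕ.n<1+n _))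
  ... | inj₁ n<m = contradiction (ℕ.≤-trans (ℕ.≤-trans (ℕ.+-monoˡ-≤ (m ℕ.* n) (ℕ.≰⇒> m≰1)) (subst (ℕ._≤ m ℕ.* m) (ℕ.*-suc m n) (ℕ.*-monoʳ-≤ m n<m)))
                                   (ℕ.≤-trans (ℕ.m≤m+n (m ℕ.* m) (n ℕ.* n)) le)) (ℕ.<⇒≱ (ℕ.n<1+n _))

quadratic-bound : ∀ m n → m ℕ.* m ℕ.+ n ℕ.* n ℕ.≤ 1 ℕ.+ m ℕ.* n → m ℕ.≤ 1 × n ℕ.≤ 1
quadratic-bound m n le = bound₁ m n le , bound₁ n m (subst₂ ℕ._≤_ (ℕ.+-comm (m ℕ.* m) _) (cong suc (ℕ.*-comm m n)) le)

Small : ℤ → Set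
Small x = x ≡ 0ℤ ⊎ x ≡ 1ℤ ⊎ x ≡ -1ℤ

small : ∀ x → ℤ.∣ x ∣ ℕ.≤ 1 → Small x
small (+ 0) _ = inj₁ refl
small (+ 1) _ = inj₂ (inj₁ refl)
small (+ suc (suc _)) (ℕ.s≤s ())
small -[1+ 0 ] _ = inj₂ (inj₂ refl)
small -[1+ suc _ ] (ℕ.s≤s ())

square-abs : ∀ x → x * x ≡ + (ℤ.∣ x ∣ ℕ.* ℤ.∣ x ∣)
square-abs (+ n) = sym (ℤ.pos-* n n)
square-abs -[1+ n ] = refl

≤-abs : ∀ x → x ≤ + ℤ.∣ x ∣
≤-abs (+ n) = ℤ.≤-refl
≤-abs -[1+ n ] = -≤+

abs-≤ : ∀ {x y} → - y ≤ x → x ≤ y → + ℤ.∣ x ∣ ≤ y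
abs-≤ {+ n} _ le = le
abs-≤ { -[1+ n ]} {y} ge _ = subst (_ ≤_) (ℤ.neg-involutive y) (ℤ.neg-mono-≤ ge)

-- From |B| ≤ A ≤ C one gets A (x² + y²) ≤ A x² + C y² = A - B x y ≤ A (1 + |x y|), and
-- `quadratic-bound` applies after division by A. It confines the first column of an automorphism to
-- nine candidates.
reduced-bounds : ∀ {f} → 0ℤ < A f → Reduced f → ∀ x y → A f * x * x + B f * x * y + C f * y * y ≡ A f → Small x × Small y
reduced-bounds {form a b c} a>0 (reduced -a≤b b≤a a≤c) x y eq =
  small x (proj₁ mn) , small y (proj₂ mn)
  where
  m = ℤ.∣ x ∣
  n = ℤ.∣ y ∣
  instance
    a⁺ : ℤ.Positive a
    a⁺ = ℤ.positive a>0
  cross : - (b * x * y) ≤ a * + (m ℕ.* n)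
  cross = ℤ.≤-trans (≤-abs (- (b * x * y))) (ℤ.≤-trans (ℤ.≤-reflexive eq′) (ℤ.*-monoʳ-≤-nonNeg (+ (m ℕ.* n)) (abs-≤ -a≤b b≤a)))
    where
    eq′ : + ℤ.∣ - (b * x * y) ∣ ≡ + ℤ.∣ b ∣ * + (m ℕ.* n)
    eq′ = trans (cong +_ (trans (ℤ.∣-i∣≡∣i∣ (b * x * y)) (trans (ℤ.abs-* (b * x) y) (trans (cong (ℕ._* n) (ℤ.abs-* b x)) (ℕ.*-assoc ℤ.∣ b ∣ m n))))) (ℤ.pos-* ℤ.∣ b ∣ (m ℕ.* n))
  bound : a * + (m ℕ.* m ℕ.+ n ℕ.* n) ≤ a * + (1 ℕ.+ m ℕ.* n)
  bound = begin
    a * + (m ℕ.* m ℕ.+ n ℕ.* n)              ≡⟨ cong (a *_) (cong₂ _+_ (sym (square-abs x)) (sym (square-abs y))) ⟩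
    a * (x * x + y * y)                      ≡⟨ ℤ.*-distribˡ-+ a (x * x) (y * y) ⟩
    a * (x * x) + a * (y * y)                ≤⟨ ℤ.+-monoʳ-≤ (a * (x * x)) (subst (λ t → a * t ≤ c * t) (sym (square-abs y)) (ℤ.*-monoʳ-≤-nonNeg (+ (n ℕ.* n)) a≤c)) ⟩
    a * (x * x) + c * (y * y)                ≡⟨ solve 5 (λ a b c x y → a :* (x :* x) :+ c :* (y :* y) := a :* x :* x :+ b :* x :* y :+ c :* y :* y :- b :* x :* y) refl a b c x y ⟩
    a * x * x + b * x * y + c * y * y - b * x * y ≡⟨ cong (_- b * x * y) eq ⟩
    a - b * x * y                            ≤⟨ ℤ.+-monoʳ-≤ a cross ⟩
    a + a * + (m ℕ.* n)                      ≡⟨ solve 2 (λ a t → a :+ a :* t := a :* (con 1ℤ :+ t)) refl a (+ (m ℕ.* n)) ⟩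
    a * + (1 ℕ.+ m ℕ.* n)                    ∎
    where open ℤ.≤-Reasoning
  mn : m ℕ.≤ 1 × n ℕ.≤ 1
  mn = quadratic-bound m n (ℤ.drop‿+≤+ (ℤ.*-cancelˡ-≤-pos _ _ a bound))

Size : ∀ {f} → Automorphisms f → ℕ
Size = length ∘ elements

conjugate : ∀ {f g} → f ≅ g → (auts : Automorphisms g) → Σ (Automorphisms f) λ auts′ → Size auts′ ≡ Size auts
conjugate {f} {g} (iso γ dγ eγ) auts = record
  { elements = List.map conj (elements auts)
  ; unique = unique-map conj (λ _ _ → conj-injective) (unique auts)
  ; sound = snd
  ; complete = cpl
  } , List.length-map conj (elements auts)
  where
  conj : Mat → Mat
  conj a = γ ⊗ (a ⊗ adj γ)
  dγ⁻¹ : det (adj γ) ≡ 1ℤ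
  dγ⁻¹ = trans (det-adj γ) dγ
  eγ⁻¹ : g ⊙ adj γ ≡ f
  eγ⁻¹ = ⊙-unimodular-inverse γ dγ eγ
  cancelʳ : ∀ {M N} → M ⊗ adj γ ≡ N ⊗ adj γ → M ≡ N
  cancelʳ {M} {N} e = trans (sym (back M)) (trans (cong (_⊗ γ) e) (back N))
    where
    back : ∀ M → (M ⊗ adj γ) ⊗ γ ≡ M
    back M = trans (⊗-assoc M (adj γ) γ) (trans (cong (M ⊗_) (trans (⊗-adjˡ γ) (cong scalar dγ))) (⊗-identityʳ M))
  conj-injective : ∀ {M N} → conj M ≡ conj N → M ≡ N
  conj-injective e = cancelʳ (cancel-unimodular γ dγ e)
  snd : ∀ {M} → M ∈ List.map conj (elements auts) → IsAutomorphism f M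
  snd M∈ with ∈-map⁻ conj M∈
  ... | a , a∈ , refl with sound auts a∈
  ... | da , ea = det-⊗-unimodular γ (a ⊗ adj γ) dγ (det-⊗-unimodular a (adj γ) da dγ⁻¹) ,
                  ⊙-compose γ (a ⊗ adj γ) eγ (⊙-compose a (adj γ) ea eγ⁻¹)
  cpl : ∀ {M} → IsAutomorphism f M → M ∈ List.map conj (elements auts)
  cpl {M} (dM , eM) = subst (_∈ List.map conj (elements auts)) restore (∈-map⁺ conj (complete auts
      (det-⊗-unimodular (adj γ) (M ⊗ γ) dγ⁻¹ (det-⊗-unimodular M γ dM dγ) , ⊙-compose (adj γ) (M ⊗ γ) eγ⁻¹ (⊙-compose M γ eM eγ))))
    where
    γγ⁻¹ : γ ⊗ adj γ ≡ 𝟙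
    γγ⁻¹ = trans (⊗-adjʳ γ) (cong scalar dγ)
    restore : conj (adj γ ⊗ (M ⊗ γ)) ≡ M
    restore = begin
      γ ⊗ ((adj γ ⊗ (M ⊗ γ)) ⊗ adj γ)    ≡⟨ cong (γ ⊗_) (⊗-assoc (adj γ) (M ⊗ γ) (adj γ)) ⟩
      γ ⊗ (adj γ ⊗ ((M ⊗ γ) ⊗ adj γ))    ≡⟨ sym (⊗-assoc γ (adj γ) _) ⟩
      (γ ⊗ adj γ) ⊗ ((M ⊗ γ) ⊗ adj γ)    ≡⟨ cong₂ _⊗_ γγ⁻¹ (⊗-assoc M γ (adj γ)) ⟩
      𝟙 ⊗ (M ⊗ (γ ⊗ adj γ))              ≡⟨ ⊗-identityˡ _ ⟩
      M ⊗ (γ ⊗ adj γ)                    ≡⟨ cong (M ⊗_) γγ⁻¹ ⟩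
      M ⊗ 𝟙                              ≡⟨ ⊗-identityʳ M ⟩
      M                                  ∎
      where open ≡-Reasoning

-- The matrix of multiplication by α + γθ in ℤ[θ], where θ² = εθ - 1.
multiplication : ℤ → ℤ × ℤ → Mat
multiplication ε (α , γ) = mat α (- γ) γ (α + ε * γ)

multiplication-injective : ∀ ε {x y} → multiplication ε x ≡ multiplication ε y → x ≡ y
multiplication-injective ε e = cong₂ _,_ (cong m₁₁ e) (cong m₂₁ e)

-- Norm 1 for α + γθ. The ring is ℤ[i] for ε = 0 and the Eisenstein integers for ε = 1, and
-- `form k (ε * k) k` is k times the norm form.
Unit : ℤ → ℤ × ℤ → Set
Unit ε (α , γ) = α * α + ε * α * γ + γ * γ ≡ 1ℤ

opaque
  unfolding det _⊙_

  -- The norm is multiplicative, so multiplication by an element of norm 1 preserves every multiple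
  -- of the norm form.
  multiplication-aut : ∀ ε k x → Unit ε x → IsAutomorphism (form k (ε * k) k) (multiplication ε x)
  multiplication-aut ε k (α , γ) u =
    trans (solve 3 (λ ε α γ → α :* (α :+ ε :* γ) :- (:- γ) :* γ := α :* α :+ ε :* α :* γ :+ γ :* γ) refl ε α γ) u ,
    form-≡
      (scale k (solve 4 (λ ε k α γ → k :* α :* α :+ ε :* k :* α :* γ :+ k :* γ :* γ := k :* (α :* α :+ ε :* α :* γ :+ γ :* γ)) refl ε k α γ))
      (scale (ε * k) (solve 4 (λ ε k α γ → con (+ 2) :* k :* α :* :- γ :+ ε :* k :* (α :* (α :+ ε :* γ) :+ :- γ :* γ) :+ con (+ 2) :* k :* γ :* (α :+ ε :* γ)
          := ε :* k :* (α :* α :+ ε :* α :* γ :+ γ :* γ)) refl ε k α γ))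
      (scale k (solve 4 (λ ε k α γ → k :* :- γ :* :- γ :+ ε :* k :* :- γ :* (α :+ ε :* γ) :+ k :* (α :+ ε :* γ) :* (α :+ ε :* γ) := k :* (α :* α :+ ε :* α :* γ :+ γ :* γ)) refl ε k α γ))
    where
    scale : ∀ k {x} → x ≡ k * (α * α + ε * α * γ + γ * γ) → x ≡ k
    scale k e = trans e (trans (cong (k *_) u) (ℤ.*-identityʳ k))

aut-multiplication : ∀ ε k M → 0ℤ < k → Reduced (form k (ε * k) k) → IsAutomorphism (form k (ε * k) k) M →
  Σ (ℤ × ℤ) λ x → M ≡ multiplication ε x × Unit ε x × Small (proj₁ x) × Small (proj₂ x)
aut-multiplication ε k M k>0 red aut = (α , γ) , mat-≡ refl β≡ refl δ≡ , unit , reduced-bounds k>0 red α γ (aut-value aut)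
  where
  α = m₁₁ M
  γ = m₂₁ M
  instance
    k≢0 : ℤ.NonZero k
    k≢0 = ℤ.≢-nonZero (positive⇒≢0 k>0)
  β≡ : m₁₂ M ≡ - γ
  β≡ = ℤ.*-cancelˡ-≡ k (m₁₂ M) (- γ) (trans (aut-β aut) (ℤ.neg-distribʳ-* k γ))
  δ≡ : m₂₂ M ≡ α + ε * γ
  δ≡ = ℤ.*-cancelˡ-≡ k (m₂₂ M) (α + ε * γ) (trans (aut-δ aut) (solve 4 (λ ε k α γ → k :* α :+ ε :* k :* γ := k :* (α :+ ε :* γ)) refl ε k α γ))
  unit : Unit ε (α , γ)
  unit = ℤ.*-cancelˡ-≡ k _ 1ℤ (trans (solve 4 (λ ε k α γ → k :* (α :* α :+ ε :* α :* γ :+ γ :* γ) := k :* α :* α :+ ε :* k :* α :* γ :+ k :* γ :* γ) refl ε k α γ)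
    (trans (aut-value aut) (sym (ℤ.*-identityʳ k))))

multiplication-auts : ∀ ε k (units : List (ℤ × ℤ)) → 0ℤ < k → Reduced (form k (ε * k) k) → Unique units → All (Unit ε) units →
  (∀ {α γ} → Small α → Small γ → Unit ε (α , γ) → (α , γ) ∈ units) →
  Σ (Automorphisms (form k (ε * k) k)) λ auts → Size auts ≡ length units
multiplication-auts ε k units k>0 red uniq units-ok all = record
  { elements = List.map (multiplication ε) units
  ; unique = unique-map (multiplication ε) (λ _ _ → multiplication-injective ε) uniq
  ; sound = snd
  ; complete = cpl
  } , List.length-map (multiplication ε) units
  where
  form′ : Form
  form′ = form k (ε * k) k
  snd : ∀ {M} → M ∈ List.map (multiplication ε) units → IsAutomorphism form′ M
  snd M∈ = let (x , x∈ , e) = ∈-map⁻ (multiplication ε) M∈ in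
    subst (IsAutomorphism form′) (sym e) (multiplication-aut ε k x (All.lookup units-ok x∈))
  cpl : ∀ {M} → IsAutomorphism form′ M → M ∈ List.map (multiplication ε) units
  cpl {M} aut = let (x , e , u , sα , sγ) = aut-multiplication ε k M k>0 red aut in
    subst (_∈ List.map (multiplication ε) units) (sym e) (∈-map⁺ (multiplication ε) (all {proj₁ x} {proj₂ x} sα sγ u))

units-i : List (ℤ × ℤ)
units-i = (1ℤ , 0ℤ) ∷ (-1ℤ , 0ℤ) ∷ (0ℤ , 1ℤ) ∷ (0ℤ , -1ℤ) ∷ []

units-ω : List (ℤ × ℤ)
units-ω = (1ℤ , 0ℤ) ∷ (-1ℤ , 0ℤ) ∷ (0ℤ , 1ℤ) ∷ (0ℤ , -1ℤ) ∷ (1ℤ , -1ℤ) ∷ (-1ℤ , 1ℤ) ∷ []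

square-auts : ∀ k → 0ℤ < k → Σ (Automorphisms (form k 0ℤ k)) λ auts → Size auts ≡ 4
square-auts k k>0 = subst (λ b → Σ (Automorphisms (form k b k)) λ auts → Size auts ≡ 4) (ℤ.*-zeroˡ k)
  (multiplication-auts 0ℤ k units-i k>0 red uniq (refl ∷ refl ∷ refl ∷ refl ∷ []) all)
  where
  red : Reduced (form k (0ℤ * k) k)
  red = subst (λ b → Reduced (form k b k)) (sym (ℤ.*-zeroˡ k)) (reduced (ℤ.neg-mono-≤ (ℤ.<⇒≤ k>0)) (ℤ.<⇒≤ k>0) ℤ.≤-refl)
  uniq : Unique units-i
  uniq = ((λ ()) ∷ (λ ()) ∷ (λ ()) ∷ []) ∷ ((λ ()) ∷ (λ ()) ∷ []) ∷ ((λ ()) ∷ []) ∷ [] ∷ []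
  all : ∀ {α γ} → Small α → Small γ → Unit 0ℤ (α , γ) → (α , γ) ∈ units-i
  all (inj₂ (inj₁ refl)) (inj₁ refl) _ = here refl
  all (inj₂ (inj₂ refl)) (inj₁ refl) _ = there (here refl)
  all (inj₁ refl) (inj₂ (inj₁ refl)) _ = there (there (here refl))
  all (inj₁ refl) (inj₂ (inj₂ refl)) _ = there (there (there (here refl)))
  all (inj₁ refl) (inj₁ refl) ()
  all (inj₂ (inj₁ refl)) (inj₂ (inj₁ refl)) ()
  all (inj₂ (inj₁ refl)) (inj₂ (inj₂ refl)) ()
  all (inj₂ (inj₂ refl)) (inj₂ (inj₁ refl)) ()
  all (inj₂ (inj₂ refl)) (inj₂ (inj₂ refl)) ()

hexagonal-auts : ∀ k → 0ℤ < k → Σ (Automorphisms (form k k k)) λ auts → Size auts ≡ 6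
hexagonal-auts k k>0 = subst (λ b → Σ (Automorphisms (form k b k)) λ auts → Size auts ≡ 6) (ℤ.*-identityˡ k)
  (multiplication-auts 1ℤ k units-ω k>0 red uniq (refl ∷ refl ∷ refl ∷ refl ∷ refl ∷ refl ∷ []) all)
  where
  red : Reduced (form k (1ℤ * k) k)
  red = subst (λ b → Reduced (form k b k)) (sym (ℤ.*-identityˡ k)) (reduced (ℤ.≤-trans (ℤ.neg-mono-≤ (ℤ.<⇒≤ k>0)) (ℤ.<⇒≤ k>0)) ℤ.≤-refl ℤ.≤-refl)
  uniq : Unique units-ω
  uniq = ((λ ()) ∷ (λ ()) ∷ (λ ()) ∷ (λ ()) ∷ (λ ()) ∷ []) ∷ ((λ ()) ∷ (λ ()) ∷ (λ ()) ∷ (λ ()) ∷ []) ∷ ((λ ()) ∷ (λ ()) ∷ (λ ()) ∷ []) ∷ ((λ ()) ∷ (λ ()) ∷ []) ∷ ((λ ()) ∷ []) ∷ [] ∷ []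
  all : ∀ {α γ} → Small α → Small γ → Unit 1ℤ (α , γ) → (α , γ) ∈ units-ω
  all (inj₂ (inj₁ refl)) (inj₁ refl) _ = here refl
  all (inj₂ (inj₂ refl)) (inj₁ refl) _ = there (here refl)
  all (inj₁ refl) (inj₂ (inj₁ refl)) _ = there (there (here refl))
  all (inj₁ refl) (inj₂ (inj₂ refl)) _ = there (there (there (here refl)))
  all (inj₂ (inj₁ refl)) (inj₂ (inj₂ refl)) _ = there (there (there (there (here refl))))
  all (inj₂ (inj₂ refl)) (inj₂ (inj₁ refl)) _ = there (there (there (there (there (here refl)))))
  all (inj₁ refl) (inj₁ refl) ()
  all (inj₂ (inj₁ refl)) (inj₂ (inj₁ refl)) ()
  all (inj₂ (inj₂ refl)) (inj₂ (inj₂ refl)) ()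

Special : Form → Set
Special f = C f ≡ A f × (B f ≡ 0ℤ ⊎ B f ≡ A f ⊎ B f ≡ - A f)

-- The first column has entries 0, 1 or -1. For γ = 0 the second column is forced and `M` is ± the
-- identity; for α = 0 one gets C = A with A dividing B; two nonzero entries give C = ± B.
generic-aut : ∀ {f} M → 0ℤ < A f → Reduced f → IsAutomorphism f M → (M ≡ 𝟙 ⊎ M ≡ scalar -1ℤ) ⊎ Special f
generic-aut {f} M@(mat α β γ δ) a>0 red@(reduced -a≤b b≤a a≤c) aut = cases (reduced-bounds {f} a>0 red α γ (aut-value {f} {M} aut))
  where
  a = A f
  b = B f
  c = C f
  instance
    a≢0 : ℤ.NonZero a
    a≢0 = ℤ.≢-nonZero (positive⇒≢0 a>0)
  value-at : ∀ x y → α ≡ x → γ ≡ y → a * x * x + b * x * y + c * y * y ≡ a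
  value-at x y refl refl = aut-value {f} {M} aut
  δ-at : ∀ x y → α ≡ x → γ ≡ y → a * δ ≡ a * x + b * y
  δ-at x y refl refl = aut-δ {f} {M} aut
  β-at : ∀ y → γ ≡ y → a * β ≡ - (c * y)
  β-at y refl = aut-β {f} {M} aut
  β-zero : γ ≡ 0ℤ → β ≡ 0ℤ
  β-zero e = ℤ.*-cancelˡ-≡ a β 0ℤ (trans (β-at 0ℤ e) (solve 2 (λ a c → :- (c :* con 0ℤ) := a :* con 0ℤ) refl a c))
  δ-α : ∀ x → α ≡ x → γ ≡ 0ℤ → δ ≡ x
  δ-α x e e′ = ℤ.*-cancelˡ-≡ a δ x (trans (δ-at x 0ℤ e e′) (solve 3 (λ a b x → a :* x :+ b :* con 0ℤ := a :* x) refl a b x))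
  ∣b∣≤a : + ℤ.∣ b ∣ ≤ a
  ∣b∣≤a = abs-≤ -a≤b b≤a
  b-multiple : ∀ x → b ≡ a * x → b ≡ 0ℤ ⊎ b ≡ a ⊎ b ≡ - a
  b-multiple x e with small x (ℤ.drop‿+≤+ (ℤ.*-cancelˡ-≤-pos (+ ℤ.∣ x ∣) 1ℤ a {{ℤ.positive a>0}} le))
    where
    le : a * + ℤ.∣ x ∣ ≤ a * 1ℤ
    le = subst₂ _≤_ (trans (cong +_ (trans (cong ℤ.∣_∣ e) (ℤ.abs-* a x))) (trans (ℤ.pos-* ℤ.∣ a ∣ ℤ.∣ x ∣) (cong (_* + ℤ.∣ x ∣) (ℤ.0≤i⇒+∣i∣≡i (ℤ.<⇒≤ a>0))))) (sym (ℤ.*-identityʳ a)) ∣b∣≤a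
  ... | inj₁ refl = inj₁ (trans e (ℤ.*-zeroʳ a))
  ... | inj₂ (inj₁ refl) = inj₂ (inj₁ (trans e (ℤ.*-identityʳ a)))
  ... | inj₂ (inj₂ refl) = inj₂ (inj₂ (trans e (solve 1 (λ a → a :* con -1ℤ := :- a) refl a)))
  axis : ∀ y → y * y ≡ 1ℤ → α ≡ 0ℤ → γ ≡ y → Special f
  -- Since a δ = b y and y² = 1, b is the multiple a (δ y) of a, and |b| ≤ a leaves only 0 and ± a.
  axis y yy eα eγ = c≡a , b-multiple (δ * y) (begin
      b              ≡⟨ sym (ℤ.*-identityʳ b) ⟩
      b * 1ℤ         ≡⟨ cong (b *_) (sym yy) ⟩
      b * (y * y)    ≡⟨ solve 3 (λ a b y → b :* (y :* y) := (a :* con 0ℤ :+ b :* y) :* y) refl a b y ⟩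
      (a * 0ℤ + b * y) * y ≡⟨ cong (_* y) (sym (δ-at 0ℤ y eα eγ)) ⟩
      a * δ * y      ≡⟨ ℤ.*-assoc a δ y ⟩
      a * (δ * y)    ∎)
    where
    open ≡-Reasoning
    c≡a : c ≡ a
    c≡a = begin
      c              ≡⟨ sym (ℤ.*-identityʳ c) ⟩
      c * 1ℤ         ≡⟨ cong (c *_) (sym yy) ⟩
      c * (y * y)    ≡⟨ solve 4 (λ a b c y → c :* (y :* y) := a :* con 0ℤ :* con 0ℤ :+ b :* con 0ℤ :* y :+ c :* y :* y) refl a b c y ⟩
      a * 0ℤ * 0ℤ + b * 0ℤ * y + c * y * y ≡⟨ value-at 0ℤ y eα eγ ⟩
      a              ∎
  -- Here a ± b + c = a, so |b| = c, and |b| ≤ a ≤ c makes all three equal.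
  diagonal⁺ : c ≡ - b → Special f
  diagonal⁺ e = sym a≡c , inj₂ (inj₂ (trans (sym (ℤ.neg-involutive b)) (cong -_ (trans (sym e) (sym a≡c)))))
    where
    a≡c : a ≡ c
    a≡c = ℤ.≤-antisym a≤c (subst₂ _≤_ (sym e) (ℤ.neg-involutive a) (ℤ.neg-mono-≤ -a≤b))
  diagonal⁻ : c ≡ b → Special f
  diagonal⁻ e = sym a≡c , inj₂ (inj₁ (trans (sym e) (sym a≡c)))
    where
    a≡c : a ≡ c
    a≡c = ℤ.≤-antisym a≤c (subst (_≤ a) (sym e) b≤a)
  opposite : ∀ {t} → a + t + c ≡ a → c ≡ - t
  opposite {t} e = trans (solve 3 (λ a t c → c := a :+ t :+ c :- a :- t) refl a t c) (trans (cong (λ u → u - a - t) e) (solve 2 (λ a t → a :- a :- t := :- t) refl a t))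
  cases : Small α × Small γ → (M ≡ 𝟙 ⊎ M ≡ scalar -1ℤ) ⊎ Special f
  cases (inj₁ eα , inj₁ eγ) = contradiction (trans (sym (value-at 0ℤ 0ℤ eα eγ)) (solve 3 (λ a b c → a :* con 0ℤ :* con 0ℤ :+ b :* con 0ℤ :* con 0ℤ :+ c :* con 0ℤ :* con 0ℤ := con 0ℤ) refl a b c)) (positive⇒≢0 a>0)
  cases (inj₂ (inj₁ eα) , inj₁ eγ) = inj₁ (inj₁ (mat-≡ eα (β-zero eγ) eγ (δ-α 1ℤ eα eγ)))
  cases (inj₂ (inj₂ eα) , inj₁ eγ) = inj₁ (inj₂ (mat-≡ eα (β-zero eγ) eγ (δ-α -1ℤ eα eγ)))
  cases (inj₁ eα , inj₂ (inj₁ eγ)) = inj₂ (axis 1ℤ refl eα eγ)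
  cases (inj₁ eα , inj₂ (inj₂ eγ)) = inj₂ (axis -1ℤ refl eα eγ)
  cases (inj₂ (inj₁ eα) , inj₂ (inj₁ eγ)) = inj₂ (diagonal⁺ (opposite
    (trans (solve 3 (λ a b c → a :+ b :+ c := a :* con 1ℤ :* con 1ℤ :+ b :* con 1ℤ :* con 1ℤ :+ c :* con 1ℤ :* con 1ℤ) refl a b c) (value-at 1ℤ 1ℤ eα eγ))))
  cases (inj₂ (inj₂ eα) , inj₂ (inj₂ eγ)) = inj₂ (diagonal⁺ (opposite
    (trans (solve 3 (λ a b c → a :+ b :+ c := a :* con -1ℤ :* con -1ℤ :+ b :* con -1ℤ :* con -1ℤ :+ c :* con -1ℤ :* con -1ℤ) refl a b c) (value-at -1ℤ -1ℤ eα eγ))))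
  cases (inj₂ (inj₁ eα) , inj₂ (inj₂ eγ)) = inj₂ (diagonal⁻ (trans (opposite
    (trans (solve 3 (λ a b c → a :+ :- b :+ c := a :* con 1ℤ :* con 1ℤ :+ b :* con 1ℤ :* con -1ℤ :+ c :* con -1ℤ :* con -1ℤ) refl a b c) (value-at 1ℤ -1ℤ eα eγ))) (ℤ.neg-involutive b)))
  cases (inj₂ (inj₂ eα) , inj₂ (inj₁ eγ)) = inj₂ (diagonal⁻ (trans (opposite
    (trans (solve 3 (λ a b c → a :+ :- b :+ c := a :* con -1ℤ :* con -1ℤ :+ b :* con -1ℤ :* con 1ℤ :+ c :* con 1ℤ :* con 1ℤ) refl a b c) (value-at -1ℤ 1ℤ eα eγ))) (ℤ.neg-involutive b)))

hexagonal-reflection : ∀ a → form a (- a) a ≅ form a a a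
hexagonal-reflection a = subst (form a (- a) a ≅_) shifted (shift (form a (- a) a) 1ℤ)
  where
  e₁ : ∀ a → - a + + 2 * a * 1ℤ ≡ a
  e₁ = solve 1 (λ a → :- a :+ con (+ 2) :* a :* con 1ℤ := a) refl
  e₂ : ∀ a → a * 1ℤ * 1ℤ + - a * 1ℤ + a ≡ a
  e₂ = solve 1 (λ a → a :* con 1ℤ :* con 1ℤ :+ (:- a) :* con 1ℤ :+ a := a) refl
  shifted : form a (- a + + 2 * a * 1ℤ) (a * 1ℤ * 1ℤ + - a * 1ℤ + a) ≡ form a a a
  shifted = form-≡ refl (e₁ a) (e₂ a)

special⇒contains : ∀ {f} → Special f → ContainsMultSq f ⊎ ContainsMultHex f
special⇒contains {form a _ _} (refl , inj₁ refl) = inj₁ (a , ≅⇒∼ (≅-refl {form a 0ℤ a}))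
special⇒contains {form a _ _} (refl , inj₂ (inj₁ refl)) = inj₂ (a , ≅⇒∼ (≅-refl {form a a a}))
special⇒contains {form a _ _} (refl , inj₂ (inj₂ refl)) = inj₂ (a , ≅⇒∼ (hexagonal-reflection a))

generic-auts : ∀ f → 0ℤ < A f → Reduced f → ¬ Special f → Σ (Automorphisms f) λ auts → Size auts ≡ 2
generic-auts f a>0 red ¬special = record
  { elements = 𝟙 ∷ scalar -1ℤ ∷ []
  ; unique = ((λ ()) ∷ []) ∷ [] ∷ []
  ; sound = snd
  ; complete = cpl
  } , refl
  where
  snd : ∀ {M} → M ∈ 𝟙 ∷ scalar -1ℤ ∷ [] → IsAutomorphism f M
  snd (here refl) = det-𝟙 , ⊙-𝟙 f
  snd (there (here refl)) = det-scalar -1ℤ , trans (⊙-scalar f -1ℤ) (1• f)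
  cpl : ∀ {M} → IsAutomorphism f M → M ∈ 𝟙 ∷ scalar -1ℤ ∷ []
  cpl {M} aut = cases (generic-aut {f} M a>0 red aut)
    where
    cases : (M ≡ 𝟙 ⊎ M ≡ scalar -1ℤ) ⊎ Special f → M ∈ 𝟙 ∷ scalar -1ℤ ∷ []
    cases (inj₁ (inj₁ e)) = here e
    cases (inj₁ (inj₂ e)) = there (here e)
    cases (inj₂ special) = contradiction special ¬special

Contains-≅ : ∀ {f g} → f ≅ g → ContainsMultSq g ⊎ ContainsMultHex g → ContainsMultSq f ⊎ ContainsMultHex f
Contains-≅ φ (inj₁ (k , ψ)) = inj₁ (k , ≅⇒∼ (≅-trans φ (∼⇒≅ ψ)))
Contains-≅ φ (inj₂ (k , ψ)) = inj₂ (k , ≅⇒∼ (≅-trans φ (∼⇒≅ ψ)))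

sixfold : ∀ {f w} → Weight f w → ℕ
sixfold (wSq _) = 3
sixfold (wHex _) = 2
sixfold (wOther _ _) = 6

-- The group is computed at a convenient equivalent form and conjugated back. In the generic case
-- this is a reduced form, where an extra automorphism would make `f` equivalent to a multiple of
-- one of the two exceptional forms.
weight-auts : ∀ {f w} → PositiveDefinite f → (W : Weight f w) → Σ (Automorphisms f) λ auts → sixfold W ℕ.* Size auts ≡ 12
weight-auts {f} pd (wSq (k , φ)) = transport ψ (square-auts k (posDef⇒A>0 (form k 0ℤ k) (posDef-≅ ψ pd)))
  where
  ψ : f ≅ form k 0ℤ k
  ψ = ∼⇒≅ φ
  transport : ∀ {g} → f ≅ g → (Σ (Automorphisms g) λ auts → Size auts ≡ 4) → Σ (Automorphisms f) λ auts → 3 ℕ.* Size auts ≡ 12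
  transport φ (auts , e) = proj₁ (conjugate φ auts) , cong (3 ℕ.*_) (trans (proj₂ (conjugate φ auts)) e)
weight-auts {f} pd (wHex (k , φ)) = transport ψ (hexagonal-auts k (posDef⇒A>0 (form k k k) (posDef-≅ ψ pd)))
  where
  ψ : f ≅ form k k k
  ψ = ∼⇒≅ φ
  transport : ∀ {g} → f ≅ g → (Σ (Automorphisms g) λ auts → Size auts ≡ 6) → Σ (Automorphisms f) λ auts → 2 ℕ.* Size auts ≡ 12
  transport φ (auts , e) = proj₁ (conjugate φ auts) , cong (2 ℕ.*_) (trans (proj₂ (conjugate φ auts)) e)
weight-auts {f} pd (wOther ¬sq ¬hex) = via (reduce-form f pd)
  where
  transport : ∀ {g} → f ≅ g → (Σ (Automorphisms g) λ auts → Size auts ≡ 2) → Σ (Automorphisms f) λ auts → 6 ℕ.* Size auts ≡ 12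
  transport φ (auts , e) = proj₁ (conjugate φ auts) , cong (6 ℕ.*_) (trans (proj₂ (conjugate φ auts)) e)
  via : Reduction f → Σ (Automorphisms f) λ auts → 6 ℕ.* Size auts ≡ 12
  via (g , φ , red) = transport φ (generic-auts g (posDef⇒A>0 g (posDef-≅ φ pd)) red (λ s → [ ¬sq , ¬hex ] (Contains-≅ φ (special⇒contains {g} s))))

-- Hurwitz numbers as weighted class counts

-- The list data of `hPos`, bundled so that it can be both extracted from a Hurwitz number and used
-- to build one.
record System (D : ℤ) : Set where
  constructor system
  field
    reps     : List (Form × ℚ)
    valid    : All (λ p → PositiveDefinite (proj₁ p) × (disc (proj₁ p) ≡ - D) × Weight (proj₁ p) (proj₂ p)) reps
    inequivalent : AllPairs (λ p q → ¬ (proj₁ p ∼ proj₁ q)) reps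
    exhaustive : ∀ g → PositiveDefinite g → disc g ≡ - D → Any (λ p → g ∼ proj₁ p) reps

allPairs-lookup : ∀ {A : Set} {R : A → A → Set} {xs : List A} → AllPairs R xs → ∀ {i j} → i Fin.< j → R (lookup xs i) (lookup xs j)
allPairs-lookup (r ∷ rs) {zero} {suc j} _ = All.lookup r (∈-lookup j)
allPairs-lookup (r ∷ rs) {suc i} {suc j} (ℕ.s≤s i<j) = allPairs-lookup rs i<j

module _ {D : ℤ} (𝒮 : System D) where
  open System 𝒮

  private
    entry : ∀ i → PositiveDefinite (proj₁ (lookup reps i)) × (disc (proj₁ (lookup reps i)) ≡ - D) × Weight (proj₁ (lookup reps i)) (proj₂ (lookup reps i))
    entry i = All.lookup valid (∈-lookup i)

    find : ∀ g → Any (λ p → g ∼ proj₁ p) reps → Σ (Fin (length reps)) λ i → g ≅ proj₁ (lookup reps i)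
    find g a = Any.index a , ∼⇒≅ (Any.lookup-index a)

    separated : ∀ {i j} → proj₁ (lookup reps i) ≅ proj₁ (lookup reps j) → i ≡ j
    separated {i} {j} φ with Fin.<-cmp i j
    ... | tri< i<j _ _ = contradiction (≅⇒∼ φ) (allPairs-lookup inequivalent i<j)
    ... | tri≈ _ i≡j _ = i≡j
    ... | tri> _ _ j<i = contradiction (≅⇒∼ (≅-sym φ)) (allPairs-lookup inequivalent j<i)

  classes : Classes D
  classes = record
    { size = length reps
    ; rep = λ i → proj₁ (lookup reps i)
    ; posDef = λ i → proj₁ (entry i)
    ; disc≡ = λ i → proj₁ (proj₂ (entry i))
    ; class = λ g pd e → find g (exhaustive g pd e)
    ; distinct = separated
    ; weight = λ i → sixfold (proj₂ (proj₂ (entry i)))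
    ; auts = λ i → proj₁ (weight-auts (proj₁ (entry i)) (proj₂ (proj₂ (entry i))))
    ; mass = λ i → proj₂ (weight-auts (proj₁ (entry i)) (proj₂ (proj₂ (entry i))))
    }

  hurwitz : ℚ
  hurwitz = sumℚ (List.map proj₂ reps)

-- The unnormalised fraction stores its denominator minus one, so 5 stands for the denominator 6.
_≃_/6 : ℚ → ℕ → Set
q ≃ t /6 = toℚᵘ q ℚᵘ.≃ mkℚᵘ (+ t) 5

sixths-+ : ∀ {q r t u} → q ≃ t /6 → r ≃ u /6 → (q ℚ.+ r) ≃ t ℕ.+ u /6
sixths-+ {q} {r} {t} {u} e e′ = ℚᵘ.≃-trans (ℚ.toℚᵘ-homo-+ q r) (ℚᵘ.≃-trans (ℚᵘ.+-cong e e′)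
  (*≡* (solve 2 (λ t u → (t :* con (+ 6) :+ u :* con (+ 6)) :* con (+ 6) := (t :+ u) :* con (+ 36)) refl (+ t) (+ u))))

sixths-weight : ∀ {f w} (W : Weight f w) → w ≃ sixfold W /6
sixths-weight (wSq _) = *≡* refl
sixths-weight (wHex _) = *≡* refl
sixths-weight (wOther _ _) = *≡* refl

sixths-sum : ∀ {V : Form × ℚ → Set} (reps : List (Form × ℚ)) (valid : All V reps) (W : ∀ {p} → V p → Weight (proj₁ p) (proj₂ p)) →
  sumℚ (List.map proj₂ reps) ≃ ∑[ i < length reps ] sixfold (W (All.lookup valid (∈-lookup i))) /6
sixths-sum [] [] W = *≡* refl
sixths-sum (p ∷ reps) (v ∷ valid) W = sixths-+ (sixths-weight (W v)) (sixths-sum reps valid W)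

hurwitz-total : ∀ {D} (𝒮 : System D) → hurwitz 𝒮 ≃ total (classes 𝒮) /6
hurwitz-total 𝒮 = sixths-sum (System.reps 𝒮) (System.valid 𝒮) (proj₂ ∘ proj₂)

-- Passing between H(D) and 6 H(D) modulo ℓ.

module _ (ℓ : ℕ) (ℓ-prime : Prime ℓ) (3<ℓ : 3 ℕ.< ℓ) where
  ∤6 : ¬ ℓ ℕ.∣ 6
  ∤6 d with euclidsLemma 2 3 ℓ-prime d
  ... | inj₁ e = ℕ.≤⇒≯ (ℕ.∣⇒≤ e) (ℕ.<-trans (ℕ.n<1+n 2) 3<ℓ)
  ... | inj₂ e = ℕ.≤⇒≯ (ℕ.∣⇒≤ e) 3<ℓ

  private
    cross : ∀ {n d-1 t} .{c : Coprime ℤ.∣ n ∣ (suc d-1)} → mkℚ n d-1 c ≃ t /6 → ℤ.∣ n ∣ ℕ.* 6 ≡ t ℕ.* suc d-1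
    cross {n} {d-1} {t} (*≡* e) = trans (sym (ℤ.abs-* n (+ 6))) (trans (cong ℤ.∣_∣ e) (ℤ.abs-* (+ t) (+ suc d-1)))

  -- In lowest terms n / d = t / 6 gives 6 n = t d, and ℓ ∣ n keeps ℓ from dividing d.
  zeroMod⇒∣ : ∀ {q t} → q ≃ t /6 → ZeroMod ℓ q → ℓ ℕ.∣ t
  zeroMod⇒∣ {mkℚ n d-1 c} {t} e d with euclidsLemma t (suc d-1) ℓ-prime (subst (ℓ ℕ.∣_) (cross {n} {d-1} {t} {c} e) (ℕ.∣m⇒∣m*n 6 d))
  ... | inj₁ ℓ∣t = ℓ∣t
  ... | inj₂ ℓ∣d with Coprime.recompute {n = ℤ.∣ n ∣} {d = suc d-1} c (d , ℓ∣d)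
  ... | refl = contradiction ℓ-prime ¬prime[1]

  ∣⇒zeroMod : ∀ {q t} → q ≃ t /6 → ℓ ℕ.∣ t → ZeroMod ℓ q
  ∣⇒zeroMod {mkℚ n d-1 c} {t} e ℓ∣t with euclidsLemma ℤ.∣ n ∣ 6 ℓ-prime (subst (ℓ ℕ.∣_) (sym (cross {n} {d-1} {t} {c} e)) (ℕ.∣m⇒∣m*n (suc d-1) ℓ∣t))
  ... | inj₁ d = d
  ... | inj₂ d = contradiction d ∤6

-- Existence of class representatives up to double negation.

¬¬-weight : ∀ f → ¬ ¬ (Σ ℚ λ w → Weight f w)
¬¬-weight f k = ¬¬-excluded-middle λ where
  (yes sq) → k (_ , wSq sq)
  (no ¬sq) → ¬¬-excluded-middle λ where
    (yes hex) → k (_ , wHex hex)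
    (no ¬hex) → k (_ , wOther ¬sq ¬hex)

Good : ℤ → Form → Set
Good D f = PositiveDefinite f × disc f ≡ - D

Partial : ℤ → List Form → Set
Partial D fs = Σ (List (Form × ℚ)) λ reps →
  All (λ p → PositiveDefinite (proj₁ p) × (disc (proj₁ p) ≡ - D) × Weight (proj₁ p) (proj₂ p)) reps ×
  AllPairs (λ p q → ¬ (proj₁ p ∼ proj₁ q)) reps ×
  (∀ {g} → g ∈ fs → Good D g → Any (λ p → g ∼ proj₁ p) reps)

-- A greedy selection: a form is kept if it has the right discriminant, is positive definite and is
-- equivalent to none of those kept so far. Each of these questions, and the choice of the weight,
-- is settled by excluded middle under the double negation.
¬¬-partial : ∀ D fs → ¬ ¬ Partial D fs
¬¬-partial D [] k = k ([] , [] , [] , λ ())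
¬¬-partial D (f ∷ fs) k = ¬¬-partial D fs λ (reps , valid , dist , cover) →
  ¬¬-excluded-middle λ where
    (no ¬good) → k (reps , valid , dist , λ { (here refl) good → contradiction good ¬good ; (there g∈) good → cover g∈ good })
    (yes good) → ¬¬-excluded-middle λ where
      (yes old) → k (reps , valid , dist , λ { (here refl) _ → old ; (there g∈) good → cover g∈ good })
      (no new) → ¬¬-weight f λ (w , W) → k ((f , w) ∷ reps , (proj₁ good , proj₂ good , W) ∷ valid , All.¬Any⇒All¬ reps new ∷ dist ,
        λ { (here refl) _ → here (≅⇒∼ ≅-refl) ; (there g∈) good → there (cover g∈ good) })

range : ℕ → List ℤ
range d = List.map +_ (upTo (suc d)) ++ List.map (λ n → - (+ n)) (upTo (suc d))

∈-range : ∀ {d} x → ℤ.∣ x ∣ ℕ.≤ d → x ∈ range d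
∈-range (+ n) le = ∈-++⁺ˡ (∈-map⁺ +_ (∈-upTo⁺ (ℕ.s≤s le)))
∈-range {d} -[1+ n ] le = ∈-++⁺ʳ (List.map +_ (upTo (suc d))) (∈-map⁺ (λ n → - (+ n)) (∈-upTo⁺ {i = suc n} (ℕ.s≤s le)))

box : ℕ → List Form
box d = cartesianProductWith (λ a (b , c) → form a b c) (range d) (cartesianProduct (range d) (range d))

∈-box : ∀ {d} f → ℤ.∣ A f ∣ ℕ.≤ d → ℤ.∣ B f ∣ ℕ.≤ d → ℤ.∣ C f ∣ ℕ.≤ d → f ∈ box d
∈-box (form a b c) la lb lc = ∈-cartesianProductWith⁺ (λ a (b , c) → form a b c) (∈-range a la) (∈-cartesianProduct⁺ (∈-range b lb) (∈-range c lc))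

-- With B² ≤ A C, the equation B² + d = 4 A C gives 3 A C ≤ d, which bounds all three coefficients.
-- So `box d` meets every class.
reduced-size : ∀ d f → 0ℤ < A f → Reduced f → disc f ≡ - (+ d) → ℤ.∣ A f ∣ ℕ.≤ d × ℤ.∣ B f ∣ ℕ.≤ d × ℤ.∣ C f ∣ ℕ.≤ d
reduced-size d f@(form (+ m) b (+ n)) (+<+ 0<m) (reduced -a≤b b≤a (+≤+ m≤n)) e =
  ℕ.≤-trans (ℕ.m≤m*n m n) mn≤d , ℕ.≤-trans k≤m (ℕ.≤-trans (ℕ.m≤m*n m n) mn≤d) , ℕ.≤-trans (ℕ.m≤n*m n m) mn≤d
  where
  k = ℤ.∣ b ∣
  instance
    m≢0 : ℕ.NonZero m
    m≢0 = ℕ.>-nonZero 0<m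
    n≢0 : ℕ.NonZero n
    n≢0 = ℕ.>-nonZero (ℕ.<-≤-trans 0<m m≤n)
  k≤m : k ℕ.≤ m
  k≤m = ℤ.drop‿+≤+ (abs-≤ -a≤b b≤a)
  eq : k ℕ.* k ℕ.+ d ≡ 4 ℕ.* m ℕ.* n
  eq = ℤ.+-injective (begin
    + (k ℕ.* k) + + d              ≡⟨ cong (_+ + d) (sym (square-abs b)) ⟩
    b * b + + d                    ≡⟨ solve 3 (λ b d x → b :* b :+ d := b :* b :- x :+ d :+ x) refl b (+ d) (+ 4 * + m * + n) ⟩
    b * b - + 4 * + m * + n + + d + + 4 * + m * + n ≡⟨ cong (λ t → t + + d + + 4 * + m * + n) e ⟩
    - (+ d) + + d + + 4 * + m * + n ≡⟨ solve 2 (λ d x → :- d :+ d :+ x := x) refl (+ d) (+ 4 * + m * + n) ⟩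
    + 4 * + m * + n                ≡⟨ cong (_* + n) (sym (ℤ.pos-* 4 m)) ⟩
    + (4 ℕ.* m) * + n              ≡⟨ sym (ℤ.pos-* (4 ℕ.* m) n) ⟩
    + (4 ℕ.* m ℕ.* n)              ∎)
    where open ≡-Reasoning
  mn≤d : m ℕ.* n ℕ.≤ d
  mn≤d = ℕ.≤-trans (ℕ.m≤n*m (m ℕ.* n) 3) (ℕ.+-cancelˡ-≤ (k ℕ.* k) _ _ (ℕ.≤-trans (ℕ.+-monoˡ-≤ (3 ℕ.* (m ℕ.* n)) (ℕ.*-mono-≤ k≤m (ℕ.≤-trans k≤m m≤n)))
    (ℕ.≤-reflexive (trans (four m n) (sym eq)))))
    where
    four : ∀ m n → m ℕ.* n ℕ.+ 3 ℕ.* (m ℕ.* n) ≡ 4 ℕ.* m ℕ.* n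
    four = ℕ-solve-∀

-- Divisibility by ℓ is decidable, so it is enough to have class representatives up to double negation, which spares
-- deciding equivalence of forms.
¬¬-system : ∀ D → 0ℤ < D → ¬ ¬ System D
¬¬-system (+ d) _ k = ¬¬-partial (+ d) (box d) λ (reps , valid , dist , cover) →
  k (system reps valid dist λ g pd e → via reps cover g pd e (reduce-form g pd))
  where
  via : ∀ (reps : List (Form × ℚ)) → (∀ {g} → g ∈ box d → Good (+ d) g → Any (λ p → g ∼ proj₁ p) reps) →
    ∀ g → PositiveDefinite g → disc g ≡ - (+ d) → Reduction g → Any (λ p → g ∼ proj₁ p) reps
  via reps cover g pd e (h , φ , red) = Any.map (λ r → ≅⇒∼ (≅-trans φ (∼⇒≅ r)))
    (cover (∈-box h (proj₁ sizes) (proj₁ (proj₂ sizes)) (proj₂ (proj₂ sizes))) (pd′ , e′))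
    where
    pd′ : PositiveDefinite h
    pd′ = posDef-≅ φ pd
    e′ : disc h ≡ - (+ d)
    e′ = trans (sym (disc-≅ φ)) e
    sizes = reduced-size d h (posDef⇒A>0 h pd′) red e′

-- Descent along square multiples of D

NoCommonPrime : ℤ → ℤ → Set
NoCommonPrime x y = ∀ q → Prime q → + q ∣ x → ¬ + q ∣ y

prime∣prime : ∀ {p q} → Prime p → Prime q → q ℕ.∣ p → q ≡ p
prime∣prime pp qq d with prime⇒irreducible pp d
... | inj₁ refl = contradiction qq ¬prime[1]
... | inj₂ e = e

prime-factor : ∀ n → 1 ℕ.< n → Σ ℕ λ p → Prime p × p ℕ.∣ n
prime-factor n 1<n = go (factors F) (isFactorisation F) (factorsPrime F)
  where
  open PrimeFactorisation
  F = factorise n {{ℕ.>-nonZero (ℕ.<-trans ℕ.z<s 1<n)}}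
  go : ∀ ps → n ≡ product ps → All Prime ps → Σ ℕ λ p → Prime p × p ℕ.∣ n
  go [] refl _ = contradiction 1<n λ { (ℕ.s≤s ()) }
  go (p ∷ ps) refl (pp ∷ _) = p , pp , ℕ.m∣m*n (product ps)

euclidℤ : ∀ {q} → Prime q → ∀ x y → + q ∣ x * y → + q ∣ x ⊎ + q ∣ y
euclidℤ {q} qq = ModPrime.euclid q qq

product-avoiding : ∀ s (qs : List ℕ) → All Prime qs → Σ ℤ λ k →
  (∀ {q} → q ∈ qs → ¬ + q ∣ s → + q ∣ k) × (∀ q → Prime q → + q ∣ s → ¬ + q ∣ k)
product-avoiding s [] [] = 1ℤ , (λ ()) , λ q qq _ → ModPrime.∤1 q qq
product-avoiding s (r ∷ qs) (rr ∷ primes) = extend (product-avoiding s qs primes) (+ r ∣? s)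
  where
  Result : List ℕ → Set
  Result qs = Σ ℤ λ k → (∀ {q} → q ∈ qs → ¬ + q ∣ s → + q ∣ k) × (∀ q → Prime q → + q ∣ s → ¬ + q ∣ k)
  extend : Result qs → Dec (+ r ∣ s) → Result (r ∷ qs)
  extend (k , f , g) (yes r∣s) = k , (λ { (here refl) ¬d → contradiction r∣s ¬d ; (there q∈) → f q∈ }) , g
  extend (k , f , g) (no r∤s) = + r * k , (λ { (here refl) _ → ∣m⇒∣m*n k ∣-refl ; (there q∈) ¬d → ∣n⇒∣m*n (+ r) (f q∈ ¬d) }) , g′
    where
    g′ : ∀ q → Prime q → + q ∣ s → ¬ + q ∣ + r * k
    g′ q qq q∣s d with euclidℤ qq (+ r) k d
    ... | inj₂ e = g q qq q∣s e
    ... | inj₁ e = r∤s (subst (λ t → + t ∣ s) (prime∣prime rr qq (∣⇒∣ᵤ e)) q∣s)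

-- Take k to be the product of the primes of N that do not divide s. Each prime of N then divides
-- exactly one of s and a k, hence not their sum. This is the substitute for primes in arithmetic
-- progressions.
shift-coprime : ∀ a s N → NoCommonPrime s a → .{{ℕ.NonZero N}} → Σ ℤ λ k → NoCommonPrime (s + a * k) (+ N)
shift-coprime a s N cop = k , avoid
  where
  open PrimeFactorisation
  F = factorise N
  result = product-avoiding s (factors F) (factorsPrime F)
  k = proj₁ result
  avoid : NoCommonPrime (s + a * k) (+ N)
  avoid q qq q∣s+ak q∣N = cases (+ q ∣? s)
    where
    q∈ : q ∈ factors F
    q∈ = factorisationHasAllPrimeFactors qq (subst (q ℕ.∣_) (isFactorisation F) (∣⇒∣ᵤ q∣N)) (factorsPrime F)
    cases : ¬ Dec (+ q ∣ s)
    cases (no q∤s) = q∤s (∣-comb 1ℤ (- a) q∣s+ak (proj₁ (proj₂ result) q∈ q∤s) (solve 3 (λ s a k → s := con 1ℤ :* (s :+ a :* k) :+ (:- a) :* k) refl s a k))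
    cases (yes q∣s) = [ cop q qq q∣s , proj₂ (proj₂ result) q qq q∣s ]
      (euclidℤ qq a k (∣-comb 1ℤ -1ℤ q∣s+ak q∣s (solve 3 (λ s a k → a :* k := con 1ℤ :* (s :+ a :* k) :+ con -1ℤ :* s) refl s a k)))

square-positive : ∀ {x} → x ≢ 0ℤ → 0ℤ < x * x
square-positive {+ 0} x≢0 = contradiction refl x≢0
square-positive {+ suc n} _ = +<+ ℕ.z<s
square-positive { -[1+ n ]} _ = +<+ ℕ.z<s

parity : ∀ x → Σ ℤ λ y → x ≡ + 2 * y ⊎ x ≡ + 2 * y + 1ℤ
parity x = x /ℕ 2 , cases (x %ℕ 2) (n%ℕd<d x 2) (a≡a%ℕn+[a/ℕn]*n x 2)
  where
  cases : ∀ r → r ℕ.< 2 → x ≡ + r + (x /ℕ 2) * + 2 → x ≡ + 2 * (x /ℕ 2) ⊎ x ≡ + 2 * (x /ℕ 2) + 1ℤ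
  cases 0 _ e = inj₁ (trans e (solve 1 (λ y → con (+ 0) :+ y :* con (+ 2) := con (+ 2) :* y) refl (x /ℕ 2)))
  cases 1 _ e = inj₂ (trans e (solve 1 (λ y → con (+ 1) :+ y :* con (+ 2) := con (+ 2) :* y :+ con 1ℤ) refl (x /ℕ 2)))
  cases (suc (suc r)) (ℕ.s≤s (ℕ.s≤s ())) e

discCong-square : ∀ x {D} → DiscCong D → DiscCong (x * x * D)
discCong-square x {D} (k , inj₁ e) = x * x * k , inj₁ (trans (ℤ.neg-distribʳ-* (x * x) D) (trans (cong (x * x *_) e)
  (solve 2 (λ x k → x :* x :* (con (+ 4) :* k) := con (+ 4) :* (x :* x :* k)) refl x k)))
discCong-square x {D} (k , inj₂ e) = cases (parity x)
  where
  cases : (Σ ℤ λ y → x ≡ + 2 * y ⊎ x ≡ + 2 * y + 1ℤ) → DiscCong (x * x * D)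
  cases (y , inj₁ refl) = y * y * (+ 4 * k + 1ℤ) , inj₁ (trans (ℤ.neg-distribʳ-* (x * x) D) (trans (cong (x * x *_) e)
    (solve 2 (λ y k → con (+ 2) :* y :* (con (+ 2) :* y) :* (con (+ 4) :* k :+ con 1ℤ) := con (+ 4) :* (y :* y :* (con (+ 4) :* k :+ con 1ℤ))) refl y k)))
  cases (y , inj₂ refl) = x * x * k + y * y + y , inj₂ (trans (ℤ.neg-distribʳ-* (x * x) D) (trans (cong (x * x *_) e)
    (solve 2 (λ y k → (con (+ 2) :* y :+ con 1ℤ) :* (con (+ 2) :* y :+ con 1ℤ) :* (con (+ 4) :* k :+ con 1ℤ)
       := con (+ 4) :* ((con (+ 2) :* y :+ con 1ℤ) :* (con (+ 2) :* y :+ con 1ℤ) :* k :+ y :* y :+ y) :+ con 1ℤ) refl y k)))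

module Descent (ℓ : ℕ) (ℓ-prime : Prime ℓ) where
  -- Stated for every choice of representatives, as none is at hand except under a double negation.
  Vanish : ℤ → Set
  Vanish D = ∀ (X : Classes D) → ℓ ℕ.∣ total X

  private
    euclidℓ : ∀ m n → ¬ ℓ ℕ.∣ m → ℓ ℕ.∣ m ℕ.* n → ℓ ℕ.∣ n
    euclidℓ m n ¬d d with euclidsLemma m n ℓ-prime d
    ... | inj₁ e = contradiction e ¬d
    ... | inj₂ e = e

    with-classes : ∀ {D} {Q : Set} → 0ℤ < D → Dec Q → (Classes D → Q) → Q
    with-classes {D} D>0 Q? f = decidable-stable Q? λ ¬q → ¬¬-system D D>0 λ 𝒮 → ¬q (f (classes 𝒮))

  Split : ℤ → ℕ → Set
  Split D p = ¬ + p ∣ + 2 × ¬ + p ∣ D × Σ ℤ λ r → + p ∣ r * r + D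

  module _ (p : ℕ) (pp : Prime p) (odd : ¬ + p ∣ + 2) where
    open Hecke p pp odd
    private P = + p

    -- Writing h_k for the total at p²ᵏD, an inert p gives h₁ = (p + 2) h₀, h₂ = (p + 1) h₁ - p h₀, h₃ = (p + 1) h₂ - p h₁.
    -- If h₁ ≡ h₃ ≡ 0 then (p + 1) p h₀ ≡ 0, and when p ≡ -1 already h₁ ≡ h₀.
    inert-descent : ∀ h₀ h₁ h₂ h₃ → ¬ ℓ ℕ.∣ p → h₁ ≡ suc (suc p) ℕ.* h₀ → suc p ℕ.* h₁ ≡ p ℕ.* h₀ ℕ.+ h₂ → suc p ℕ.* h₂ ≡ p ℕ.* h₁ ℕ.+ h₃ →
      ℓ ℕ.∣ h₁ → ℓ ℕ.∣ h₃ → ℓ ℕ.∣ h₀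
    inert-descent h₀ h₁ h₂ h₃ ℓ∤p e₁ e₂ e₃ d₁ d₃ with euclidsLemma (suc p) h₂ ℓ-prime (subst (ℓ ℕ.∣_) (sym e₃) (ℕ.∣m∣n⇒∣m+n (ℕ.∣n⇒∣m*n p d₁) d₃))
    ... | inj₁ d = ℕ.∣m+n∣m⇒∣n (subst (ℓ ℕ.∣_) (trans e₁ (ℕ.+-comm h₀ (suc p ℕ.* h₀))) d₁) (ℕ.∣m⇒∣m*n h₀ d)
    ... | inj₂ d₂ = euclidℓ p h₀ ℓ∤p (ℕ.∣m+n∣m⇒∣n (subst (ℓ ℕ.∣_) (trans e₂ (ℕ.+-comm (p ℕ.* h₀) h₂)) (ℕ.∣n⇒∣m*n (suc p) d₁)) d₂)

    -- A split p needs only `v₁`, since it multiplies the total by p, a unit modulo ℓ; otherwise -D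
    -- is a nonsquare modulo p and `inert-descent` uses both values. The goal is decidable, so the
    -- distinction may be made by excluded middle.
    prime-descent : ∀ {D} → 0ℤ < D → ¬ P ∣ D → ¬ ℓ ℕ.∣ p → Vanish (P * P * D) → Vanish (P * P * (P * P * (P * P * D))) → Vanish D
    prime-descent {D} D>0 p∤D ℓ∤p v₁ v₃ X =
      with-classes D₁>0 goal? λ X₁ → with-classes D₂>0 goal? λ X₂ → with-classes (*-positive PP>0 D₂>0) goal? λ X₃ →
      decidable-stable goal? λ ¬goal → ¬¬-excluded-middle {A = Σ ℤ λ r → P ∣ r * r + D} λ where
        (yes (r , d)) → ¬goal (euclidℓ p (total X) ℓ∤p (subst (ℓ ℕ.∣_) (hecke-split r p∤D d refl X X₁) (v₁ X₁)))
        (no none) → ¬goal (inert-descent (total X) (total X₁) (total X₂) (total X₃) ℓ∤p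
          (hecke-inert p∤D (λ r d → none (r , d)) refl X X₁) (hecke-ramified refl refl X X₁ X₂) (hecke-ramified refl refl X₁ X₂ X₃) (v₁ X₁) (v₃ X₃))
      where
      goal? : Dec (ℓ ℕ.∣ total X)
      goal? = ℓ ℕ.∣? total X
      PP>0 : 0ℤ < P * P
      PP>0 = *-positive (ModPrime.P>0 p pp) (ModPrime.P>0 p pp)
      D₁>0 : 0ℤ < P * P * D
      D₁>0 = *-positive PP>0 D>0
      D₂>0 : 0ℤ < P * P * (P * P * D)
      D₂>0 = *-positive PP>0 D₁>0

  module _ {D : ℤ} (D>0 : 0ℤ < D) where
    AllSplit : ℕ → Set
    AllSplit m = ∀ q → Prime q → q ℕ.∣ m → Split D q

    square-D>0 : ∀ m → .{{ℕ.NonZero m}} → 0ℤ < + m * + m * D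
    square-D>0 (suc m) = *-positive {+ suc m * + suc m} (+<+ ℕ.z<s) D>0

    -- If p ∤ m, then -m²D is still a nonzero square modulo p and `hecke-split` applies. If m = k p,
    -- let Z, X, Y be the totals at k², m² and p²m² times D: induction gives X = p Z, and (p + 1) X
    -- = p Z + Y becomes Y = p X. So split primes multiply the total by p at every power.
    split-total : ∀ m → Acc ℕ._<_ m → .{{ℕ.NonZero m}} → AllSplit m → ∀ p → Prime p → Split D p → ∀ {D′} → D′ ≡ + p * + p * (+ m * + m * D) →
      (X : Classes (+ m * + m * D)) (Y : Classes D′) → total Y ≡ p ℕ.* total X
    split-total m (acc rec) split p pp (odd , p∤D , r , d) e X Y with p ℕ.∣? m
    ... | no p∤m = Hecke.hecke-split p pp odd (r * + m) p∤m²D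
        (∣-mult (+ m * + m) d (solve 3 (λ r m D → r :* m :* (r :* m) :+ m :* m :* D := m :* m :* (r :* r :+ D)) refl r (+ m) D)) e X Y
      where
      p∤m²D : ¬ + p ∣ + m * + m * D
      p∤m²D d with euclidℤ pp (+ m * + m) D d
      ... | inj₂ d′ = p∤D d′
      ... | inj₁ d′ = p∤m (∣⇒∣ᵤ (ModPrime.square⇒∣ p pp (+ m) d′))
    ... | yes (ℕ.divides k refl) = with-classes (square-D>0 k) (total Y ℕ.≟ p ℕ.* total X) λ Z →
        conclude (total Z) (total X) (total Y) (Hecke.hecke-ramified p pp odd e₁ e Z X Y)
          (split-total k (rec k<m) (λ q qq q∣k → split q qq (ℕ.∣m⇒∣m*n p q∣k)) p pp (odd , p∤D , r , d) e₁ Z X)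
      where
      instance
        k≢0 : ℕ.NonZero k
        k≢0 = ℕ.m*n≢0⇒m≢0 k {p}
      k<m : k ℕ.< k ℕ.* p
      k<m = ℕ.m<m*n k p (ℕ.nonTrivial⇒n>1 p {{prime⇒nonTrivial pp}})
      e₁ : + (k ℕ.* p) * + (k ℕ.* p) * D ≡ + p * + p * (+ k * + k * D)
      e₁ = trans (cong (λ t → t * t * D) (ℤ.pos-* k p)) (solve 3 (λ k p D → k :* p :* (k :* p) :* D := p :* p :* (k :* k :* D)) refl (+ k) (+ p) D)
      conclude : ∀ z x y → suc p ℕ.* x ≡ p ℕ.* z ℕ.+ y → x ≡ p ℕ.* z → y ≡ p ℕ.* x
      conclude z x y h h′ = sym (ℕ.+-cancelˡ-≡ x (p ℕ.* x) y (trans h (cong (ℕ._+ y) (sym h′))))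

    split-descent : ∀ n → Acc ℕ._<_ n → .{{ℕ.NonZero n}} → AllSplit n → ¬ ℓ ℕ.∣ n → Vanish (+ n * + n * D) → Vanish D
    split-descent 1 _ split ℓ∤n v = subst Vanish (solve 1 (λ D → con 1ℤ :* con 1ℤ :* D := D) refl D) v
    split-descent n@(suc (suc _)) (acc rec) split ℓ∤n v = cases (prime-factor n (ℕ.s≤s ℕ.z<s))
      where
      cases : (Σ ℕ λ p → Prime p × p ℕ.∣ n) → Vanish D
      cases (p , pp , ℕ.divides k eq) = split-descent k (rec k<n) split′ ℓ∤k v′
        where
        instance
          kp≢0 : ℕ.NonZero (k ℕ.* p)
          kp≢0 = subst ℕ.NonZero eq _
          k≢0 : ℕ.NonZero k
          k≢0 = ℕ.m*n≢0⇒m≢0 k {p}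
        k<n : k ℕ.< n
        k<n = subst (k ℕ.<_) (sym eq) (ℕ.m<m*n k p (ℕ.nonTrivial⇒n>1 p {{prime⇒nonTrivial pp}}))
        p∣n : p ℕ.∣ n
        p∣n = ℕ.divides k eq
        ℓ∤p : ¬ ℓ ℕ.∣ p
        ℓ∤p d = ℓ∤n (ℕ.∣-trans d p∣n)
        ℓ∤k : ¬ ℓ ℕ.∣ k
        ℓ∤k d = ℓ∤n (subst (ℓ ℕ.∣_) (sym eq) (ℕ.∣m⇒∣m*n p d))
        split′ : AllSplit k
        split′ q qq q∣k = split q qq (subst (q ℕ.∣_) (sym eq) (ℕ.∣m⇒∣m*n p q∣k))
        e : + n * + n * D ≡ + p * + p * (+ k * + k * D)
        e = trans (cong (λ t → t * t * D) (trans (cong +_ eq) (ℤ.pos-* k p))) (solve 3 (λ k p D → k :* p :* (k :* p) :* D := p :* p :* (k :* k :* D)) refl (+ k) (+ p) D)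
        v′ : Vanish (+ k * + k * D)
        v′ X = with-classes (square-D>0 n) (ℓ ℕ.∣? total X) λ Y →
          euclidℓ p (total X) ℓ∤p (subst (ℓ ℕ.∣_) (split-total k (<-wellFounded k) split′ p pp (split p pp p∣n) e X Y) (v Y))

-- Residue classes modulo a and removal of primes.

coprime-cancel : ∀ {x y a} t → x * y + t * a ≡ 1ℤ → NoCommonPrime x a
coprime-cancel {x} {y} {a} t e q qq q∣x q∣a = ModPrime.∤1 q qq (∣-comb y t q∣x q∣a (trans (sym e) (cong (_+ t * a) (ℤ.*-comm x y))))

nonzero : ∀ {x} N → .{{ℕ.NonZero N}} → NoCommonPrime x (+ (2 ℕ.* N)) → x ≢ 0ℤ
nonzero N cop refl = cop 2 prime[2] (divides 0ℤ refl) (∣ᵤ⇒∣ (ℕ.m∣m*n N))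

module SquareClass (ℓ : ℕ) (ℓ-prime : Prime ℓ) (a : ℤ) (a≥1 : 1ℤ ≤ a) where
  open Descent ℓ ℓ-prime

  -- Used with c the inverse of u: this is what the hypothesis says about square multiples of D.
  VanishOn : ℤ → ℤ → Set
  VanishOn c D = ∀ x → x ≢ 0ℤ → a ∣ x - c → Vanish (x * x * D)

  -- Collects the primes that multipliers must avoid: 2 for the Hecke relations, those of `a` for
  -- the congruence, ℓ so that multipliers are units, and those of D to exclude ramification.
  level : ℤ → ℕ
  level D = 2 ℕ.* (ℤ.∣ a ∣ ℕ.* (ℓ ℕ.* ℤ.∣ D ∣))

  private
    a≢0 : ℕ.NonZero ℤ.∣ a ∣
    a≢0 = abs-nonZero (ℤ.<-≤-trans (+<+ ℕ.z<s) a≥1)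
      where
      abs-nonZero : ∀ {x} → 0ℤ < x → ℕ.NonZero ℤ.∣ x ∣
      abs-nonZero (+<+ 0<n) = ℕ.>-nonZero 0<n

    level-factor : ∀ D → 0ℤ < D → ℕ.NonZero (ℤ.∣ a ∣ ℕ.* (ℓ ℕ.* ℤ.∣ D ∣))
    level-factor (+ suc n) _ = ℕ.m*n≢0 ℤ.∣ a ∣ (ℓ ℕ.* suc n) {{a≢0}} {{ℕ.m*n≢0 ℓ (suc n) {{prime⇒nonZero ℓ-prime}}}}
    level-factor (+ 0) (+<+ ())

    level≢0 : ∀ D → 0ℤ < D → ℕ.NonZero (level D)
    level≢0 D D>0 = ℕ.m*n≢0 2 (ℤ.∣ a ∣ ℕ.* (ℓ ℕ.* ℤ.∣ D ∣)) {{_}} {{level-factor D D>0}}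

    2∣level : ∀ D {q} → + q ∣ + 2 → + q ∣ + level D
    2∣level D d = ∣-trans d (∣ᵤ⇒∣ (ℕ.m∣m*n (ℤ.∣ a ∣ ℕ.* (ℓ ℕ.* ℤ.∣ D ∣))))

    a∣level : ∀ D → a ∣ + level D
    a∣level D = ∣-trans m∣∣m∣ (∣ᵤ⇒∣ (ℕ.∣n⇒∣m*n 2 (ℕ.m∣m*n (ℓ ℕ.* ℤ.∣ D ∣))))

    ℓ∣level : ∀ D → + ℓ ∣ + level D
    ℓ∣level D = ∣ᵤ⇒∣ (ℕ.∣n⇒∣m*n 2 (ℕ.∣n⇒∣m*n ℤ.∣ a ∣ (ℕ.m∣m*n ℤ.∣ D ∣)))

    D∣level : ∀ D → D ∣ + level D
    D∣level D = ∣-trans m∣∣m∣ (∣ᵤ⇒∣ (ℕ.∣n⇒∣m*n 2 (ℕ.∣n⇒∣m*n ℤ.∣ a ∣ (ℕ.n∣m*n ℓ))))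

    level-prime : ∀ D q → Prime q → + q ∣ + level D → + q ∣ + 2 ⊎ + q ∣ a ⊎ + q ∣ + ℓ ⊎ + q ∣ D
    level-prime D q qq d with euclidsLemma 2 (ℤ.∣ a ∣ ℕ.* (ℓ ℕ.* ℤ.∣ D ∣)) qq (∣⇒∣ᵤ d)
    ... | inj₁ e = inj₁ (∣ᵤ⇒∣ e)
    ... | inj₂ d₁ with euclidsLemma ℤ.∣ a ∣ (ℓ ℕ.* ℤ.∣ D ∣) qq d₁
    ... | inj₁ e = inj₂ (inj₁ (∣ᵤ⇒∣ e))
    ... | inj₂ d₂ with euclidsLemma ℓ ℤ.∣ D ∣ qq d₂
    ... | inj₁ e = inj₂ (inj₂ (inj₁ (∣ᵤ⇒∣ e)))
    ... | inj₂ e = inj₂ (inj₂ (inj₂ (∣ᵤ⇒∣ e)))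

  -- All primes dividing a value of the form x² + D y² at coprime arguments split, so the value itself is a multiplier
  -- of D that keeps the total up to a unit modulo ℓ.
  norm-descent : ∀ D → 0ℤ < D → ∀ s → NoCommonPrime s (+ level D) → VanishOn (s * s) D → Vanish D
  norm-descent D D>0 s cop v = split-descent D>0 n (<-wellFounded n) {{n≢0}} all-split ℓ∤n
      (v (+ n) (λ e → positive⇒≢0 norm>0 (trans (sym n≡) e)) (∣-comb (y * D) 0ℤ (a∣level D) ∣-refl (trans (cong (_- s * s) n≡) (ring s D y a))))
    where
    y : ℤ
    -- Divisibility by a makes the norm congruent to s² modulo a. A prime dividing both the norm and
    -- `y` would divide s, so the norm is coprime to the level.
    y = + level D
    norm : ℤ
    norm = s * s + D * y * y
    y≢0 : y ≢ 0ℤ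
    y≢0 e = ℕ.≢-nonZero⁻¹ (level D) {{level≢0 D D>0}} (ℤ.+-injective e)
    norm>0 : 0ℤ < norm
    norm>0 = ℤ.+-mono-≤-< (square≥0 s) (subst (0ℤ <_) (sym (ℤ.*-assoc D y y)) (*-positive D>0 (square-positive y≢0)))
      where
      square≥0 : ∀ s → 0ℤ ≤ s * s
      square≥0 s = subst (0ℤ ≤_) (sym (square-abs s)) (+≤+ ℕ.z≤n)
    n : ℕ
    n = ℤ.∣ norm ∣
    n≡ : + n ≡ norm
    n≡ = ℤ.0≤i⇒+∣i∣≡i (ℤ.<⇒≤ norm>0)
    n≢0 : ℕ.NonZero n
    n≢0 = ℕ.≢-nonZero λ e → positive⇒≢0 norm>0 (trans (sym n≡) (cong +_ e))
    ring : ∀ s D y a → s * s + D * y * y - s * s ≡ y * D * y + 0ℤ * a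
    ring = solve 4 (λ s D y a → s :* s :+ D :* y :* y :- s :* s := y :* D :* y :+ con 0ℤ :* a) refl
    q∤level : ∀ q → Prime q → q ℕ.∣ n → ¬ + q ∣ y
    q∤level q qq q∣n q∣y = cop q qq (ModPrime.square⇒∣ q qq s (∣-comb 1ℤ (- (D * y)) (subst (+ q ∣_) n≡ (∣ᵤ⇒∣ {+ q} {+ n} q∣n)) q∣y
      (solve 3 (λ s D y → s :* s := con 1ℤ :* (s :* s :+ D :* y :* y) :+ (:- (D :* y)) :* y) refl s D y))) q∣y
    ℓ∤n : ¬ ℓ ℕ.∣ n
    ℓ∤n d = q∤level ℓ ℓ-prime d (ℓ∣level D)
    all-split : AllSplit D>0 n
    all-split q qq q∣n = (λ d → q∤y (2∣level D d)) , (λ d → q∤y (∣-trans d (D∣level D))) , root (ModPrime.inverse q qq y q∤y)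
      where
      q∤y : ¬ + q ∣ y
      q∤y = q∤level q qq q∣n
      root : (Σ ℤ λ z → + q ∣ z * y - 1ℤ) → Σ ℤ λ r → + q ∣ r * r + D
      -- With z inverse to y modulo q, dividing s² + D y² ≡ 0 by y² gives (s z)² ≡ - D.
      root (z , d) = s * z , ∣-comb (z * z) (- (D * (z * y + 1ℤ))) (subst (+ q ∣_) n≡ (∣ᵤ⇒∣ {+ q} {+ n} q∣n)) d
        (solve 4 (λ s D y z → s :* z :* (s :* z) :+ D := z :* z :* (s :* s :+ D :* y :* y) :+ (:- (D :* (z :* y :+ con 1ℤ))) :* (z :* y :- con 1ℤ)) refl s D y z)

  vanishOn-resp : ∀ {c c′ D} → a ∣ c - c′ → VanishOn c D → VanishOn c′ D
  vanishOn-resp {c} {c′} d v x x≢0 e = v x x≢0 (∣-comb 1ℤ -1ℤ e d (solve 3 (λ x c c′ → x :- c := con 1ℤ :* (x :- c′) :+ con -1ℤ :* (c :- c′)) refl x c c′))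

  vanishOn-scale : ∀ {c c′ D D′} m → m ≢ 0ℤ → D′ ≡ m * m * D → (∀ x → a ∣ x - c′ → a ∣ m * x - c) → VanishOn c D → VanishOn c′ D′
  vanishOn-scale {D = D} m m≢0 refl f v x x≢0 e = subst Vanish (solve 3 (λ m x D → m :* x :* (m :* x) :* D := x :* x :* (m :* m :* D)) refl m x D)
    (v (m * x) mx≢0 (f x e))
    where
    mx≢0 : m * x ≢ 0ℤ
    mx≢0 e with ℤ.i*j≡0⇒i≡0∨j≡0 m e
    ... | inj₁ z = m≢0 z
    ... | inj₂ z = x≢0 z

  -- Induction on w: a square factor of w is moved into s; a prime p exactly dividing w is removed by passing from D
  -- to p²D and p⁶D, since p³ and p lie in the same class modulo squares.
  square-class-descent : ∀ w → Acc ℕ._<_ w → .{{ℕ.NonZero w}} → ∀ D → 0ℤ < D → ∀ s → NoCommonPrime s a →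
    NoCommonPrime (+ w) (+ level D) → VanishOn (+ w * (s * s)) D → Vanish D
  square-class-descent 1 _ D D>0 s cop _ v = base (shift-coprime a s (level D) cop {{level≢0 D D>0}})
    where
    base : (Σ ℤ λ k → NoCommonPrime (s + a * k) (+ level D)) → Vanish D
    -- Only the residue of s modulo a matters, so s may be moved within it to be coprime to the
    -- whole level.
    base (k , cop′) = norm-descent D D>0 (s + a * k) cop′ (vanishOn-resp (divides (- (k * (+ 2 * s + a * k)))
      (solve 3 (λ s a k → con 1ℤ :* (s :* s) :- (s :+ a :* k) :* (s :+ a :* k) := (:- (k :* (con (+ 2) :* s :+ a :* k))) :* a) refl s a k)) v)
  square-class-descent w@(suc (suc _)) (acc rec) D D>0 s cop copw v = cases (prime-factor w (ℕ.s≤s ℕ.z<s))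
    where
    cases : (Σ ℕ λ p → Prime p × p ℕ.∣ w) → Vanish D
    cases (p , pp , ℕ.divides w₁ w≡) = split? (p ℕ.∣? w₁)
      where
      P = + p
      open ModPrime p pp using (P>0; inverse; ∤⇒coprime)
      instance
        w₁p≢0 : ℕ.NonZero (w₁ ℕ.* p)
        w₁p≢0 = subst ℕ.NonZero w≡ _
        w₁≢0 : ℕ.NonZero w₁
        w₁≢0 = ℕ.m*n≢0⇒m≢0 w₁ {p}
      P∣w : P ∣ + w
      P∣w = ∣ᵤ⇒∣ (ℕ.divides w₁ w≡)
      P∤level : ¬ P ∣ + level D
      P∤level = copw p pp P∣w
      P∤2 : ¬ P ∣ + 2
      P∤2 d = P∤level (2∣level D d)
      P∤a : ¬ P ∣ a
      P∤a d = P∤level (∣-trans d (a∣level D))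
      P∤D : ¬ P ∣ D
      P∤D d = P∤level (∣-trans d (D∣level D))
      ℓ∤p : ¬ ℓ ℕ.∣ p
      ℓ∤p d = P∤level (subst (λ t → + t ∣ + level D) (prime∣prime pp ℓ-prime d) (ℓ∣level D))
      1<p : 1 ℕ.< p
      1<p = ℕ.nonTrivial⇒n>1 p {{prime⇒nonTrivial pp}}
      w≡′ : + w ≡ + w₁ * P
      w≡′ = trans (cong +_ w≡) (ℤ.pos-* w₁ p)
      w₁<w : w₁ ℕ.< w
      w₁<w = subst (w₁ ℕ.<_) (sym w≡) (ℕ.m<m*n w₁ p 1<p)
      P≢0 : P ≢ 0ℤ
      P≢0 = positive⇒≢0 P>0
      split? : Dec (p ℕ.∣ w₁) → Vanish D
      split? (yes (ℕ.divides w₂ w₁≡)) = square-class-descent w₂ (rec w₂<w) {{w₂≢0}} D D>0 (s * P) cop-sp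
          (λ q qq q∣w₂ → copw q qq (subst (+ q ∣_) (sym w≡″) (∣m⇒∣m*n P (∣m⇒∣m*n P q∣w₂))))
          (subst (λ c → VanishOn c D) (trans (cong (_* (s * s)) w≡″) (solve 3 (λ w p s → w :* p :* p :* (s :* s) := w :* (s :* p :* (s :* p))) refl (+ w₂) P s)) v)
        where
        w₂p≢0 : ℕ.NonZero (w₂ ℕ.* p)
        w₂p≢0 = subst ℕ.NonZero w₁≡ w₁≢0
        w₂≢0 : ℕ.NonZero w₂
        w₂≢0 = ℕ.m*n≢0⇒m≢0 w₂ {p} {{w₂p≢0}}
        w₂<w : w₂ ℕ.< w
        w₂<w = ℕ.<-trans (subst (w₂ ℕ.<_) (sym w₁≡) (ℕ.m<m*n w₂ p {{w₂≢0}} 1<p)) w₁<w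
        w≡″ : + w ≡ + w₂ * P * P
        w≡″ = trans w≡′ (cong (_* P) (trans (cong +_ w₁≡) (ℤ.pos-* w₂ p)))
        cop-sp : NoCommonPrime (s * P) a
        cop-sp q qq d q∣a with euclidℤ qq s P d
        ... | inj₁ e = cop q qq e q∣a
        ... | inj₂ e = P∤a (subst (λ t → + t ∣ a) (prime∣prime pp qq (∣⇒∣ᵤ e)) q∣a)
      split? (no p∤w₁) = remove (bezout P a (Coprime.sym (∤⇒coprime a P∤a)))
        where
        -- Passing to p²D or p⁶D adds only p to the primes of the level, and p ∤ w₁; this keeps the
        -- invariant of the induction.
        cop₁ : ∀ {D′} → (∀ q → Prime q → + q ∣ D′ → + q ∣ P ⊎ + q ∣ D) → NoCommonPrime (+ w₁) (+ level D′)
        cop₁ {D′} f q qq q∣w₁ d = [ (λ e → q∤ (2∣level D e)) , [ (λ e → q∤ (∣-trans e (a∣level D))) , [ (λ e → q∤ (∣-trans e (ℓ∣level D))) , (λ e → [ from-P , (λ e → q∤ (∣-trans e (D∣level D))) ] (f q qq e)) ] ] ] (level-prime D′ q qq d)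
          where
          q∤ : ¬ + q ∣ + level D
          q∤ = copw q qq (subst (+ q ∣_) (sym w≡′) (∣m⇒∣m*n P q∣w₁))
          from-P : ¬ + q ∣ P
          from-P e = p∤w₁ (subst (ℕ._∣ w₁) (prime∣prime pp qq (∣⇒∣ᵤ e)) (∣⇒∣ᵤ q∣w₁))
        peel : ∀ {E} → (∀ q → Prime q → + q ∣ E → + q ∣ P ⊎ + q ∣ D) → ∀ q → Prime q → + q ∣ P * P * E → + q ∣ P ⊎ + q ∣ D
        peel {E} f q qq d with euclidℤ qq (P * P) E d
        ... | inj₂ e = f q qq e
        ... | inj₁ e with euclidℤ qq P P e
        ... | inj₁ e′ = inj₁ e′
        ... | inj₂ e′ = inj₁ e′
        PP>0 : 0ℤ < P * P
        PP>0 = *-positive P>0 P>0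
        PPP≢0 : P * P * P ≢ 0ℤ
        PPP≢0 = positive⇒≢0 (*-positive PP>0 P>0)
        D₁ = P * P * D
        D₃ = P * P * (P * P * (P * P * D))
        v₁ : VanishOn (+ w₁ * (s * s)) D₁
        v₁ = vanishOn-scale P P≢0 refl (λ x e → ∣-mult P e (trans (cong (λ t → P * x - t * (s * s)) w≡′)
          (solve 4 (λ P x w s → P :* x :- w :* P :* (s :* s) := P :* (x :- w :* (s :* s))) refl P x (+ w₁) s))) v
        remove : (Σ ℤ λ z → Σ ℤ λ t → z * P + t * a ≡ 1ℤ) → Vanish D
        remove (z , t , zP) = prime-descent p pp P∤2 D>0 P∤D ℓ∤p
            (square-class-descent w₁ (rec w₁<w) D₁ (*-positive PP>0 D>0) s cop (cop₁ (peel λ q qq → inj₂)) v₁)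
            (square-class-descent w₁ (rec w₁<w) D₃ (*-positive PP>0 (*-positive PP>0 (*-positive PP>0 D>0))) (s * z) cop-sz (cop₁ (peel (peel (peel λ q qq → inj₂)))) v₃)
          where
          cop-sz : NoCommonPrime (s * z) a
          cop-sz q qq d q∣a with euclidℤ qq s z d
          ... | inj₁ e = cop q qq e q∣a
          ... | inj₂ e = coprime-cancel t zP q qq e q∣a
          v₃ : VanishOn (+ w₁ * (s * z * (s * z))) D₃
          -- As z inverts P modulo a, P³ w₁ (s z)² ≡ P w₁ s² = w s². The power P³ is thus absorbed
          -- by replacing s with s z.
          v₃ = vanishOn-scale (P * P * P) PPP≢0 (solve 2 (λ P D → P :* P :* (P :* P :* (P :* P :* D)) := P :* P :* P :* (P :* P :* P) :* D) refl P D)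
            (λ x e → ∣-comb (P * P * P) (- (+ w₁ * P * (s * s) * (z * P + 1ℤ) * t)) e ∣-refl
              (trans (cong (λ u → P * P * P * x - u * (s * s)) w≡′) (congruence x))) v
            where
            congruence : ∀ x → P * P * P * x - + w₁ * P * (s * s) ≡ P * P * P * (x - + w₁ * (s * z * (s * z))) + - (+ w₁ * P * (s * s) * (z * P + 1ℤ) * t) * a
            congruence x = trans (poly₁ P x (+ w₁) s z) (trans (cong (λ u → P * P * P * (x - + w₁ * (s * z * (s * z))) + + w₁ * P * (s * s) * (z * P + 1ℤ) * u)
                (trans (cong (λ u → z * P - u) (sym zP)) (poly₂ (z * P) t a))) (poly₃ (P * P * P * (x - + w₁ * (s * z * (s * z)))) (+ w₁ * P * (s * s) * (z * P + 1ℤ)) t a))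
              where
              poly₁ : ∀ P x w s z → P * P * P * x - w * P * (s * s) ≡ P * P * P * (x - w * (s * z * (s * z))) + w * P * (s * s) * (z * P + 1ℤ) * (z * P - 1ℤ)
              poly₁ = solve 5 (λ P x w s z → P :* P :* P :* x :- w :* P :* (s :* s) := P :* P :* P :* (x :- w :* (s :* z :* (s :* z))) :+ w :* P :* (s :* s) :* (z :* P :+ con 1ℤ) :* (z :* P :- con 1ℤ)) refl
              poly₂ : ∀ u t a → u - (u + t * a) ≡ - (t * a)
              poly₂ = solve 3 (λ u t a → u :- (u :+ t :* a) := :- (t :* a)) refl
              poly₃ : ∀ u v t a → u + v * - (t * a) ≡ u + - (v * t) * a
              poly₃ = solve 4 (λ u v t a → u :+ v :* :- (t :* a) := u :+ (:- (v :* t)) :* a) refl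

  -- Move s within its residue class to a nonzero s′ coprime to the level and start the induction at
  -- w = |s′| with trivial square part. The sign is harmless because only x² enters.
  class-descent : ∀ D → 0ℤ < D → ∀ s → NoCommonPrime s a → VanishOn s D → Vanish D
  class-descent D D>0 s cop v = via (shift-coprime a s (level D) cop {{level≢0 D D>0}})
    where
    via : (Σ ℤ λ k → NoCommonPrime (s + a * k) (+ level D)) → Vanish D
    via (k , cop′) = square-class-descent w (<-wellFounded w) {{w≢0}} D D>0 1ℤ (λ q qq d _ → ModPrime.∤1 q qq d)
        (λ q qq d → cop′ q qq (∣-trans d ∣m∣∣m)) (signed w≡±)
      where
      s′ = s + a * k
      s′≢0 : s′ ≢ 0ℤ
      s′≢0 = nonzero (ℤ.∣ a ∣ ℕ.* (ℓ ℕ.* ℤ.∣ D ∣)) {{level-factor D D>0}} cop′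
      w = ℤ.∣ s′ ∣
      w≢0 : ℕ.NonZero w
      w≢0 = ℕ.≢-nonZero λ e → s′≢0 (ℤ.∣i∣≡0⇒i≡0 e)
      v′ : VanishOn s′ D
      v′ = vanishOn-resp (divides (- k) (solve 3 (λ s a k → s :- (s :+ a :* k) := (:- k) :* a) refl s a k)) v
      w≡± : s′ ≡ + w ⊎ s′ ≡ - (+ w)
      w≡± = abs-cases s′
        where
        abs-cases : ∀ x → x ≡ + ℤ.∣ x ∣ ⊎ x ≡ - (+ ℤ.∣ x ∣)
        abs-cases (+ n) = inj₁ refl
        abs-cases -[1+ n ] = inj₂ refl
      signed : s′ ≡ + w ⊎ s′ ≡ - (+ w) → VanishOn (+ w * (1ℤ * 1ℤ)) D
      signed (inj₁ e) = subst (λ c → VanishOn c D) (trans e (sym (ℤ.*-identityʳ (+ w)))) v′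
      signed (inj₂ e) = vanishOn-scale -1ℤ (λ ()) (solve 1 (λ D → D := con -1ℤ :* con -1ℤ :* D) refl D)
        (λ x d → ∣-mult -1ℤ d (trans (cong (λ t → -1ℤ * x - t) e) (solve 2 (λ x w → con -1ℤ :* x :- :- w := con -1ℤ :* (x :- w :* (con 1ℤ :* con 1ℤ))) refl x (+ w)))) v′

-- Conclusion from the hypothesis on the progression.

gcd≡1⇒bezout : ∀ u a → gcd u a ≡ 1ℤ → Σ ℤ λ s → Σ ℤ λ t → s * u + t * a ≡ 1ℤ
gcd≡1⇒bezout u a e = bezout u a (Coprime.gcd≡1⇒coprime (ℤ.+-injective e))

theoremB : (ℓ : ℕ) → Prime ℓ → 3 ℕ.< ℓ → (a : ℤ) → 1ℤ ≤ a → (b : ℤ) →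
             ((n : ℤ) (h : ℚ) → IsHurwitz (a * n + b) h → ZeroMod ℓ h) →
             (u : ℤ) → gcd u a ≡ 1ℤ → (n : ℤ) (h : ℚ) →
             IsHurwitz (a * n + b * (u * u)) h → ZeroMod ℓ h
theoremB ℓ ℓ-prime 3<ℓ a a≥1 b hyp u gcd≡1 n h = conclude refl
  where
  open Descent ℓ ℓ-prime
  open SquareClass ℓ ℓ-prime a a≥1
  bez = gcd≡1⇒bezout u a gcd≡1
  s = proj₁ bez
  t = proj₁ (proj₂ bez)
  su+ta : s * u + t * a ≡ 1ℤ
  su+ta = proj₂ (proj₂ bez)

  -- The hypothesis speaks of an actual Hurwitz number, so a system is taken under the double
  -- negation and compared with `X` by `total-unique`.
  hyp-vanish : ∀ {D} → 0ℤ < D → DiscCong D → (Σ ℤ λ m → D ≡ a * m + b) → Vanish D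
  hyp-vanish {D} D>0 dc (m , refl) X = decidable-stable (ℓ ℕ.∣? total X) λ ¬d → ¬¬-system D D>0 λ 𝒮@(system reps valid ineq exh) →
    ¬d (subst (ℓ ℕ.∣_) (total-unique (classes 𝒮) X) (zeroMod⇒∣ ℓ ℓ-prime 3<ℓ (hurwitz-total 𝒮) (hyp m (hurwitz 𝒮) (hPos D>0 dc reps valid ineq exh))))

  -- The argument is a variable tied down by an equation, so that the three constructors of
  -- `IsHurwitz` can be matched.
  conclude : ∀ {D} → D ≡ a * n + b * (u * u) → IsHurwitz D h → ZeroMod ℓ h
  conclude e (hOther _ _) = ℕ.divides 0 refl
  conclude e hZero = hyp m _ (subst (λ D → IsHurwitz D (-[1+ 0 ] ℚ./ 12)) D₀ hZero)
    where
    -- m comes from b (1 - (su)²) = a b t (1 + su) and b u² = - a n.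
    m = n * s * s - b * t * (+ 1 + s * u)
    D₀ : 0ℤ ≡ a * m + b
    D₀ = sym (trans (poly₁ a n s b t u) (trans (cong (λ z → s * s * z + b * (1ℤ - s * u) * (1ℤ + s * u) - a * (b * t * (1ℤ + s * u))) (sym e))
      (trans (cong (λ z → s * s * 0ℤ + b * (z - s * u) * (1ℤ + s * u) - a * (b * t * (1ℤ + s * u))) (sym su+ta)) (poly₂ a s b t u))))
      where
      poly₁ : ∀ a n s b t u → a * (n * s * s - b * t * (+ 1 + s * u)) + b ≡ s * s * (a * n + b * (u * u)) + b * (1ℤ - s * u) * (1ℤ + s * u) - a * (b * t * (1ℤ + s * u))
      poly₁ = solve 6 (λ a n s b t u → a :* (n :* s :* s :- b :* t :* (con (+ 1) :+ s :* u)) :+ b := s :* s :* (a :* n :+ b :* (u :* u)) :+ b :* (con 1ℤ :- s :* u) :* (con 1ℤ :+ s :* u) :- a :* (b :* t :* (con 1ℤ :+ s :* u))) refl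
      poly₂ : ∀ a s b t u → s * s * 0ℤ + b * (s * u + t * a - s * u) * (1ℤ + s * u) - a * (b * t * (1ℤ + s * u)) ≡ 0ℤ
      poly₂ = solve 5 (λ a s b t u → s :* s :* con 0ℤ :+ b :* (s :* u :+ t :* a :- s :* u) :* (con 1ℤ :+ s :* u) :- a :* (b :* t :* (con 1ℤ :+ s :* u)) := con 0ℤ) refl
  conclude {D} e (hPos D>0 dc reps valid ineq exh) = ∣⇒zeroMod ℓ ℓ-prime 3<ℓ (hurwitz-total 𝒮) (class-descent D D>0 s (coprime-cancel t su+ta) vanish (classes 𝒮))
    where
    𝒮 : System D
    𝒮 = system reps valid ineq exh
    vanish : VanishOn s D
    vanish x x≢0 (divides k x-s) = hyp-vanish (*-positive (square-positive x≢0) D>0) (discCong-square x {D} dc) (m , x²D)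
      where
      -- Here x u - 1 = (x - s) u + (s u - 1) = a (k u - t), and b (x u)² - b = b (x u - 1) (x u +
      -- 1).
      m = n * x * x + b * (k * u - t) * (x * u + 1ℤ)
      x²D : x * x * D ≡ a * m + b
      x²D = trans (cong (x * x *_) e) (trans (poly₁ a n x b u s) (trans (cong₂ (λ y z → x * x * (a * n) + b * (y * u + s * u - z) * (x * u + 1ℤ) + b) x-s (sym su+ta)) (poly₂ a n x b u s k t)))
        where
        poly₁ : ∀ a n x b u s → x * x * (a * n + b * (u * u)) ≡ x * x * (a * n) + b * ((x - s) * u + s * u - 1ℤ) * (x * u + 1ℤ) + b
        poly₁ = solve 6 (λ a n x b u s → x :* x :* (a :* n :+ b :* (u :* u)) := x :* x :* (a :* n) :+ b :* ((x :- s) :* u :+ s :* u :- con 1ℤ) :* (x :* u :+ con 1ℤ) :+ b) refl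
        poly₂ : ∀ a n x b u s k t → x * x * (a * n) + b * (k * a * u + s * u - (s * u + t * a)) * (x * u + 1ℤ) + b ≡ a * (n * x * x + b * (k * u - t) * (x * u + 1ℤ)) + b
        poly₂ = solve 8 (λ a n x b u s k t → x :* x :* (a :* n) :+ b :* (k :* a :* u :+ s :* u :- (s :* u :+ t :* a)) :* (x :* u :+ con 1ℤ) :+ b := a :* (n :* x :* x :+ b :* (k :* u :- t) :* (x :* u :+ con 1ℤ)) :+ b) refl
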